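{- The labelled descent-to-peak map $\Theta_{\mathrm{NCQSym}}:\mathrm{NCQSym}\to\mathrm{NC}\Pi$ is a morphism of Hopf algebras. Hence $\mathrm{NC}\Pi$ is both a Hopf subalgebra and a quotient Hopf algebra of $\mathrm{NCQSym}$.
   Context: Let $\mathbf x_1,\mathbf x_2,\dots$ be noncommuting variables over $\mathbb Q$; $[m]=\{1,\dots,m\}$. For a set composition $\phi=\phi_1|\cdots|\phi_\ell$ of $[n]$ (sequence of disjoint nonempty blocks with union $[n]$), $\mathbf M_\phi=\sum\mathbf x_{i_1}\cdots\mathbf x_{i_n}$ over tuples of positive integers with $i_j=i_k$ iff $j,k$ in the same block and $i_j<i_k$ iff the block of $j$ is left of the block of $k$; $\mathrm{NCQSym}=\bigoplus_n\mathrm{span}\{\mathbf M_\phi\}$, a Hopf algebra with product the product of power series and coproduct $\Delta$ obtained by substituting an alphabet $\mathbf x_1<\mathbf x_2<\cdots<\mathbf y_1<\mathbf y_2<\cdots$, imposing $\mathbf x_i\mathbf y_j=\mathbf y_j\mathbf x_i$, and identifying the result with an element of $\mathrm{NCQSym}(\mathbf x)\otimes\mathrm{NCQSym}(\mathbf y)\cong\mathrm{NCQSym}\otimes\mathrm{NCQSym}$; explicitly $\Delta(\mathbf M_\phi)=\sum_{k=0}^{\ell}\mathbf M_{\mathrm{st}(\phi_1|\cdots|\phi_k)}\otimes\mathbf M_{\mathrm{st}(\phi_{k+1}|\cdots|\phi_\ell)}$, where $\mathrm{st}$ relabels the elements by $1,2,\dots$ preserving relative order. For $A=\{a_1<\dots<a_k\}\subseteq[n-1]$,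 $\sigma\in\mathfrak S_n$, $\mathbf F_{(A,\sigma)}=\sum_f\mathbf x_{f(\sigma^{ -1}(1))}\cdots\mathbf x_{f(\sigma^{ -1}(n))}$ over weakly increasing $f:[n]\to\{1,2,\dots\}$ with $f(i)<f(i+1)$ for $i\in A$; the $\mathbf F_{(A,\sigma)}$ with $\mathrm{Des}(\sigma)\subseteq A$ ("standard") form a basis of $\mathrm{NCQSym}$. Order nonzero integers by $-1\prec1\prec-2\prec2\prec\cdots$. For a poset $P$ on an $n$-set $X$ and bijections $\gamma,\sigma:X\to[n]$, an enriched $(P,\gamma)$-partition is $f:X\to\mathbb Z\setminus\{0\}$ with, for $a\le b$: $f(a)\preceq f(b)$, $f(a)=f(b)>0\Rightarrow\gamma(a)<\gamma(b)$, $f(a)=f(b)<0\Rightarrow\gamma(a)>\gamma(b)$; $\mathbf K_{(P,\gamma,\sigma)}=\sum_f\mathbf x_{|f(\sigma^{ -1}(1))|}\cdots\mathbf x_{|f(\sigma^{ -1}(n))|}$. $\mathrm{NC}\Pi$ is the span of all $\mathbf K_{(P,\gamma,\sigma)}$ (a subspace of $\mathrm{NCQSym}$). For a peak set $B$ (subset of $\{2,\dots,n-1\}$ with no two consecutive integers), $\mathbf K_{(B,\sigma)}=\mathbf K_{(P,\gamma,\sigma)}$ with $P$ the chain $1<\cdots<n$ and any $\gamma\in\mathfrak S_n$ with $\{i:\gamma(i-1)<\gamma(i)>\gamma(i+1)\}=B$ (well defined). $\Theta_{\mathrm{NCQSym}}$ is the linear map with $\mathbf F_{(A,\sigma)}\mapsto\mathbf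 K_{(A\setminus((A+1)\cup\{1\}),\sigma)}$ for standard $(A,\sigma)$, $A+1=\{a+1:a\in A\}$. -}

module Defs where

open import Level using (0ℓ)
open import Data.Bool using (Bool; true; false; _∧_; _∨_; not; if_then_else_)
open import Data.Nat using (ℕ; zero; suc; _∸_; _≤ᵇ_; _<ᵇ_; _≡ᵇ_; _<?_; _⊔_)
import Data.Nat as ℕ
open import Data.Fin using (Fin; toℕ; fromℕ<)
import Data.Fin as Fin
import Data.Fin.Properties as FinP
open import Data.Fin.Permutation using (Permutation′; _⟨$⟩ʳ_)
open import Data.List using (List; []; _∷_; map; _++_; length; take; drop; foldr; upTo; allFin)
open import Data.Vec using (Vec; []; _∷_; lookup)
open import Data.Rational using (ℚ; 0ℚ; 1ℚ; _+_; _*_)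
open import Data.Product using (Σ; _×_; _,_; proj₁; proj₂)
open import Data.List.Relation.Unary.All using (All)
open import Relation.Binary.Core using (Rel)
open import Relation.Binary.Definitions using (Decidable)
open import Relation.Binary.Structures using (IsPartialOrder)
open import Relation.Binary.PropositionalEquality using (_≡_)
open import Relation.Nullary.Decidable using (⌊_⌋; yes; no)

-- Noncommutative power series over ℚ in x₁, x₂, ….
-- A monomial x_{i₁}⋯x_{iₙ} is encoded by the word (i₁ - 1) ∷ ⋯ ∷ (iₙ - 1)
-- (letter k : ℕ stands for the variable x_{k+1}); a series is its
-- coefficient function.  Two series are equal iff all coefficients agree.

Series : Set
Series = List ℕ → ℚ

-- completed tensor product: coefficient of (x-word) ⊗ (y-word)
Series₂ : Set
Series₂ = List ℕ → List ℕ → ℚ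

_≈_ : Series → Series → Set
f ≈ g = ∀ w → f w ≡ g w

_≈₂_ : Series₂ → Series₂ → Set
f ≈₂ g = ∀ u v → f u v ≡ g u v

allᵇ : {X : Set} → (X → Bool) → List X → Bool
allᵇ p = foldr (λ x b → p x ∧ b) true

sumℚ : List ℚ → ℚ
sumℚ = foldr _+_ 0ℚ

𝟙 : Series
𝟙 [] = 1ℚ
𝟙 (_ ∷ _) = 0ℚ

counit : Series → ℚ
counit f = f []

_⋆_ : Series → Series → Series
(f ⋆ g) w = sumℚ (map (λ k → f (take k w) * g (drop k w)) (upTo (suc (length w))))

shuffles : List ℕ → List ℕ → List (List ℕ)
shuffles [] ys = ys ∷ []
shuffles (x ∷ xs) [] = (x ∷ xs) ∷ []
shuffles (x ∷ xs) (y ∷ ys) =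
  map (x ∷_) (shuffles xs (y ∷ ys)) ++ map (y ∷_) (shuffles (x ∷ xs) ys)

maxL : List ℕ → ℕ
maxL = foldr _⊔_ 0

-- Coproduct: substitute the alphabet x₁<x₂<⋯<y₁<y₂<⋯, let x's commute with
-- y's.  The coefficient of x_u ⊗ y_v is the sum of the coefficients of all
-- words in the merged alphabet whose x-subword is u and y-subword is v;
-- the merged alphabet is realised inside x₁,x₂,… order-preservingly by
-- shifting the y-letters above all letters of u (legitimate on NCQSym,
-- whose elements depend only on the relative order of letters).
Δ : Series → Series₂
Δ f u v = sumℚ (map f (shuffles u (map (λ j → j ℕ.+ suc (maxL u)) v)))

nth : List ℕ → ℕ → ℕ
nth [] _ = 0
nth (x ∷ _) zero = x
nth (_ ∷ xs) (suc k) = nth xs k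

-- a permutation of [n] viewed as a map ℕ → ℕ on 1-based positions 1..n
-- (values 1..n); junk value 0 outside.
permℕ : {n : ℕ} → Permutation′ n → ℕ → ℕ
permℕ {n} σ i with (i ∸ 1) <? n
... | yes p = suc (toℕ (σ ⟨$⟩ʳ fromℕ< p))
... | no _ = 0

record Pair : Set where
  constructor pair
  field
    deg : ℕ
    A   : ℕ → Bool            -- A ⊆ [deg - 1] as a characteristic function
    σ   : Permutation′ deg
open Pair public

Des : {n : ℕ} → Permutation′ n → ℕ → Bool
Des {n} σ i = (1 ≤ᵇ i) ∧ (i <ᵇ n) ∧ (permℕ σ (suc i) <ᵇ permℕ σ i)

IsStandard : Pair → Set
IsStandard α =
  (∀ i → A α i ≡ true → (1 ℕ.≤ i) × (i ℕ.< deg α)) ×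
  (∀ i → Des (σ α) i ≡ true → A α i ≡ true)

-- coefficient of the monomial w in F_(A,σ): the unique candidate f is
-- f(i) = w_{σ(i)} (since w_j = f(σ⁻¹(j))); it must be weakly increasing
-- with strict ascents at A.
F : Pair → Series
F (pair n A σ) w =
  if (length w ≡ᵇ n) ∧ allᵇ ok (map suc (upTo (n ∸ 1))) then 1ℚ else 0ℚ
  where
    f : ℕ → ℕ
    f i = nth w (permℕ σ i ∸ 1)
    ok : ℕ → Bool
    ok k = (f k ≤ᵇ f (suc k)) ∧ (not (A k) ∨ (f k <ᵇ f (suc k)))

record FinPoset (n : ℕ) : Set₁ where
  field
    _≤P_  : Rel (Fin n) 0ℓ
    isPO  : IsPartialOrder _≡_ _≤P_
    dec   : Decidable _≤P_
open FinPoset public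

chain : (n : ℕ) → FinPoset n
chain n = record { _≤P_ = Fin._≤_ ; isPO = FinP.≤-isPartialOrder ; dec = FinP._≤?_ }

-- all sign vectors (true = positive value, false = negative value)
allSigns : (n : ℕ) → List (Vec Bool n)
allSigns zero = [] ∷ []
allSigns (suc n) = map (true ∷_) (allSigns n) ++ map (false ∷_) (allSigns n)

-- An enriched (P,γ)-partition f with |f(σ⁻¹(j))| = letter j of w is
-- determined by its signs; |f(x)| = w_{σ(x)} + 1.  The conditions are
-- imposed for a <_P b (strictly).  Order ≺ : -1 ≺ 1 ≺ -2 ≺ 2 ≺ ⋯.
K : {n : ℕ} → FinPoset n → Permutation′ n → Permutation′ n → Series
K {n} P γ σ w = if length w ≡ᵇ n then sumℚ (map count (allSigns n)) else 0ℚ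
  where
    count : Vec Bool n → ℚ
    count s = if allᵇ (λ a → allᵇ (cond a) (allFin n)) (allFin n) then 1ℚ else 0ℚ
      where
        mag : Fin n → ℕ
        mag x = suc (nth w (toℕ (σ ⟨$⟩ʳ x)))
        cond : Fin n → Fin n → Bool
        cond a b =
          not (⌊ dec P a b ⌋ ∧ not ⌊ a Fin.≟ b ⌋) ∨
            (((mag a <ᵇ mag b) ∨ ((mag a ≡ᵇ mag b) ∧ (not sa ∨ sb)))
            ∧ (not ((mag a ≡ᵇ mag b) ∧ sa ∧ sb) ∨ (toℕ (γ ⟨$⟩ʳ a) <ᵇ toℕ (γ ⟨$⟩ʳ b)))
            ∧ (not ((mag a ≡ᵇ mag b) ∧ not sa ∧ not sb) ∨ (toℕ (γ ⟨$⟩ʳ b) <ᵇ toℕ (γ ⟨$⟩ʳ a))))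
          where
            sa = lookup s a
            sb = lookup s b

-- data (n, P, γ, σ) indexing the spanning set of NCΠ
KData : Set₁
KData = Σ ℕ (λ n → FinPoset n × Permutation′ n × Permutation′ n)

Kof : KData → Series
Kof (n , P , γ , σ) = K P γ σ

Peak : {n : ℕ} → Permutation′ n → ℕ → Bool
Peak {n} γ i = (2 ≤ᵇ i) ∧ (i <ᵇ n) ∧
  (permℕ γ (i ∸ 1) <ᵇ permℕ γ i) ∧ (permℕ γ (suc i) <ᵇ permℕ γ i)

peakOf : Pair → ℕ → Bool
peakOf α i = A α i ∧ not (i ≡ᵇ 1) ∧ not (A α (i ∸ 1))

-- a choice, for every pair α, of a γ used to realise K_(B,σ) = K_(chain,γ,σ)
PeakChoice : Set
PeakChoice = (α : Pair) → Permutation′ (deg α)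

ValidPeakChoice : PeakChoice → Set
ValidPeakChoice g = ∀ α → IsStandard α → ∀ i → Peak (g α) i ≡ peakOf α i

Comb : Set
Comb = List (ℚ × Pair)

Comb₂ : Set
Comb₂ = List (ℚ × Pair × Pair)

StdComb : Comb → Set
StdComb c = All (λ t → IsStandard (proj₂ t)) c

StdComb₂ : Comb₂ → Set
StdComb₂ e = All (λ t → IsStandard (proj₁ (proj₂ t)) × IsStandard (proj₂ (proj₂ t))) e

evalF : Comb → Series
evalF c w = sumℚ (map (λ t → proj₁ t * F (proj₂ t) w) c)

evalF₂ : Comb₂ → Series₂
evalF₂ e u v = sumℚ (map (λ t → proj₁ t * (F (proj₁ (proj₂ t)) u * F (proj₂ (proj₂ t)) v)) e)

-- Θ(F_(A,σ)) = K_(A∖((A+1)∪{1}), σ), extended linearly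
ΘK : PeakChoice → Pair → Series
ΘK g α = K (chain (deg α)) (g α) (σ α)

Θ : PeakChoice → Comb → Series
Θ g c w = sumℚ (map (λ t → proj₁ t * ΘK g (proj₂ t) w) c)

Θ₂ : PeakChoice → Comb₂ → Series₂
Θ₂ g e u v = sumℚ (map (λ t → proj₁ t * (ΘK g (proj₁ (proj₂ t)) u * ΘK g (proj₂ (proj₂ t)) v)) e)

-- elements of NCΠ / NCΠ ⊗ NCΠ as finite combinations of K's
KComb : Set₁
KComb = List (ℚ × KData)

KComb₂ : Set₁
KComb₂ = List (ℚ × KData × KData)

evalK : KComb → Series
evalK a w = sumℚ (map (λ t → proj₁ t * Kof (proj₂ t) w) a)

evalK₂ : KComb₂ → Series₂
evalK₂ e u v = sumℚ (map (λ t → proj₁ t * (Kof (proj₁ (proj₂ t)) u * Kof (proj₂ (proj₂ t)) v)) e)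

{-# OPTIONS --safe #-}
-- Θ is obtained from a one-parameter family of substitutions.  For n ≥ 1 let
-- T n replace every variable by n consecutive ones, the last of which is
-- counted with sign + and the others with sign -.  Being a substitution of
-- ordered alphabets, T n respects products and coproducts.  On a chain the
-- coefficients of T n F_(A,σ) are polynomials in n, and by reciprocity (the
-- n - 1 negative variables become "-1 variables" at n = 0) their values at
-- n = 0 count enriched partitions: they are the coefficients of
-- Θ F_(A,σ).  Every identity between the T n therefore extrapolates to Θ.
-- Linear extensions extend this from chains to all posets, and expanding
-- quasisymmetric series in the standard F_(A,σ) gives the rest.
module Submission where

open import Defs
open import Level using (Level)
open import Function using (_∘_; id; mk⇔)
open import Data.Bool using (Bool; true; false; _∧_; _∨_; not; if_then_else_)
open import Data.Bool.Properties using (⇔→≡; ∧-comm; ∧-identityʳ; ∧-zeroʳ; ∧-conicalˡ; ∧-conicalʳ)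
open import Data.Fin as Fin using (Fin; zero; suc; toℕ; fromℕ<; cast)
import Data.Fin.Properties as FinP
open import Data.Fin.Permutation as Permutation using (Permutation′; _⟨$⟩ʳ_; _⟨$⟩ˡ_; inverseˡ; inverseʳ; cast-id; _∘ₚ_)
open import Data.List using (List; []; _∷_; map; _++_; concatMap; tabulate; allFin; length; upTo; applyUpTo; take; drop; lookup)
open import Data.List.Properties using (map-∘; map-cong; map-tabulate; map-upTo; tabulate-cong; tabulate-lookup; lookup-tabulate; length-map; length-tabulate; length-++; take++drop≡id)
open import Data.List.Membership.Propositional using (_∈_)
open import Data.List.Membership.Propositional.Properties using (∈-allFin; ∈-map⁺)
open import Data.List.Membership.Propositional.Properties.WithK using (unique∧set⇒bag)
open import Data.List.Relation.Binary.BagAndSetEquality using (∼bag⇒↭)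
open import Data.List.Relation.Binary.Permutation.Homogeneous using (onIndices)
open import Data.List.Relation.Binary.Permutation.Propositional as Perm using (_↭_; ↭-refl; ↭-sym; ↭-trans; ↭⇒↭ₛ)
open import Data.List.Relation.Binary.Permutation.Propositional.Properties as PermP using (All-resp-↭; ∈-resp-↭; ↭-length)
open import Data.List.Relation.Binary.Permutation.Setoid.Properties using (onIndices-lookup; Unique-resp-↭)
open import Data.List.Relation.Binary.Pointwise as Pointwise using (Pointwise; []; _∷_; Pointwise-length)
open import Data.List.Relation.Unary.All as All using (All; []; _∷_)
import Data.List.Relation.Unary.All.Properties as AllP
open import Data.List.Relation.Unary.AllPairs as AllPairs using (AllPairs; []; _∷_)
import Data.List.Relation.Unary.AllPairs.Properties as AllPairsP
open import Data.List.Relation.Unary.Any using (here; there)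
open import Data.List.Relation.Unary.Linked using (Linked; []; [-]; _∷_)
open import Data.List.Relation.Unary.Linked.Properties using (AllPairs⇒Linked; Linked⇒AllPairs)
open import Data.List.Relation.Unary.Unique.Propositional using (Unique)
open import Data.List.Relation.Unary.Unique.Propositional.Properties as Unique using (allFin⁺)
open import Data.Nat as ℕ using (ℕ; zero; suc; _∸_; _≤_; _<_; z≤n; s≤s; _≤ᵇ_; _<ᵇ_; _≡ᵇ_; _<?_; _⊔_)
import Data.Nat.Properties as ℕP
open import Data.Product using (Σ; ∃; _×_; _,_; proj₁; proj₂)
open import Data.Rational using (ℚ; 0ℚ; 1ℚ; _+_; _*_; -_; _-_)
open import Data.Rational.Properties using (+-assoc; +-comm; +-identityˡ; +-identityʳ; +-inverseʳ; *-assoc; *-comm; *-identityˡ; *-identityʳ; *-zeroˡ; *-zeroʳ; *-distribˡ-+)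
open import Data.Rational.Solver using (module +-*-Solver)
open import Data.Sum using (_⊎_; inj₁; inj₂)
import Data.Vec as Vec
open import Relation.Binary using (tri<; tri≈; tri>)
open import Relation.Binary.PropositionalEquality
open import Relation.Nullary using (yes; no; does; contradiction)
open import Relation.Nullary.Decidable using (⌊_⌋)
open +-*-Solver using (solve; _:+_; _:*_; _:-_; _:=_; con)

-- Θ is prescribed on combinations of the standard F's, whereas product and coproduct live on
-- coefficient functions, and re-expanding them in that basis is not transparent. T n bridges the
-- two: it acts on coefficient functions, so for n ≥ 1 its value on a combination `c` depends only
-- on `evalF c`. The value at n = 0 is no substitution, since an empty window kills every nonempty
-- word. Hence the value families are glued by cases, the enriched count at 0 and T n above, and
-- what has to be shown is that the glued family is polynomial. Why enriched partitions appear at 0: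
-- if the top letter of a window contributes g and the letter with t ≥ 1 letters above it
-- contributes G t, with G polynomial, the signed sum g - G 1 - ... - G (n - 1) extrapolates to g +
-- G 0, one positive and one negative letter. From the negative letter, a strict step (sum over t' <
-- t) extrapolates at t = 0 to both signs, a weak one (t' ≤ t) to the positive sign alone: the sign
-- rules for equal absolute values.

private
  variable
    a b : Level
    X : Set a
    Y : Set b

-- Finite sums

-1ℚ : ℚ
-1ℚ = - 1ℚ

⟦_⟧ : Bool → ℚ
⟦ b ⟧ = if b then 1ℚ else 0ℚ

⟦∧⟧ : ∀ x y → ⟦ x ∧ y ⟧ ≡ ⟦ x ⟧ * ⟦ y ⟧
⟦∧⟧ true  y = sym (*-identityˡ ⟦ y ⟧)
⟦∧⟧ false y = sym (*-zeroˡ ⟦ y ⟧)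

∑ : List X → (X → ℚ) → ℚ
∑ xs f = sumℚ (map f xs)

∑-cong : (xs : List X) {f g : X → ℚ} → (∀ x → f x ≡ g x) → ∑ xs f ≡ ∑ xs g
∑-cong xs e = cong sumℚ (map-cong e xs)

∑-cong-All : {P : X → Set b} {xs : List X} {f g : X → ℚ} → All P xs → (∀ x → P x → f x ≡ g x) → ∑ xs f ≡ ∑ xs g
∑-cong-All []       e = refl
∑-cong-All (p ∷ ps) e = cong₂ _+_ (e _ p) (∑-cong-All ps e)

∑-0 : (xs : List X) → ∑ xs (λ _ → 0ℚ) ≡ 0ℚ
∑-0 []       = refl
∑-0 (x ∷ xs) = trans (+-identityˡ _) (∑-0 xs)

∑-++ : (xs ys : List X) (f : X → ℚ) → ∑ (xs ++ ys) f ≡ ∑ xs f + ∑ ys f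
∑-++ []       ys f = sym (+-identityˡ _)
∑-++ (x ∷ xs) ys f = trans (cong (f x +_) (∑-++ xs ys f)) (sym (+-assoc (f x) _ _))

∑-map : (g : X → Y) (xs : List X) (f : Y → ℚ) → ∑ (map g xs) f ≡ ∑ xs (λ x → f (g x))
∑-map g xs f = cong sumℚ (sym (map-∘ xs))

∑-concatMap : (g : X → List Y) (xs : List X) (f : Y → ℚ) → ∑ (concatMap g xs) f ≡ ∑ xs (λ x → ∑ (g x) f)
∑-concatMap g []       f = refl
∑-concatMap g (x ∷ xs) f =
  trans (∑-++ (g x) (concatMap g xs) f) (cong (∑ (g x) f +_) (∑-concatMap g xs f))

+-interchange : ∀ p q r s → (p + q) + (r + s) ≡ (p + r) + (q + s)
+-interchange = solve 4 (λ p q r s → (p :+ q) :+ (r :+ s) := (p :+ r) :+ (q :+ s)) refl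

∑-+ : (xs : List X) (f g : X → ℚ) → ∑ xs (λ x → f x + g x) ≡ ∑ xs f + ∑ xs g
∑-+ []       f g = refl
∑-+ (x ∷ xs) f g = trans (cong ((f x + g x) +_) (∑-+ xs f g)) (+-interchange (f x) (g x) _ _)

∑-*ˡ : (xs : List X) (k : ℚ) (f : X → ℚ) → ∑ xs (λ x → k * f x) ≡ k * ∑ xs f
∑-*ˡ []       k f = sym (*-zeroʳ k)
∑-*ˡ (x ∷ xs) k f = trans (cong (k * f x +_) (∑-*ˡ xs k f)) (sym (*-distribˡ-+ k (f x) _))

∑-*ʳ : (xs : List X) (k : ℚ) (f : X → ℚ) → ∑ xs (λ x → f x * k) ≡ ∑ xs f * k
∑-*ʳ xs k f = trans (∑-cong xs λ x → *-comm (f x) k) (trans (∑-*ˡ xs k f) (*-comm k _))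

∑-swap : (xs : List X) (ys : List Y) (f : X → Y → ℚ) →
         ∑ xs (λ x → ∑ ys (f x)) ≡ ∑ ys (λ y → ∑ xs (λ x → f x y))
∑-swap []       ys f = sym (∑-0 ys)
∑-swap (x ∷ xs) ys f =
  trans (cong (∑ ys (f x) +_) (∑-swap xs ys f)) (sym (∑-+ ys (f x) _))

*-left-comm : ∀ p q r → p * (q * r) ≡ q * (p * r)
*-left-comm = solve 3 (λ p q r → p :* (q :* r) := q :* (p :* r)) refl

-- Polynomial sequences

-- p : ℕ → ℚ agrees with a polynomial: some iterated difference vanishes.

data Poly (p : ℕ → ℚ) : Set where
  null : (∀ n → p n ≡ 0ℚ) → Poly p
  diff : Poly (λ n → p (suc n) - p n) → Poly p

Poly-cong : {p q : ℕ → ℚ} → (∀ n → p n ≡ q n) → Poly p → Poly q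
Poly-cong e (null z) = null λ n → trans (sym (e n)) (z n)
Poly-cong e (diff d) = diff (Poly-cong (λ n → cong₂ _-_ (e (suc n)) (e n)) d)

Poly-const : ∀ k → Poly (λ _ → k)
Poly-const k = diff (null λ _ → +-inverseʳ k)

Poly-shift : {p : ℕ → ℚ} → Poly p → Poly (λ n → p (suc n))
Poly-shift (null z) = null λ n → z (suc n)
Poly-shift (diff d) = diff (Poly-shift d)

Poly-+ : {p q : ℕ → ℚ} → Poly p → Poly q → Poly (λ n → p n + q n)
Poly-+ {p} {q} (null z) Q =
  Poly-cong (λ n → sym (trans (cong (_+ q n) (z n)) (+-identityˡ (q n)))) Q
Poly-+ {p} {q} (diff d) (null z) =
  Poly-cong (λ n → sym (trans (cong (p n +_) (z n)) (+-identityʳ (p n)))) (diff d)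
Poly-+ {p} {q} (diff d) (diff e) = diff (Poly-cong (λ n → eq (p (suc n)) (p n) (q (suc n)) (q n)) (Poly-+ d e))
  where
  eq : ∀ a b c d → (a - b) + (c - d) ≡ (a + c) - (b + d)
  eq = solve 4 (λ a b c d → (a :- b) :+ (c :- d) := (a :+ c) :- (b :+ d)) refl

-- Discrete Leibniz rule with one factor shifted: the difference of p q at n is (p (n+1) - p n) q
-- (n+1) + p n (q (n+1) - q n), and each summand lowers the order of one factor.
Poly-* : {p q : ℕ → ℚ} → Poly p → Poly q → Poly (λ n → p n * q n)
Poly-* {p} {q} (null z) Q = null λ n → trans (cong (_* q n) (z n)) (*-zeroˡ (q n))
Poly-* {p} {q} (diff d) (null z) = null λ n → trans (cong (p n *_) (z n)) (*-zeroʳ (p n))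
Poly-* {p} {q} (diff d) (diff e) =
  diff (Poly-cong (λ n → eq (p (suc n)) (p n) (q (suc n)) (q n))
    (Poly-+ (Poly-* d (Poly-shift {q} (diff e))) (Poly-* (diff {p} d) e)))
  where
  eq : ∀ a b c d → (a - b) * c + b * (c - d) ≡ a * c - b * d
  eq = solve 4 (λ a b c d → (a :- b) :* c :+ b :* (c :- d) := a :* c :- b :* d) refl

Poly-∑ : {P : X → Set b} {xs : List X} {p : X → ℕ → ℚ} → All P xs → (∀ x → P x → Poly (p x)) → Poly (λ n → ∑ xs (λ x → p x n))
Poly-∑ []       h = Poly-const 0ℚ
Poly-∑ (q ∷ qs) h = Poly-+ (h _ q) (Poly-∑ qs h)

-- Write p 0 = p 1 - (p 1 - p 0). The difference sequence also vanishes from index 1 on, so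
-- induction on the order settles its value at 0.
Poly-extrapolate : {p : ℕ → ℚ} → Poly p → (∀ n → p (suc n) ≡ 0ℚ) → p 0 ≡ 0ℚ
Poly-extrapolate (null z) h = z 0
Poly-extrapolate {p} (diff d) h = trans (eq (p 0) (p 1)) (cong₂ _-_ (h 0) Δ0)
  where
  eq : ∀ a b → a ≡ b - (b - a)
  eq = solve 2 (λ a b → a := b :- (b :- a)) refl
  Δ0 : p 1 - p 0 ≡ 0ℚ
  Δ0 = Poly-extrapolate d λ n → trans (cong₂ _-_ (h (suc n)) (h n)) (+-inverseʳ 0ℚ)

-- The engine of the proof: an identity verified for every T (N + 1) carries over to the value at 0,
-- where Θ sits.
Poly-unique : {p q : ℕ → ℚ} → Poly p → Poly q → (∀ n → p (suc n) ≡ q (suc n)) → p 0 ≡ q 0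
Poly-unique {p} {q} P Q h = trans (eq (p 0) (q 0)) (trans (cong (_+ q 0) z) (+-identityˡ (q 0)))
  where
  eq : ∀ a b → a ≡ (a + -1ℚ * b) + b
  eq = solve 2 (λ a b → a := (a :+ con -1ℚ :* b) :+ b) refl
  z : p 0 + -1ℚ * q 0 ≡ 0ℚ
  z = Poly-extrapolate (Poly-+ P (Poly-* (Poly-const -1ℚ) Q))
        (λ n → trans (cong (λ r → r + -1ℚ * q (suc n)) (h n))
                 (solve 1 (λ b → b :+ con -1ℚ :* b := con 0ℚ) refl (q (suc n))))

Poly-∑′ : (xs : List X) {p : X → ℕ → ℚ} → (∀ x → Poly (p x)) → Poly (λ n → ∑ xs (λ x → p x n))
Poly-∑′ []       h = Poly-const 0ℚ
Poly-∑′ (x ∷ xs) h = Poly-+ (h x) (Poly-∑′ xs h)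

-- Transfer recursion along a chain

lex : ℕ → ℕ → Bool → Bool
lex m m′ x = (m <ᵇ m′) ∨ ((m ≡ᵇ m′) ∧ x)

-- A transfer-matrix count of labelled chains. The word of windows `m` is fixed, `v` is the letter
-- chosen inside the current window, and `b 0` says whether the next step is strict. The instances
-- are signs (enriched partitions) and letters of a window (T n).
module Transfer {V : Set} (choices : List V) (wt : V → ℚ) (r : Bool → V → V → Bool) where

  step : Bool → ℕ → ℕ → V → V → Bool
  step d m m′ v v′ = lex m m′ (r d v v′)

  from : V → ℕ → (ℕ → Bool) → List ℕ → ℚ
  from v m b []        = 1ℚ
  from v m b (m′ ∷ ms) =
    ∑ choices λ v′ → wt v′ * (⟦ step (b 0) m m′ v v′ ⟧ * from v′ m′ (b ∘ suc) ms)

  total : (ℕ → Bool) → List ℕ → ℚ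
  total b []       = 1ℚ
  total b (m ∷ ms) = ∑ choices λ v → wt v * from v m b ms

signs : List Bool
signs = true ∷ false ∷ []

-- true is the positive letter of a window; it comes after the negative one.
rK : Bool → Bool → Bool → Bool
rK d s s′ = if d then not s else s′

module TK = Transfer signs (λ _ → 1ℚ) rK

-- t : Fin n is the letter with t letters above it in its window; the top one
-- is positive, the others are negative.
wt : ℕ → ℚ
wt zero    = 1ℚ
wt (suc _) = -1ℚ

-- Letters are numbered from the top, so the order is reversed: a strict step up needs `t′ < t`, a
-- weak one `t′ ≤ t`.
rT : {n : ℕ} → Bool → Fin n → Fin n → Bool
rT d t t′ = toℕ t′ <ᵇ (if d then toℕ t else suc (toℕ t))

module TT (n : ℕ) = Transfer (allFin n) (wt ∘ toℕ) rT

Pre : (ℕ → ℚ) → ℕ → ℚ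
Pre h zero    = 0ℚ
Pre h (suc s) = h 0 + Pre (h ∘ suc) s

Pre-cong : {h k : ℕ → ℚ} → (∀ i → h i ≡ k i) → ∀ s → Pre h s ≡ Pre k s
Pre-cong e zero    = refl
Pre-cong e (suc s) = cong₂ _+_ (e 0) (Pre-cong (e ∘ suc) s)

Pre-last : ∀ h s → Pre h (suc s) ≡ Pre h s + h s
Pre-last h zero    = +-comm (h 0) 0ℚ
Pre-last h (suc s) = trans (cong (h 0 +_) (Pre-last (h ∘ suc) s)) (sym (+-assoc (h 0) _ _))

∑-allFin-suc : ∀ n (f : Fin (suc n) → ℚ) → ∑ (allFin (suc n)) f ≡ f zero + ∑ (allFin n) (f ∘ suc)
∑-allFin-suc n f = cong (λ l → f zero + sumℚ l) (trans (map-tabulate suc f) (sym (map-tabulate id (f ∘ suc))))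

∑-Fin-prefix : ∀ n (h : ℕ → ℚ) {s} → s ℕ.≤ n → ∑ (allFin n) (λ t → ⟦ toℕ t <ᵇ s ⟧ * h (toℕ t)) ≡ Pre h s
∑-Fin-prefix zero    h z≤n = refl
∑-Fin-prefix (suc n) h z≤n =
  trans (∑-cong (allFin (suc n)) λ t → *-zeroˡ (h (toℕ t))) (∑-0 (allFin (suc n)))
∑-Fin-prefix (suc n) h {suc s} (s≤s le) =
  trans (∑-allFin-suc n (λ t → ⟦ toℕ t <ᵇ suc s ⟧ * h (toℕ t))) (cong₂ _+_ (*-identityˡ (h 0)) (∑-Fin-prefix n (h ∘ suc) le))

∑-Fin : ∀ n (h : ℕ → ℚ) → ∑ (allFin n) (h ∘ toℕ) ≡ Pre h n
∑-Fin zero    h = refl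
∑-Fin (suc n) h = trans (∑-allFin-suc n (h ∘ toℕ)) (cong (h 0 +_) (∑-Fin n (h ∘ suc)))

head-value : ℚ → (ℕ → ℚ) → ℕ → ℚ
head-value g G zero    = g
head-value g G (suc t) = G (suc t)

-- For n ≥ 1 this is the signed sum over a window of n letters. The clause at 0 is the only value
-- that makes the first difference there equal to `-1ℚ * G 0`.
window : ℚ → (ℕ → ℚ) → ℕ → ℚ
window g G zero    = g + G 0
window g G (suc s) = g + Pre (λ i → -1ℚ * G (suc i)) s

window-Pre : ∀ g G s → Pre (λ t → wt t * head-value g G t) (suc s) ≡ window g G (suc s)
window-Pre g G s = cong (_+ Pre (λ i → -1ℚ * G (suc i)) s) (*-identityˡ g)

-- The first difference is `-1ℚ * G n` at every n, including 0. This is where reciprocity enters: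
-- stepping back from n = 1 to n = 0 turns the sign - of a negative letter into +.
window-Poly : ∀ {g G} → Poly G → Poly (window g G)
window-Poly {g} {G} P = diff (Poly-cong eq (Poly-* (Poly-const -1ℚ) P))
  where
  eq : ∀ n → -1ℚ * G n ≡ window g G (suc n) - window g G n
  eq zero    = solve 2 (λ g G → con -1ℚ :* G := (g :+ con 0ℚ) :- (g :+ G)) refl g (G 0)
  eq (suc n) = trans (eq′ g (Pre h n) (h n)) (cong (λ x → (g + x) - (g + Pre h n)) (sym (Pre-last h n)))
    where
    h = λ i → -1ℚ * G (suc i)
    eq′ : ∀ g p x → x ≡ (g + (p + x)) - (g + p)
    eq′ = solve 3 (λ g p x → x := (g :+ (p :+ x)) :- (g :+ p)) refl

-- The windows above the current one contribute a factor rest n; the value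
-- at a letter with t ≥ 1 letters above it is a polynomial lower t, and
-- lower 0 is what the negative letter contributes.
record Shape (fT : ∀ n → Fin n → ℚ) (fK : Bool → ℚ) : Set where
  field
    top        : ℚ
    lower rest : ℕ → ℚ
    lower-Poly : Poly lower
    rest-Poly  : Poly rest
    from-T     : ∀ n (t : Fin n) → fT n t ≡ head-value top lower (toℕ t) * rest n
    from-K⁺    : fK true ≡ top * rest 0
    from-K⁻    : fK false ≡ lower 0 * rest 0

private
  K-sum : ∀ x y r → 1ℚ * (1ℚ * (x * r)) + (1ℚ * (1ℚ * (y * r)) + 0ℚ) ≡ 1ℚ * ((x + y) * r)
  K-sum = solve 3 (λ x y r → con 1ℚ :* (con 1ℚ :* (x :* r)) :+ (con 1ℚ :* (con 1ℚ :* (y :* r)) :+ con 0ℚ)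
             := con 1ℚ :* ((x :+ y) :* r)) refl

  K-sum′ : ∀ x y r → 1ℚ * (1ℚ * (x * r)) + (1ℚ * (1ℚ * (y * r)) + 0ℚ) ≡ (x + y) * r
  K-sum′ x y r = trans (K-sum x y r) (*-identityˡ _)

  K-none : ∀ x y → 1ℚ * (0ℚ * x) + (1ℚ * (0ℚ * y) + 0ℚ) ≡ 0ℚ
  K-none = solve 2 (λ x y → con 1ℚ :* (con 0ℚ :* x) :+ (con 1ℚ :* (con 0ℚ :* y) :+ con 0ℚ) := con 0ℚ) refl

  K-first : ∀ x r y → 1ℚ * (1ℚ * (x * r)) + (1ℚ * (0ℚ * y) + 0ℚ) ≡ x * r
  K-first = solve 3 (λ x r y → con 1ℚ :* (con 1ℚ :* (x :* r)) :+ (con 1ℚ :* (con 0ℚ :* y) :+ con 0ℚ)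
             := x :* r) refl

  T-none : ∀ w x → w * (0ℚ * x) ≡ 0ℚ
  T-none = solve 2 (λ w x → w :* (con 0ℚ :* x) := con 0ℚ) refl

  T-some : ∀ w i x r → w * (i * (x * r)) ≡ (i * (w * x)) * r
  T-some = solve 4 (λ w i x r → w :* (i :* (x :* r)) := (i :* (w :* x)) :* r) refl

  head-const : ∀ k n (t : Fin n) → head-value k (λ _ → k) (toℕ t) ≡ k
  head-const k n zero    = refl
  head-const k n (suc t) = refl

module _ {fT : ∀ n → Fin n → ℚ} {fK : Bool → ℚ} (S : Shape fT fK) where
  open Shape S
  private
    h : ℕ → ℚ
    h t = wt t * head-value top lower t

  -- The argument of type `Fin n` certifies n ≥ 1: an empty window sums to 0, unlike the
  -- extrapolated value `window top lower 0`.
  ∑-window : ∀ n → Fin n → ∑ (allFin n) (λ t → wt (toℕ t) * fT n t) ≡ window top lower n * rest n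
  ∑-window n@(suc n′) _ = begin
    ∑ (allFin n) (λ t → wt (toℕ t) * fT n t)
      ≡⟨ ∑-cong (allFin n) (λ t → trans (cong (wt (toℕ t) *_) (from-T n t)) (sym (*-assoc (wt (toℕ t)) (head-value top lower (toℕ t)) (rest n)))) ⟩
    ∑ (allFin n) (λ t → h (toℕ t) * rest n)
      ≡⟨ ∑-*ʳ (allFin n) (rest n) (h ∘ toℕ) ⟩
    ∑ (allFin n) (λ t → h (toℕ t)) * rest n
      ≡⟨ cong (_* rest n) (trans (∑-Fin n h) (window-Pre top lower n′)) ⟩
    window top lower n * rest n ∎
    where open ≡-Reasoning

  ∑-prefix : ∀ n s → s ℕ.≤ n →
      ∑ (allFin n) (λ t → wt (toℕ t) * (⟦ toℕ t <ᵇ s ⟧ * fT n t)) ≡ Pre h s * rest n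
  ∑-prefix n s le = begin
    ∑ (allFin n) (λ t → wt (toℕ t) * (⟦ toℕ t <ᵇ s ⟧ * fT n t))
      ≡⟨ ∑-cong (allFin n) (λ t → trans (cong (λ x → wt (toℕ t) * (⟦ toℕ t <ᵇ s ⟧ * x)) (from-T n t))
            (T-some (wt (toℕ t)) ⟦ toℕ t <ᵇ s ⟧ (head-value top lower (toℕ t)) (rest n))) ⟩
    ∑ (allFin n) (λ t → (⟦ toℕ t <ᵇ s ⟧ * h (toℕ t)) * rest n)
      ≡⟨ ∑-*ʳ (allFin n) (rest n) _ ⟩
    ∑ (allFin n) (λ t → ⟦ toℕ t <ᵇ s ⟧ * h (toℕ t)) * rest n
      ≡⟨ cong (_* rest n) (∑-Fin-prefix n h le) ⟩
    Pre h s * rest n ∎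
    where open ≡-Reasoning

  private
    K-eq = cong₂ (λ x y → 1ℚ * (1ℚ * x) + (1ℚ * (1ℚ * y) + 0ℚ)) from-K⁺ from-K⁻
    K-top = λ y → trans (cong (λ x → 1ℚ * (1ℚ * x) + (1ℚ * (0ℚ * y) + 0ℚ)) from-K⁺) (K-first top (rest 0) y)

  -- `x` and `y` stand for "the next window is higher" and "is the same". A higher window can be
  -- entered at any letter, so its whole sum joins `rest`; a lower one is forbidden; inside the same
  -- window the admissible letters form a prefix, whose signed sum is again a window polynomial.
  shape-step : (x y d : Bool) →
    Shape (λ n t → ∑ (allFin n) λ t′ → wt (toℕ t′) * (⟦ x ∨ (y ∧ rT d t t′) ⟧ * fT n t′))
          (λ s → ∑ signs λ s′ → 1ℚ * (⟦ x ∨ (y ∧ rK d s s′) ⟧ * fK s′))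
  shape-step true _ _ = record
    { top = 1ℚ ; lower = λ _ → 1ℚ ; rest = λ n → window top lower n * rest n
    ; lower-Poly = Poly-const 1ℚ ; rest-Poly = Poly-* (window-Poly lower-Poly) rest-Poly
    ; from-T = λ n t →
        trans (∑-cong (allFin n) λ t′ → cong (wt (toℕ t′) *_) (*-identityˡ (fT n t′)))
          (trans (∑-window n t) (sym (trans (cong (_* (window top lower n * rest n)) (head-const 1ℚ n t)) (*-identityˡ _))))
    ; from-K⁺ = trans K-eq (K-sum top (lower 0) (rest 0))
    ; from-K⁻ = trans K-eq (K-sum top (lower 0) (rest 0)) }
  shape-step false false _ = record
    { top = 0ℚ ; lower = λ _ → 0ℚ ; rest = λ _ → 1ℚ
    ; lower-Poly = Poly-const 0ℚ ; rest-Poly = Poly-const 1ℚ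
    ; from-T = λ n t →
        trans (∑-cong (allFin n) λ t′ → T-none (wt (toℕ t′)) (fT n t′))
          (trans (∑-0 (allFin n)) (sym (cong (_* 1ℚ) (head-const 0ℚ n t))))
    ; from-K⁺ = K-none (fK true) (fK false)
    ; from-K⁻ = K-none (fK true) (fK false) }
  -- Strict step: the top letter has no successor in its window. For a lower letter the prefix t' <
  -- t sums to `window top lower t`, which at t = 0 gives both signs.
  shape-step false true true = record
    { top = 0ℚ ; lower = window top lower ; rest = rest
    ; lower-Poly = window-Poly lower-Poly ; rest-Poly = rest-Poly
    ; from-T = λ
        { n zero    → ∑-prefix n 0 z≤n
        ; n (suc t) → trans (∑-prefix n (suc (toℕ t)) (ℕP.<⇒≤ (FinP.toℕ<n (suc t))))
                        (cong (_* rest n) (window-Pre top lower (toℕ t))) }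
    ; from-K⁺ = trans (K-none (fK true) (fK false)) (sym (*-zeroˡ (rest 0)))
    ; from-K⁻ = trans K-eq (K-sum′ top (lower 0) (rest 0)) }
  -- Weak step: the prefix now includes t itself, so the index moves up by one; at t = 0 only `top`
  -- is left, the positive sign.
  shape-step false true false = record
    { top = top ; lower = window top lower ∘ suc ; rest = rest
    ; lower-Poly = Poly-shift (window-Poly {top} lower-Poly) ; rest-Poly = rest-Poly
    ; from-T = λ n t → trans (∑-prefix n (suc (toℕ t)) (FinP.toℕ<n t))
                         (cong (_* rest n) (trans (window-Pre top lower (toℕ t)) (eq (toℕ t))))
    ; from-K⁺ = K-top (fK false)
    ; from-K⁻ = trans (K-top (fK false)) (cong (_* rest 0) (sym (+-identityʳ top))) }
    where
    eq : ∀ t → window top lower (suc t) ≡ head-value top (window top lower ∘ suc) t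
    eq zero    = +-identityʳ top
    eq (suc t) = refl

shape : ∀ m b ms → Shape (λ n t → TT.from n t m b ms) (λ s → TK.from s m b ms)
shape m b [] = record
  { top = 1ℚ ; lower = λ _ → 1ℚ ; rest = λ _ → 1ℚ
  ; lower-Poly = Poly-const 1ℚ ; rest-Poly = Poly-const 1ℚ
  ; from-T = λ n t → cong (_* 1ℚ) (sym (head-const 1ℚ n t)) ; from-K⁺ = refl ; from-K⁻ = refl }
shape m b (m′ ∷ ms) = shape-step (shape m′ (b ∘ suc) ms) (m <ᵇ m′) (m ≡ᵇ m′) (b 0)

-- Index 0 carries the enriched count, not the count over an empty window; that the two definitions
-- form a single polynomial is the content of `chain-value-Poly`.
chain-value : (ℕ → Bool) → List ℕ → ℕ → ℚ
chain-value b ms zero    = TK.total b ms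
chain-value b ms (suc n) = TT.total (suc n) b ms

chain-value-Poly : ∀ b ms → Poly (chain-value b ms)
chain-value-Poly b []       = Poly-cong (λ { zero → refl ; (suc n) → refl }) (Poly-const 1ℚ)
chain-value-Poly b (m ∷ ms) = Poly-cong eq (Poly-* (window-Poly lower-Poly) rest-Poly)
  where
  S = shape m b ms
  open Shape S
  eq : ∀ n → window top lower n * rest n ≡ chain-value b (m ∷ ms) n
  eq zero    = sym (trans (cong₂ (λ x y → 1ℚ * x + (1ℚ * y + 0ℚ)) from-K⁺ from-K⁻)
    (solve 3 (λ x y r → con 1ℚ :* (x :* r) :+ (con 1ℚ :* (y :* r) :+ con 0ℚ) := (x :+ y) :* r) refl top (lower 0) (rest 0)))
  eq (suc n) = sym (∑-window S (suc n) zero)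

-- A window contributes 2 if no peak lies in its interior and 0 otherwise,
-- so the signed count sees a strictness pattern only through its peaks.
peaks : (ℕ → Bool) → ℕ → Bool
peaks b k = b (suc k) ∧ not (b k)

private
  next-same : Bool → ℕ → List ℕ → Bool
  next-same p m []       = false
  next-same p m (m′ ∷ _) = not (m <ᵇ m′) ∧ (m ≡ᵇ m′) ∧ p

  peak-count : ℕ → (ℕ → Bool) → List ℕ → ℚ
  peak-count m p []        = 1ℚ + 1ℚ
  peak-count m p (m′ ∷ ms) =
    if m <ᵇ m′ then (1ℚ + 1ℚ) * peak-count m′ (p ∘ suc) ms
    else if m ≡ᵇ m′ then (if next-same (p 0) m′ ms then 0ℚ else peak-count m′ (p ∘ suc) ms)
    else 0ℚ

  count-∑ : ∀ x y → 1ℚ * x + (1ℚ * y + 0ℚ) ≡ x + y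
  count-∑ = solve 2 (λ x y → con 1ℚ :* x :+ (con 1ℚ :* y :+ con 0ℚ) := x :+ y) refl

  sum-K : ℕ → (ℕ → Bool) → List ℕ → ℚ
  sum-K m b ms = TK.from true m b ms + TK.from false m b ms

  both : ∀ x y → (1ℚ * (1ℚ * x) + (1ℚ * (1ℚ * y) + 0ℚ)) + (1ℚ * (1ℚ * x) + (1ℚ * (1ℚ * y) + 0ℚ)) ≡ (1ℚ + 1ℚ) * (x + y)
  both = solve 2 (λ x y → (con 1ℚ :* (con 1ℚ :* x) :+ (con 1ℚ :* (con 1ℚ :* y) :+ con 0ℚ)) :+ (con 1ℚ :* (con 1ℚ :* x) :+ (con 1ℚ :* (con 1ℚ :* y) :+ con 0ℚ)) := con (1ℚ + 1ℚ) :* (x :+ y)) refl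

  second : ∀ x y → (1ℚ * (0ℚ * x) + (1ℚ * (0ℚ * y) + 0ℚ)) + (1ℚ * (1ℚ * x) + (1ℚ * (1ℚ * y) + 0ℚ)) ≡ x + y
  second = solve 2 (λ x y → (con 1ℚ :* (con 0ℚ :* x) :+ (con 1ℚ :* (con 0ℚ :* y) :+ con 0ℚ)) :+ (con 1ℚ :* (con 1ℚ :* x) :+ (con 1ℚ :* (con 1ℚ :* y) :+ con 0ℚ)) := x :+ y) refl

  firsts : ∀ x y → (1ℚ * (1ℚ * x) + (1ℚ * (0ℚ * y) + 0ℚ)) + (1ℚ * (1ℚ * x) + (1ℚ * (0ℚ * y) + 0ℚ)) ≡ x + x
  firsts = solve 2 (λ x y → (con 1ℚ :* (con 1ℚ :* x) :+ (con 1ℚ :* (con 0ℚ :* y) :+ con 0ℚ)) :+ (con 1ℚ :* (con 1ℚ :* x) :+ (con 1ℚ :* (con 0ℚ :* y) :+ con 0ℚ)) := x :+ x) refl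

  -- A positive and a negative letter have the same continuations unless the next step is strict and
  -- stays in the window; in that case a positive letter has none.
  double-top : ∀ m b ms → TK.from true m b ms + TK.from true m b ms
                 ≡ (if next-same (b 0) m ms then 0ℚ else sum-K m b ms)
  double-top m b [] = refl
  double-top m b (m′ ∷ ms) with m <ᵇ m′ | m ≡ᵇ m′ | b 0
  ... | true  | _     | _     = refl
  ... | false | false | _     = refl
  ... | false | true  | false = refl
  ... | false | true  | true  =
    cong₂ _+_ (K-none (TK.from true m′ (b ∘ suc) ms) (TK.from false m′ (b ∘ suc) ms))
              (K-none (TK.from true m′ (b ∘ suc) ms) (TK.from false m′ (b ∘ suc) ms))

  next-same-false : ∀ m ms → next-same false m ms ≡ false
  next-same-false m [] = refl
  next-same-false m (m′ ∷ ms) with m <ᵇ m′ | m ≡ᵇ m′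
  ... | true  | _     = refl
  ... | false | true  = refl
  ... | false | false = refl

  -- Inside a window a strict step forces a negative letter and leaves both signs open next, while a
  -- weak step sends both signs to a positive letter and so doubles it. By `double-top` the doubled
  -- count is again the sum over both signs, except that it vanishes when weak is followed by
  -- strict, which is a peak.
  sum-K-peaks : ∀ m b ms → sum-K m b ms ≡ peak-count m (peaks b) ms
  sum-K-peaks m b [] = refl
  sum-K-peaks m b (m′ ∷ ms) with m <ᵇ m′ | m ≡ᵇ m′ | b 0
  ... | true  | _     | _ = trans (both (TK.from true m′ (b ∘ suc) ms) (TK.from false m′ (b ∘ suc) ms))
                              (cong ((1ℚ + 1ℚ) *_) (sum-K-peaks m′ (b ∘ suc) ms))
  ... | false | false | _ = cong₂ _+_ (K-none (TK.from true m′ (b ∘ suc) ms) (TK.from false m′ (b ∘ suc) ms))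
              (K-none (TK.from true m′ (b ∘ suc) ms) (TK.from false m′ (b ∘ suc) ms))
  ... | false | true  | true =
    trans (second (TK.from true m′ (b ∘ suc) ms) (TK.from false m′ (b ∘ suc) ms))
      (trans (sum-K-peaks m′ (b ∘ suc) ms)
        (cong (λ c → if c then 0ℚ else peak-count m′ (peaks (b ∘ suc)) ms)
          (sym (trans (cong (λ c → next-same c m′ ms) (∧-zeroʳ (b 1))) (next-same-false m′ ms)))))
  ... | false | true  | false =
    trans (firsts (TK.from true m′ (b ∘ suc) ms) (TK.from false m′ (b ∘ suc) ms))
      (trans (double-top m′ (b ∘ suc) ms)
        (cong₂ (λ c z → if c then 0ℚ else z)
          (cong (λ c → next-same c m′ ms) (sym (∧-identityʳ (b 1))))
          (sum-K-peaks m′ (b ∘ suc) ms)))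

  peak-count-cong : ∀ m {p q} ms → (∀ k → p k ≡ q k) → peak-count m p ms ≡ peak-count m q ms
  peak-count-cong m [] e = refl
  peak-count-cong m (m′ ∷ ms) e rewrite peak-count-cong m′ ms (e ∘ suc) | e 0 = refl

total-K-peaks : ∀ {b b′} ms → (∀ k → peaks b k ≡ peaks b′ k) → TK.total b ms ≡ TK.total b′ ms
total-K-peaks [] e = refl
total-K-peaks {b} {b′} (m ∷ ms) e = begin
  TK.total b (m ∷ ms)        ≡⟨ count-∑ (TK.from true m b ms) (TK.from false m b ms) ⟩
  sum-K m b ms               ≡⟨ sum-K-peaks m b ms ⟩
  peak-count m (peaks b) ms  ≡⟨ peak-count-cong m ms e ⟩
  peak-count m (peaks b′) ms ≡⟨ sum-K-peaks m b′ ms ⟨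
  sum-K m b′ ms              ≡⟨ count-∑ (TK.from true m b′ ms) (TK.from false m b′ ms) ⟨
  TK.total b′ (m ∷ ms)       ∎
  where open ≡-Reasoning

-- Sums over assignments of letters to positions

Unique-↭ : {X : Set} {xs ys : List X} → xs ↭ ys → Unique xs → Unique ys
Unique-↭ p = Unique-resp-↭ (setoid _) (↭⇒↭ₛ p)

link : {X : Set} → (Bool → X → X → Bool) → (ℕ → Bool) → List X → Bool
link ρ b []          = true
link ρ b (x ∷ [])    = true
link ρ b (x ∷ y ∷ l) = ρ (b 0) x y ∧ link ρ (b ∘ suc) (y ∷ l)

link-cong : {X : Set} {ρ ρ′ : Bool → X → X → Bool} → (∀ d x y → ρ d x y ≡ ρ′ d x y) → ∀ b l → link ρ b l ≡ link ρ′ b l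
link-cong e b []          = refl
link-cong e b (x ∷ [])    = refl
link-cong e b (x ∷ y ∷ l) = cong₂ _∧_ (e (b 0) x y) (link-cong e (b ∘ suc) (y ∷ l))

link-map : {X Y : Set} (f : X → Y) (ρ : Bool → Y → Y → Bool) → ∀ b l → link ρ b (map f l) ≡ link (λ d x y → ρ d (f x) (f y)) b l
link-map f ρ b []          = refl
link-map f ρ b (x ∷ [])    = refl
link-map f ρ b (x ∷ y ∷ l) = cong (ρ (b 0) (f x) (f y) ∧_) (link-map f ρ (b ∘ suc) (y ∷ l))

module Assignments {V : Set} (choices : List V) (wt : V → ℚ) where

  cons : ∀ {n} → V → (Fin n → V) → Fin (suc n) → V
  cons v y zero    = v
  cons v y (suc i) = y i

  ∑-all : ∀ n → ((Fin n → V) → ℚ) → ℚ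
  ∑-all zero    φ = φ λ ()
  ∑-all (suc n) φ = ∑ choices λ v → wt v * ∑-all n (φ ∘ cons v)

  -- Stands in for function extensionality: the updates below produce assignments that agree only
  -- pointwise.
  Ext : ∀ {n} → ((Fin n → V) → ℚ) → Set
  Ext φ = ∀ {y z} → (∀ i → y i ≡ z i) → φ y ≡ φ z

  ∑-all-cong : ∀ n {φ ψ : (Fin n → V) → ℚ} → (∀ y → φ y ≡ ψ y) → ∑-all n φ ≡ ∑-all n ψ
  ∑-all-cong zero    e = e _
  ∑-all-cong (suc n) e = ∑-cong choices λ v → cong (wt v *_) (∑-all-cong n λ y → e _)

  ∑-all-linear : ∀ {X : Set} n (xs : List X) (c : X → ℚ) (φ : X → (Fin n → V) → ℚ) →
    ∑-all n (λ y → ∑ xs (λ i → c i * φ i y)) ≡ ∑ xs (λ i → c i * ∑-all n (φ i))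
  ∑-all-linear zero    xs c φ = refl
  ∑-all-linear (suc n) xs c φ = begin
    ∑ choices (λ v → wt v * ∑-all n (λ y → ∑ xs (λ i → c i * φ i (cons v y))))
      ≡⟨ ∑-cong choices (λ v → cong (wt v *_) (∑-all-linear n xs c (λ i y → φ i (cons v y)))) ⟩
    ∑ choices (λ v → wt v * ∑ xs (λ i → c i * g i v))
      ≡⟨ ∑-cong choices (λ v → ∑-*ˡ xs (wt v) (λ i → c i * g i v)) ⟨
    ∑ choices (λ v → ∑ xs (λ i → wt v * (c i * g i v)))
      ≡⟨ ∑-swap choices xs _ ⟩
    ∑ xs (λ i → ∑ choices (λ v → wt v * (c i * g i v)))
      ≡⟨ ∑-cong xs (λ i → trans (∑-cong choices λ v → *-left-comm (wt v) (c i) (g i v))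
                            (∑-*ˡ choices (c i) (λ v → wt v * g i v))) ⟩
    ∑ xs (λ i → c i * ∑ choices (λ v → wt v * g i v)) ∎
    where
    open ≡-Reasoning
    g = λ i v → ∑-all n (λ y → φ i (cons v y))

  cons-cong : ∀ {n} v {y z : Fin n → V} → (∀ i → y i ≡ z i) → ∀ i → cons v y i ≡ cons v z i
  cons-cong v e zero    = refl
  cons-cong v e (suc i) = e i

  upd : ∀ {n} → (Fin n → V) → Fin n → V → Fin n → V
  upd y j v i = if does (i Fin.≟ j) then v else y i

  upd-cong : ∀ {n} {y z : Fin n → V} j v → (∀ i → y i ≡ z i) → ∀ i → upd y j v i ≡ upd z j v i
  upd-cong j v e i with does (i Fin.≟ j)
  ... | true  = refl
  ... | false = e i

  upd-same : ∀ {n} (y : Fin n → V) j v → upd y j v j ≡ v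
  upd-same y j v with j Fin.≟ j
  ... | yes _  = refl
  ... | no j≢j = contradiction refl j≢j

  upd-other : ∀ {n} (y : Fin n → V) {i j} v → i ≢ j → upd y j v i ≡ y i
  upd-other y {i} {j} v i≢j with i Fin.≟ j
  ... | yes i≡j = contradiction i≡j i≢j
  ... | no _    = refl

  upd-swap : ∀ {n} (y : Fin n → V) {i j} v w → i ≢ j → ∀ k → upd (upd y i v) j w k ≡ upd (upd y j w) i v k
  upd-swap y {i} {j} v w i≢j k with k Fin.≟ i | k Fin.≟ j
  ... | yes k≡i | yes k≡j = contradiction (trans (sym k≡i) k≡j) i≢j
  ... | yes _   | no _    = refl
  ... | no _    | yes _   = refl
  ... | no _    | no _    = refl

  -- The list fixes the order of summation and `y` is a background assignment that is overwritten
  -- position by position. Summing in the order of a chain turns the sum into the transfer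
  -- recursion.
  ∑-along : ∀ {n} → List (Fin n) → ((Fin n → V) → ℚ) → (Fin n → V) → ℚ
  ∑-along []      φ y = φ y
  ∑-along (j ∷ l) φ y = ∑ choices λ v → wt v * ∑-along l φ (upd y j v)

  ∑-along-cong : ∀ {n} (l : List (Fin n)) {φ ψ} → (∀ y → φ y ≡ ψ y) → ∀ y → ∑-along l φ y ≡ ∑-along l ψ y
  ∑-along-cong []      e y = e y
  ∑-along-cong (j ∷ l) e y = ∑-cong choices λ v → cong (wt v *_) (∑-along-cong l e (upd y j v))

  ∑-along-ext : ∀ {n} (l : List (Fin n)) {φ} → Ext φ → Ext (∑-along l φ)
  ∑-along-ext []      E e = E e
  ∑-along-ext (j ∷ l) E e = ∑-cong choices λ v → cong (wt v *_) (∑-along-ext l E (upd-cong j v e))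

  ∑-along-swap : ∀ {n} i j (l : List (Fin n)) {φ} → Ext φ → i ≢ j → ∀ y →
                 ∑-along (i ∷ j ∷ l) φ y ≡ ∑-along (j ∷ i ∷ l) φ y
  ∑-along-swap i j l {φ} E i≢j y = begin
    ∑ choices (λ v → wt v * ∑ choices (λ w → wt w * ∑-along l φ (upd (upd y i v) j w)))
      ≡⟨ ∑-cong choices (λ v → ∑-*ˡ choices (wt v) _) ⟨
    ∑ choices (λ v → ∑ choices (λ w → wt v * (wt w * ∑-along l φ (upd (upd y i v) j w))))
      ≡⟨ ∑-swap choices choices _ ⟩
    ∑ choices (λ w → ∑ choices (λ v → wt v * (wt w * ∑-along l φ (upd (upd y i v) j w))))
      ≡⟨ ∑-cong choices (λ w → ∑-cong choices λ v → trans (*-left-comm (wt v) (wt w) _)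
           (cong (λ x → wt w * (wt v * x)) (∑-along-ext l E (upd-swap y v w i≢j)))) ⟩
    ∑ choices (λ w → ∑ choices (λ v → wt w * (wt v * ∑-along l φ (upd (upd y j w) i v))))
      ≡⟨ ∑-cong choices (λ w → ∑-*ˡ choices (wt w) _) ⟩
    ∑ choices (λ w → wt w * ∑ choices (λ v → wt v * ∑-along l φ (upd (upd y j w) i v))) ∎
    where open ≡-Reasoning

  -- Neighbouring summations commute because they update different positions; this is what
  -- uniqueness of the list provides.
  ∑-along-↭ : ∀ {n} {l l′ : List (Fin n)} {φ} → Ext φ → Unique l → l ↭ l′ → ∀ y → ∑-along l φ y ≡ ∑-along l′ φ y
  ∑-along-↭ E u Perm.refl y = refl
  ∑-along-↭ E (_ ∷ u) (Perm.prep x p) y = ∑-cong choices λ v → cong (wt v *_) (∑-along-↭ E u p (upd y x v))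
  ∑-along-↭ {φ = φ} E ((i≢j ∷ _) ∷ (_ ∷ u)) (Perm.swap {xs = l} i j p) y = trans (∑-along-swap i j l E i≢j y)
    (∑-cong choices λ v → cong (wt v *_) (∑-cong choices λ w → cong (wt w *_) (∑-along-↭ E u p (upd (upd y j v) i w))))
  ∑-along-↭ E u (Perm.trans p q) y = trans (∑-along-↭ E u p y) (∑-along-↭ E (Unique-↭ p u) q y)

  ∑-along-map-suc : ∀ {n} (l : List (Fin n)) {φ} → Ext φ → ∀ y →
    ∑-along (map suc l) φ y ≡ ∑-along l (φ ∘ cons (y zero)) (y ∘ suc)
  ∑-along-map-suc []      E y = E λ { zero → refl ; (suc i) → refl }
  ∑-along-map-suc (j ∷ l) E y = ∑-cong choices λ v → cong (wt v *_) (∑-along-map-suc l E (upd y (suc j) v))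

  ∑-all-along : ∀ n {φ} → Ext φ → ∀ y → ∑-all n φ ≡ ∑-along (allFin n) φ y
  ∑-all-along zero    E y = E λ ()
  ∑-all-along (suc n) {φ} E y = ∑-cong choices λ v → cong (wt v *_) (begin
    ∑-all n (φ ∘ cons v)
      ≡⟨ ∑-all-along n (E ∘ cons-cong v) (y ∘ suc) ⟩
    ∑-along (allFin n) (φ ∘ cons v) (y ∘ suc)
      ≡⟨ ∑-along-map-suc (allFin n) E (upd y zero v) ⟨
    ∑-along (map suc (allFin n)) φ (upd y zero v)
      ≡⟨ cong (λ l → ∑-along l φ (upd y zero v)) (map-tabulate id suc) ⟩
    ∑-along (tabulate suc) φ (upd y zero v) ∎)
    where open ≡-Reasoning

  ∑-along-factor : ∀ {n} (P : V → V → Bool) {a c : Fin n} l → All (a ≢_) l → All (c ≢_) l → ∀ φ y →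
    ∑-along l (λ y → ⟦ P (y a) (y c) ⟧ * φ y) y ≡ ⟦ P (y a) (y c) ⟧ * ∑-along l φ y
  ∑-along-factor P []      _ _ φ y = refl
  ∑-along-factor P {a} {c} (j ∷ l) (a≢j ∷ as) (c≢j ∷ cs) φ y = trans
    (∑-cong choices λ v → trans
       (cong (wt v *_) (trans (∑-along-factor P l as cs φ (upd y j v))
         (cong₂ (λ p q → ⟦ P p q ⟧ * ∑-along l φ (upd y j v)) (upd-other y v a≢j) (upd-other y v c≢j))))
       (*-left-comm (wt v) ⟦ P (y a) (y c) ⟧ _))
    (∑-*ˡ choices ⟦ P (y a) (y c) ⟧ _)

  module _ (r : Bool → V → V → Bool) {n : ℕ} (m : Fin n → ℕ) where
    open Transfer choices wt r

    linkedAt : (Fin n → V) → Bool → Fin n → Fin n → Bool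
    linkedAt y d a c = step d (m a) (m c) (y a) (y c)

    ∑-along-from : ∀ a π b y → Unique (a ∷ π) →
      ∑-along π (λ y → ⟦ link (linkedAt y) b (a ∷ π) ⟧) y ≡ from (y a) (m a) b (map m π)
    ∑-along-from a []      b y u = refl
    ∑-along-from a (c ∷ π) b y ((a≢c ∷ a∉) ∷ u@(c∉ ∷ _)) = ∑-cong choices λ v → cong (wt v *_) (begin
      ∑-along π (λ y → ⟦ linkedAt y (b 0) a c ∧ link (linkedAt y) (b ∘ suc) (c ∷ π) ⟧) (upd y c v)
        ≡⟨ ∑-along-cong π (λ y → ⟦∧⟧ (linkedAt y (b 0) a c) _) (upd y c v) ⟩
      ∑-along π (λ y → ⟦ linkedAt y (b 0) a c ⟧ * ⟦ link (linkedAt y) (b ∘ suc) (c ∷ π) ⟧) (upd y c v)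
        ≡⟨ ∑-along-factor (step (b 0) (m a) (m c)) π a∉ c∉ _ (upd y c v) ⟩
      ⟦ linkedAt (upd y c v) (b 0) a c ⟧ * ∑-along π (λ y → ⟦ link (linkedAt y) (b ∘ suc) (c ∷ π) ⟧) (upd y c v)
        ≡⟨ cong (⟦ linkedAt (upd y c v) (b 0) a c ⟧ *_) (∑-along-from c π (b ∘ suc) (upd y c v) u) ⟩
      ⟦ linkedAt (upd y c v) (b 0) a c ⟧ * from (upd y c v c) (m c) (b ∘ suc) (map m π)
        ≡⟨ cong₂ (λ p q → ⟦ step (b 0) (m a) (m c) p q ⟧ * from q (m c) (b ∘ suc) (map m π))
             (upd-other y v a≢c) (upd-same y c v) ⟩
      ⟦ step (b 0) (m a) (m c) (y a) v ⟧ * from v (m c) (b ∘ suc) (map m π) ∎)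
      where open ≡-Reasoning

    ∑-along-total : ∀ π b y → Unique π → ∑-along π (λ y → ⟦ link (linkedAt y) b π ⟧) y ≡ total b (map m π)
    ∑-along-total []      b y u = refl
    ∑-along-total (a ∷ π) b y u = ∑-cong choices λ v → cong (wt v *_) (trans
      (∑-along-from a π b (upd y a v) u) (cong (λ x → from x (m a) b (map m π)) (upd-same y a v)))

    linkedAt-Ext : ∀ b π → Ext (λ y → ⟦ link (linkedAt y) b π ⟧)
    linkedAt-Ext b π e = cong ⟦_⟧ (link-cong (λ d a c → cong₂ (step d (m a) (m c)) (e a) (e c)) b π)

    -- The argument of type `V` supplies the background assignment; since π exhausts the positions,
    -- each of its values is overwritten.
    ∑-all-total : V → ∀ {π} b → π ↭ allFin n → ∑-all n (λ y → ⟦ link (linkedAt y) b π ⟧) ≡ total b (map m π)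
    ∑-all-total v {π} b p = trans (∑-all-along n (linkedAt-Ext b π) (λ _ → v)) (trans
      (∑-along-↭ (linkedAt-Ext b π) (allFin⁺ n) (↭-sym p) (λ _ → v))
      (∑-along-total π b (λ _ → v) (Unique-↭ (↭-sym p) (allFin⁺ n))))

-- The substitutions T n

<ᵇ-true : ∀ {m n} → m < n → (m <ᵇ n) ≡ true
<ᵇ-true {zero}  {suc n} _         = refl
<ᵇ-true {suc m} {suc n} (s≤s m<n) = <ᵇ-true m<n

<ᵇ-false : ∀ {m n} → n ≤ m → (m <ᵇ n) ≡ false
<ᵇ-false {m}     {zero}  _         = refl
<ᵇ-false {suc m} {suc n} (s≤s n≤m) = <ᵇ-false n≤m

≤ᵇ-<ᵇ-suc : ∀ m n → (m ≤ᵇ n) ≡ (m <ᵇ suc n)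
≤ᵇ-<ᵇ-suc zero    n = refl
≤ᵇ-<ᵇ-suc (suc m) n = refl

≡ᵇ-true : ∀ {m n} → m ≡ n → (m ≡ᵇ n) ≡ true
≡ᵇ-true {zero}  refl = refl
≡ᵇ-true {suc m} refl = ≡ᵇ-true {m} refl

≡ᵇ-false : ∀ {m n} → m ≢ n → (m ≡ᵇ n) ≡ false
≡ᵇ-false {zero}  {zero}  m≢n = contradiction refl m≢n
≡ᵇ-false {zero}  {suc n} m≢n = refl
≡ᵇ-false {suc m} {zero}  m≢n = refl
≡ᵇ-false {suc m} {suc n} m≢n = ≡ᵇ-false {m} (m≢n ∘ cong suc)

st : Bool → ℕ → ℕ → Bool
st d x y = (x ≤ᵇ y) ∧ (not d ∨ (x <ᵇ y))

lex-< : ∀ {m m′} x → m < m′ → lex m m′ x ≡ true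
lex-< x m<m′ rewrite <ᵇ-true m<m′ = refl

lex-≡ : ∀ {m m′} x → m ≡ m′ → lex m m′ x ≡ x
lex-≡ {m} x refl rewrite <ᵇ-false (ℕP.≤-refl {m}) | ≡ᵇ-true {m} refl = refl

lex-> : ∀ {m m′} x → m′ < m → lex m m′ x ≡ false
lex-> x m′<m rewrite <ᵇ-false (ℕP.<⇒≤ m′<m) | ≡ᵇ-false (≢-sym (ℕP.<⇒≢ m′<m)) = refl

st-< : ∀ d {x y} → x < y → st d x y ≡ true
st-< d {x} {y} x<y rewrite ≤ᵇ-<ᵇ-suc x y | <ᵇ-true (ℕP.m<n⇒m<1+n x<y) | <ᵇ-true x<y with d
... | true  = refl
... | false = refl

st-≡ : ∀ d {x y} → x ≡ y → st d x y ≡ not d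
st-≡ d {x} refl rewrite ≤ᵇ-<ᵇ-suc x x | <ᵇ-true (ℕP.n<1+n x) | <ᵇ-false (ℕP.≤-refl {x}) with d
... | true  = refl
... | false = refl

st-> : ∀ d {x y} → y < x → st d x y ≡ false
st-> d {x} {y} y<x rewrite ≤ᵇ-<ᵇ-suc x y | <ᵇ-false y<x = refl

-- The window of the letter m consists of the n letters m n, …, m n + n - 1,
-- numbered by t from the top.
enc : ∀ {n} → ℕ → Fin n → ℕ
enc {n} m t = (n ∸ suc (toℕ t)) ℕ.+ m ℕ.* n

enc-lower : ∀ {n} m (t : Fin n) → enc m t < suc m ℕ.* n
enc-lower {suc n} m t = ℕP.+-monoˡ-< (m ℕ.* suc n) (s≤s (ℕP.m∸n≤m n (toℕ t)))

enc-mono : ∀ {n m m′} (t t′ : Fin n) → m < m′ → enc m t < enc m′ t′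
enc-mono {n} {m} {m′} t t′ m<m′ =
  ℕP.≤-trans (enc-lower m t) (ℕP.≤-trans (ℕP.*-monoˡ-≤ n m<m′) (ℕP.m≤n+m (m′ ℕ.* n) (n ∸ suc (toℕ t′))))

enc-anti : ∀ {n} m {t t′ : Fin n} → toℕ t′ < toℕ t → enc m t < enc m t′
enc-anti {n} m {t} t′<t = ℕP.+-monoˡ-< (m ℕ.* n) (ℕP.∸-monoʳ-< (s≤s t′<t) (FinP.toℕ<n t))

-- Different windows compare as their numbers do, and within a window the numbering from the top
-- reverses the order. So the step condition of F on actual letters becomes the step of the transfer
-- recursion.
st-enc : ∀ {n} d m m′ (t t′ : Fin n) → st d (enc m t) (enc m′ t′) ≡ lex m m′ (rT d t t′)
st-enc d m m′ t t′ with ℕP.<-cmp m m′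
... | tri< m<m′ _ _ = trans (st-< d (enc-mono t t′ m<m′)) (sym (lex-< (rT d t t′) m<m′))
... | tri> _ _ m′<m = trans (st-> d (enc-mono t′ t m′<m)) (sym (lex-> (rT d t t′) m′<m))
... | tri≈ _ refl _ = trans (eq d) (sym (lex-≡ {m} (rT d t t′) refl))
  where
  eq : ∀ d → st d (enc m t) (enc m t′) ≡ rT d t t′
  eq d with ℕP.<-cmp (toℕ t) (toℕ t′)
  eq true  | tri< t<t′ _ _ = trans (st-> true (enc-anti m {t′} {t} t<t′)) (sym (<ᵇ-false (ℕP.<⇒≤ t<t′)))
  eq false | tri< t<t′ _ _ = trans (st-> false (enc-anti m {t′} {t} t<t′)) (sym (<ᵇ-false t<t′))
  eq true  | tri≈ _ t≡t′ _ = trans (st-≡ true (cong (enc m) (FinP.toℕ-injective t≡t′))) (sym (<ᵇ-false (ℕP.≤-reflexive t≡t′)))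
  eq false | tri≈ _ t≡t′ _ = trans (st-≡ false (cong (enc m) (FinP.toℕ-injective t≡t′))) (sym (<ᵇ-true (s≤s (ℕP.≤-reflexive (sym t≡t′)))))
  eq true  | tri> _ _ t′<t = trans (st-< true (enc-anti m {t} {t′} t′<t)) (sym (<ᵇ-true t′<t))
  eq false | tri> _ _ t′<t = trans (st-< false (enc-anti m {t} {t′} t′<t)) (sym (<ᵇ-true (ℕP.m<n⇒m<1+n t′<t)))

-- The substitution read on coefficients: every letter in the window of m turns into plus or minus
-- the variable m, so the coefficient at a word gathers all words obtained by choosing one letter
-- from each of its windows.
T : ℕ → Series → Series
T n f []      = f []
T n f (m ∷ w) = ∑ (allFin n) λ t → wt (toℕ t) * T n (λ x → f (enc m t ∷ x)) w

T-cong-length : ∀ n w {f g : Series} → (∀ x → length x ≡ length w → f x ≡ g x) → T n f w ≡ T n g w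
T-cong-length n []      e = e [] refl
T-cong-length n (m ∷ w) e =
  ∑-cong (allFin n) λ t → cong (wt (toℕ t) *_) (T-cong-length n w λ x l → e (enc m t ∷ x) (cong suc l))

T-cong : ∀ n w {f g : Series} → f ≈ g → T n f w ≡ T n g w
T-cong n w e = T-cong-length n w λ x _ → e x

T-zero : ∀ n w → T n (λ _ → 0ℚ) w ≡ 0ℚ
T-zero n []      = refl
T-zero n (m ∷ w) = trans (∑-cong (allFin n) λ t → trans (cong (wt (toℕ t) *_) (T-zero n w)) (*-zeroʳ (wt (toℕ t)))) (∑-0 (allFin n))

nth-tabulate : ∀ {n} (g : Fin n → ℕ) i → nth (tabulate g) (toℕ i) ≡ g i
nth-tabulate g zero    = refl
nth-tabulate g (suc i) = nth-tabulate (g ∘ suc) i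

module AT (n : ℕ) = Assignments (allFin n) (wt ∘ toℕ)

letter : ∀ {n} → List ℕ → Fin n → ℕ
letter w i = nth w (toℕ i)

T-∑-all : ∀ n f w → T n f w ≡ AT.∑-all n (length w) λ y → f (tabulate λ i → enc (letter w i) (y i))
T-∑-all n f []      = refl
T-∑-all n f (m ∷ w) = ∑-cong (allFin n) λ t → cong (wt (toℕ t) *_) (T-∑-all n (λ x → f (enc m t ∷ x)) w)

T-linear : ∀ {X : Set} n (xs : List X) (c : X → ℚ) (f : X → Series) w →
           T n (λ x → ∑ xs (λ i → c i * f i x)) w ≡ ∑ xs (λ i → c i * T n (f i) w)
T-linear n xs c f w = trans (T-∑-all n _ w) (trans
  (AT.∑-all-linear n (length w) xs c _)
  (∑-cong xs λ i → cong (c i *_) (sym (T-∑-all n (f i) w))))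

-- F_(A,σ) with the permutation replaced by the list of positions along which the letters increase.
-- Linear extensions of a poset lead to series of the same form.
chainSeries : (n : ℕ) → (ℕ → Bool) → List (Fin n) → Series
chainSeries n b π w = if length w ≡ᵇ n then ⟦ link st b (map (letter w) π) ⟧ else 0ℚ

T-chainSeries : ∀ N {n} b {π : List (Fin n)} → π ↭ allFin n → ∀ w → length w ≡ n →
                T (suc N) (chainSeries n b π) w ≡ TT.total (suc N) b (map (letter w) π)
T-chainSeries N b {π} p w refl = begin
  T (suc N) (chainSeries n b π) w
    ≡⟨ T-∑-all (suc N) (chainSeries n b π) w ⟩
  ∑-all n (λ y → chainSeries n b π (tabulate λ i → enc (letter w i) (y i)))
    ≡⟨ ∑-all-cong n eq ⟩
  ∑-all n (λ y → ⟦ link (linkedAt rT (letter w) y) b π ⟧)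
    ≡⟨ ∑-all-total rT (letter w) zero b p ⟩
  TT.total (suc N) b (map (letter w) π) ∎
  where
  open ≡-Reasoning
  open AT (suc N)
  n = length w
  eq : ∀ y → chainSeries n b π (tabulate λ i → enc (letter w i) (y i)) ≡ ⟦ link (linkedAt rT (letter w) y) b π ⟧
  eq y rewrite ≡ᵇ-true (length-tabulate (λ i → enc (letter w i) (y i))) = cong ⟦_⟧ (trans
    (cong (link st b) (map-cong (nth-tabulate (λ i → enc (letter w i) (y i))) π))
    (trans (link-map (λ i → enc (letter w i) (y i)) st b π)
      (link-cong (λ d i j → st-enc d (letter w i) (letter w j) (y i) (y j)) b π)))

chainSeries-degree : ∀ {n} b π w → length w ≢ n → chainSeries n b π w ≡ 0ℚ
chainSeries-degree b π w l rewrite ≡ᵇ-false l = refl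

chainSeries-value : (n : ℕ) → (ℕ → Bool) → List (Fin n) → List ℕ → ℕ → ℚ
chainSeries-value n b π w zero    = if length w ≡ᵇ n then TK.total b (map (letter w) π) else 0ℚ
chainSeries-value n b π w (suc N) = T (suc N) (chainSeries n b π) w

chainSeries-Poly : ∀ {n} b {π : List (Fin n)} → π ↭ allFin n → ∀ w → Poly (chainSeries-value n b π w)
chainSeries-Poly {n} b {π} p w with length w ℕ.≟ n
... | yes l = Poly-cong (λ
  { zero    → cong (if_then TK.total b (map (letter w) π) else 0ℚ) (sym (≡ᵇ-true l))
  ; (suc N) → sym (T-chainSeries N b p w l) }) (chain-value-Poly b (map (letter w) π))
... | no l = null λ
  { zero    → cong (if_then TK.total b (map (letter w) π) else 0ℚ) (≡ᵇ-false l)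
  ; (suc N) → trans (T-cong-length (suc N) w λ x e → chainSeries-degree b π x (l ∘ trans (sym e))) (T-zero (suc N) w) }

permℕ-toℕ : ∀ {n} (σ : Permutation′ n) i → permℕ σ (suc (toℕ i)) ≡ suc (toℕ (σ ⟨$⟩ʳ i))
permℕ-toℕ {n} σ i with toℕ i <? n
... | yes p = cong (λ j → suc (toℕ (σ ⟨$⟩ʳ j))) (FinP.fromℕ<-toℕ i p)
... | no ¬p = contradiction (FinP.toℕ<n i) ¬p

all-below : (ℕ → Bool) → ℕ → Bool
all-below p zero    = true
all-below p (suc n) = p 0 ∧ all-below (p ∘ suc) n

allᵇ-applyUpTo : ∀ p (g : ℕ → ℕ) n → allᵇ p (applyUpTo g n) ≡ all-below (p ∘ g) n
allᵇ-applyUpTo p g zero    = refl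
allᵇ-applyUpTo p g (suc n) = cong (p (g 0) ∧_) (allᵇ-applyUpTo p (g ∘ suc) n)

link-tabulate : ∀ {X : Set} (ρ : Bool → X → X → Bool) b (h : ℕ → X) n →
  link ρ b (tabulate {n = suc n} (h ∘ toℕ)) ≡ all-below (λ k → ρ (b k) (h k) (h (suc k))) n
link-tabulate ρ b h zero    = refl
link-tabulate ρ b h (suc n) = cong (ρ (b 0) (h 0) (h 1) ∧_) (link-tabulate ρ (b ∘ suc) (h ∘ suc) n)

if-∧ : ∀ c x → (if c ∧ x then 1ℚ else 0ℚ) ≡ (if c then ⟦ x ⟧ else 0ℚ)
if-∧ true  x = refl
if-∧ false x = refl

image : ∀ {n} → Permutation′ n → List (Fin n)
image {n} σ = map (σ ⟨$⟩ʳ_) (allFin n)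

-- `A` counts places from 1 and `link` reads its bits from 0, hence `A ∘ suc`.
F-chainSeries : ∀ n A σ → F (pair n A σ) ≈ chainSeries n (A ∘ suc) (image σ)
F-chainSeries zero    A σ w = if-∧ (length w ≡ᵇ 0) true
F-chainSeries (suc n) A σ w = trans (if-∧ (length w ≡ᵇ suc n) _) (cong (λ x → if length w ≡ᵇ suc n then ⟦ x ⟧ else 0ℚ) (begin
  allᵇ (λ k → st (A k) (f k) (f (suc k))) (map suc (upTo n))
    ≡⟨ cong (allᵇ (λ k → st (A k) (f k) (f (suc k)))) (map-upTo suc n) ⟩
  allᵇ (λ k → st (A k) (f k) (f (suc k))) (applyUpTo suc n)
    ≡⟨ allᵇ-applyUpTo _ suc n ⟩
  all-below (λ k → st (A (suc k)) (f (suc k)) (f (suc (suc k)))) n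
    ≡⟨ link-tabulate st (A ∘ suc) (f ∘ suc) n ⟨
  link st (A ∘ suc) (tabulate {n = suc n} (f ∘ suc ∘ toℕ))
    ≡⟨ cong (link st (A ∘ suc)) (tabulate-cong λ i → cong (λ k → nth w (k ∸ 1)) (permℕ-toℕ σ i)) ⟩
  link st (A ∘ suc) (tabulate (λ i → letter w (σ ⟨$⟩ʳ i)))
    ≡⟨ cong (link st (A ∘ suc)) (trans (cong (map (letter w)) (map-tabulate id (σ ⟨$⟩ʳ_))) (map-tabulate (σ ⟨$⟩ʳ_) (letter w))) ⟨
  link st (A ∘ suc) (map (letter w) (image σ)) ∎))
  where
  open ≡-Reasoning
  f : ℕ → ℕ
  f i = nth w (permℕ σ i ∸ 1)

-- Linear extensions

bool-ext : ∀ {x y} → (x ≡ true → y ≡ true) → (y ≡ true → x ≡ true) → x ≡ y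
bool-ext f g = ⇔→≡ {z = true} (mk⇔ f g)

false≢true : false ≢ true
false≢true ()

not-true : ∀ {x} → not x ≡ true → x ≢ true
not-true {false} _ ()

allᵇ⁻ : ∀ {X : Set} {p : X → Bool} xs → allᵇ p xs ≡ true → All (λ x → p x ≡ true) xs
allᵇ⁻         []       e = []
allᵇ⁻ {p = p} (x ∷ xs) e = ∧-conicalˡ (p x) _ e ∷ allᵇ⁻ xs (∧-conicalʳ (p x) _ e)

allᵇ⁺ : ∀ {X : Set} {p : X → Bool} {xs} → All (λ x → p x ≡ true) xs → allᵇ p xs ≡ true
allᵇ⁺ []       = refl
allᵇ⁺ (p ∷ ps) = cong₂ _∧_ p (allᵇ⁺ ps)

linked : {X : Set} → (X → X → Bool) → List X → Bool
linked ρ = link (λ _ → ρ) (λ _ → false)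

linked⁻ : ∀ {X : Set} {ρ : X → X → Bool} xs → linked ρ xs ≡ true → Linked (λ x y → ρ x y ≡ true) xs
linked⁻         []           e = []
linked⁻         (x ∷ [])     e = [-]
linked⁻ {ρ = ρ} (x ∷ y ∷ xs) e = ∧-conicalˡ (ρ x y) _ e ∷ linked⁻ (y ∷ xs) (∧-conicalʳ (ρ x y) _ e)

linked⁺ : ∀ {X : Set} {ρ : X → X → Bool} {xs} → Linked (λ x y → ρ x y ≡ true) xs → linked ρ xs ≡ true
linked⁺ []       = refl
linked⁺ [-]      = refl
linked⁺ (r ∷ rs) = cong₂ _∧_ r (linked⁺ rs)

desc : {X : Set} → (X → X → Bool) → List X → ℕ → Bool
desc δ []          k       = false
desc δ (a ∷ [])    k       = false
desc δ (a ∷ c ∷ l) zero    = δ a c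
desc δ (a ∷ c ∷ l) (suc k) = desc δ (c ∷ l) k

link-desc : {X : Set} (ρ : Bool → X → X → Bool) (δ : X → X → Bool) → ∀ l →
            link ρ (desc δ l) l ≡ linked (λ a c → ρ (δ a c) a c) l
link-desc ρ δ []          = refl
link-desc ρ δ (a ∷ [])    = refl
link-desc ρ δ (a ∷ c ∷ l) = cong (ρ (δ a c) a c ∧_) (link-desc ρ δ (c ∷ l))

desc-map : {X Y : Set} (f : X → Y) (δ : Y → Y → Bool) → ∀ l k → desc δ (map f l) k ≡ desc (λ a c → δ (f a) (f c)) l k
desc-map f δ []          k       = refl
desc-map f δ (a ∷ [])    k       = refl
desc-map f δ (a ∷ c ∷ l) zero    = refl
desc-map f δ (a ∷ c ∷ l) (suc k) = desc-map f δ (c ∷ l) k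

desc-tabulate : ∀ {X : Set} (δ : X → X → Bool) (h : ℕ → X) n k →
                desc δ (tabulate {n = n} (h ∘ toℕ)) k ≡ (suc k <ᵇ n) ∧ δ (h k) (h (suc k))
desc-tabulate δ h zero          k       = refl
desc-tabulate δ h (suc zero)    k       = refl
desc-tabulate δ h (suc (suc n)) zero    = refl
desc-tabulate δ h (suc (suc n)) (suc k) = desc-tabulate δ (h ∘ suc) (suc n) k

-- Orderings of a list and sorting by insertion

ins : {X : Set} → X → List X → List (List X)
ins x []      = (x ∷ []) ∷ []
ins x (y ∷ l) = (x ∷ y ∷ l) ∷ map (y ∷_) (ins x l)

perms : {X : Set} → List X → List (List X)
perms []       = [] ∷ []
perms (x ∷ xs) = concatMap (ins x) (perms xs)

ins-↭ : ∀ {X : Set} (x : X) l → All (_↭ x ∷ l) (ins x l)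
ins-↭ x []      = ↭-refl ∷ []
ins-↭ x (y ∷ l) = ↭-refl ∷ AllP.map⁺ (All.map (λ p → ↭-trans (Perm.prep y p) (Perm.swap y x ↭-refl)) (ins-↭ x l))

perms-↭ : ∀ {X : Set} (xs : List X) → All (_↭ xs) (perms xs)
perms-↭ []       = ↭-refl ∷ []
perms-↭ (x ∷ xs) = AllP.concat⁺ (AllP.map⁺ (All.map (λ p → All.map (λ q → ↭-trans q (Perm.prep x p)) (ins-↭ x _)) (perms-↭ xs)))

-- The diagonal is left free, so that strict comparisons and weak ones such as `not (γ b <ᵇ γ a)`
-- both qualify.
record StrictTotal {X : Set} (ρ : X → X → Bool) : Set where
  field
    total : ∀ {x y} → x ≢ y → ρ x y ≡ not (ρ y x)
    trans′ : ∀ {x y z} → ρ x y ≡ true → ρ y z ≡ true → ρ x z ≡ true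

module Sorting {X : Set} {ρ : X → X → Bool} (S : StrictTotal ρ) where
  open StrictTotal S

  asym : ∀ {x y} → x ≢ y → ρ x y ≡ true → ρ y x ≢ true
  asym x≢y xy yx = false≢true (trans (sym (trans (total x≢y) (cong not yx))) xy)

  -- If `ρ x z`, then x fits only directly before z; if `ρ z x`, only behind z. Transitivity
  -- supplies the remaining comparison, y with z through x in the first case and y with x through z
  -- in the second.
  ∑-ins-after : ∀ {x y} l → All (x ≢_) l →
    ∑ (ins x l) (λ π → ⟦ linked ρ (y ∷ π) ⟧) ≡ ⟦ ρ y x ⟧ * ⟦ linked ρ (y ∷ l) ⟧
  ∑-ins-after {x} {y} [] _ = trans (+-identityʳ _) (trans (cong ⟦_⟧ (∧-identityʳ (ρ y x))) (sym (*-identityʳ ⟦ ρ y x ⟧)))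
  ∑-ins-after {x} {y} (z ∷ l) (x≢z ∷ x∉) = trans (cong (⟦ ρ y x ∧ ρ x z ∧ L ⟧ +_) rest) algebra
    where
    L = linked ρ (z ∷ l)
    rest : ∑ (map (z ∷_) (ins x l)) (λ π → ⟦ linked ρ (y ∷ π) ⟧) ≡ ⟦ ρ y z ⟧ * (⟦ ρ z x ⟧ * ⟦ L ⟧)
    rest = trans (∑-map (z ∷_) (ins x l) (λ π → ⟦ linked ρ (y ∷ π) ⟧)) (trans (∑-cong (ins x l) λ π → ⟦∧⟧ (ρ y z) (linked ρ (z ∷ π)))
      (trans (∑-*ˡ (ins x l) ⟦ ρ y z ⟧ (λ π → ⟦ linked ρ (z ∷ π) ⟧)) (cong (⟦ ρ y z ⟧ *_) (∑-ins-after l x∉))))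
    algebra : ⟦ ρ y x ∧ ρ x z ∧ L ⟧ + ⟦ ρ y z ⟧ * (⟦ ρ z x ⟧ * ⟦ L ⟧) ≡ ⟦ ρ y x ⟧ * ⟦ ρ y z ∧ L ⟧
    algebra with ρ x z in xz | ρ z x in zx | total x≢z
    ... | true  | true  | ()
    ... | false | false | ()
    ... | true  | false | _ with ρ y x in yx
    ...   | false = trans (+-identityˡ _) (trans (cong (⟦ ρ y z ⟧ *_) (*-zeroˡ ⟦ L ⟧)) (trans (*-zeroʳ ⟦ ρ y z ⟧) (sym (*-zeroˡ ⟦ ρ y z ∧ L ⟧))))
    ...   | true rewrite trans′ yx xz = trans (cong (λ q → ⟦ L ⟧ + 1ℚ * q) (*-zeroˡ ⟦ L ⟧)) (trans (+-identityʳ ⟦ L ⟧) (sym (*-identityˡ ⟦ L ⟧)))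
    algebra | false | true | _ with ρ y z in yz
    ...   | false rewrite ∧-zeroʳ (ρ y x) = trans (+-identityˡ _) (trans (*-zeroˡ (1ℚ * ⟦ L ⟧)) (sym (*-zeroʳ ⟦ ρ y x ⟧)))
    ...   | true rewrite trans′ yz zx = trans (+-identityˡ _) (*-identityˡ _)

  ∑-ins : ∀ {x} l → All (x ≢_) l → ∑ (ins x l) (λ π → ⟦ linked ρ π ⟧) ≡ ⟦ linked ρ l ⟧
  ∑-ins []      _ = refl
  ∑-ins {x} (y ∷ l) (x≢y ∷ x∉) = trans (cong (⟦ ρ x y ∧ L ⟧ +_)
      (trans (∑-map (y ∷_) (ins x l) (λ π → ⟦ linked ρ π ⟧)) (∑-ins-after l x∉))) algebra
    where
    L = linked ρ (y ∷ l)
    algebra : ⟦ ρ x y ∧ L ⟧ + ⟦ ρ y x ⟧ * ⟦ L ⟧ ≡ ⟦ L ⟧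
    algebra with ρ x y | ρ y x | total x≢y
    ... | true  | true  | ()
    ... | false | false | ()
    ... | true  | false | _ = trans (cong (⟦ L ⟧ +_) (*-zeroˡ ⟦ L ⟧)) (+-identityʳ ⟦ L ⟧)
    ... | false | true  | _ = trans (+-identityˡ _) (*-identityˡ ⟦ L ⟧)

  -- Insertion sort: the tail has exactly one sorted ordering, and x fits into it at exactly one
  -- place.
  ∑-perms : ∀ {xs} → Unique xs → ∑ (perms xs) (λ π → ⟦ linked ρ π ⟧) ≡ 1ℚ
  ∑-perms {[]}     _        = refl
  ∑-perms {x ∷ xs} (x∉ ∷ u) = trans (∑-concatMap (ins x) (perms xs) (λ π → ⟦ linked ρ π ⟧)) (trans
    (∑-cong-All (perms-↭ xs) λ π p → ∑-ins π (All-resp-↭ (↭-sym p) x∉)) (∑-perms u))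

AllPairs-trichotomy : ∀ {X : Set} {Q : X → X → Set} {xs x y} → AllPairs Q xs → x ∈ xs → y ∈ xs → x ≡ y ⊎ Q x y ⊎ Q y x
AllPairs-trichotomy (_ ∷ _)  (here refl) (here refl) = inj₁ refl
AllPairs-trichotomy (q ∷ _)  (here refl) (there y∈)  = inj₂ (inj₁ (All.lookup q y∈))
AllPairs-trichotomy (q ∷ _)  (there x∈)  (here refl) = inj₂ (inj₂ (All.lookup q x∈))
AllPairs-trichotomy (_ ∷ qs) (there x∈)  (there y∈)  = AllPairs-trichotomy qs x∈ y∈

ext : {X : Set} → (X → X → Bool) → List X → Bool
ext lt []      = true
ext lt (a ∷ l) = allᵇ (λ b → not (lt b a)) l ∧ ext lt l

ext⁻ : ∀ {X : Set} {lt : X → X → Bool} l → ext lt l ≡ true → AllPairs (λ a b → lt b a ≢ true) l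
ext⁻ []      e = []
ext⁻ (a ∷ l) e = All.map not-true (allᵇ⁻ l (∧-conicalˡ _ _ e)) ∷ ext⁻ l (∧-conicalʳ _ _ e)

ext⁺ : ∀ {X : Set} {lt : X → X → Bool} {l} → AllPairs (λ a b → lt b a ≢ true) l → ext lt l ≡ true
ext⁺ []       = refl
ext⁺ (q ∷ qs) = cong₂ _∧_ (allᵇ⁺ (All.map flip-not q)) (ext⁺ qs)
  where
  flip-not : ∀ {x} → x ≢ true → not x ≡ true
  flip-not {true}  h = contradiction refl h
  flip-not {false} h = refl

partition : {X : Set} → (lt ρ : X → X → Bool) → List X → Bool
partition lt ρ xs = allᵇ (λ a → allᵇ (λ b → not (lt a b) ∨ ρ a b) xs) xs

partition⁻ : ∀ {X : Set} {lt ρ : X → X → Bool} xs → partition lt ρ xs ≡ true →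
             ∀ {a b} → a ∈ xs → b ∈ xs → lt a b ≡ true → ρ a b ≡ true
partition⁻ {lt = lt} {ρ} xs e {a} {b} a∈ b∈ ab = imp (lt a b) (All.lookup (allᵇ⁻ xs (All.lookup (allᵇ⁻ xs e) a∈)) b∈) ab
  where
  imp : ∀ x {y} → not x ∨ y ≡ true → x ≡ true → y ≡ true
  imp true e refl = e

partition⁺ : ∀ {X : Set} {lt ρ : X → X → Bool} xs →
             (∀ {a b} → a ∈ xs → b ∈ xs → lt a b ≡ true → ρ a b ≡ true) → partition lt ρ xs ≡ true
partition⁺ {lt = lt} xs h = allᵇ⁺ (All.tabulate λ {a} a∈ → allᵇ⁺ (All.tabulate λ {b} b∈ → imp (lt a b) (h a∈ b∈)))
  where
  imp : ∀ x {y} → (x ≡ true → y ≡ true) → not x ∨ y ≡ true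
  imp true  f = f refl
  imp false f = refl

module _ {X : Set} {lt ρ : X → X → Bool} (irrefl : ∀ a → lt a a ≡ false) (S : StrictTotal ρ) where
  open StrictTotal S
  open Sorting S

  -- In a sorted list ρ is the order of occurrence, so both sides say that `lt` never runs against
  -- ρ. Two elements related by `lt` are distinct and occur in one of two orders, of which `ext`
  -- rules out the wrong one.
  ext≡partition : ∀ {xs π} → Unique xs → π ↭ xs → linked ρ π ≡ true → ext lt π ≡ partition lt ρ xs
  ext≡partition {xs} {π} u p l = bool-ext to from
    where
    sorted : AllPairs (λ a b → ρ a b ≡ true) π
    sorted = Linked⇒AllPairs trans′ (linked⁻ π l)
    distinct : Unique π
    distinct = Unique-↭ (↭-sym p) u
    to : ext lt π ≡ true → partition lt ρ xs ≡ true
    to e = partition⁺ xs λ {a} {b} a∈ b∈ ab → pick ab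
      (AllPairs-trichotomy (AllPairs.zip (sorted , ext⁻ π e)) (∈-resp-↭ (↭-sym p) a∈) (∈-resp-↭ (↭-sym p) b∈))
      where
      pick : ∀ {a b} → lt a b ≡ true → a ≡ b ⊎ (ρ a b ≡ true × lt b a ≢ true) ⊎ (ρ b a ≡ true × lt a b ≢ true) → ρ a b ≡ true
      pick {a} ab (inj₁ refl)            = contradiction (trans (sym (irrefl a)) ab) false≢true
      pick ab (inj₂ (inj₁ (r , _)))  = r
      pick ab (inj₂ (inj₂ (_ , ¬l))) = contradiction ab ¬l
    from : partition lt ρ xs ≡ true → ext lt π ≡ true
    from e = ext⁺ (members (λ a∈ b∈ (a≢b , ab) ba → asym a≢b ab (partition⁻ {lt = lt} {ρ} xs e b∈ a∈ ba)) (All.tabulate (∈-resp-↭ p)) (AllPairs.zip (distinct , sorted)))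
      where
      members : ∀ {Q R : X → X → Set} → (∀ {a b} → a ∈ xs → b ∈ xs → Q a b → R a b) → ∀ {l} → All (_∈ xs) l → AllPairs Q l → AllPairs R l
      members f []       []       = []
      members f (m ∷ ms) (q ∷ qs) = All.zipWith (λ (m′ , q) → f m m′ q) (ms , q) ∷ members f ms qs

  -- A P-partition is compatible with exactly one linear order of the
  -- elements, and that one extends P.
  ∑-linear-extensions : ∀ {xs} → Unique xs →
    ⟦ partition lt ρ xs ⟧ ≡ ∑ (perms xs) (λ π → ⟦ ext lt π ⟧ * ⟦ linked ρ π ⟧)
  ∑-linear-extensions {xs} u = begin
    ⟦ partition lt ρ xs ⟧
      ≡⟨ *-identityʳ _ ⟨
    ⟦ partition lt ρ xs ⟧ * 1ℚ
      ≡⟨ cong (⟦ partition lt ρ xs ⟧ *_) (∑-perms u) ⟨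
    ⟦ partition lt ρ xs ⟧ * ∑ (perms xs) (λ π → ⟦ linked ρ π ⟧)
      ≡⟨ ∑-*ˡ (perms xs) ⟦ partition lt ρ xs ⟧ (λ π → ⟦ linked ρ π ⟧) ⟨
    ∑ (perms xs) (λ π → ⟦ partition lt ρ xs ⟧ * ⟦ linked ρ π ⟧)
      ≡⟨ ∑-cong-All (perms-↭ xs) (λ π p → sym (step π p)) ⟩
    ∑ (perms xs) (λ π → ⟦ ext lt π ⟧ * ⟦ linked ρ π ⟧) ∎
    where
    open ≡-Reasoning
    step : ∀ π → π ↭ xs → ⟦ ext lt π ⟧ * ⟦ linked ρ π ⟧ ≡ ⟦ partition lt ρ xs ⟧ * ⟦ linked ρ π ⟧
    step π p with linked ρ π in l
    ... | false = trans (*-zeroʳ ⟦ ext lt π ⟧) (sym (*-zeroʳ ⟦ partition lt ρ xs ⟧))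
    ... | true  = cong (λ x → ⟦ x ⟧ * 1ℚ) (ext≡partition u p l)

-- Total orders refined by absolute values, labels and signs

lex⁻ : ∀ m m′ x → lex m m′ x ≡ true → m < m′ ⊎ (m ≡ m′ × x ≡ true)
lex⁻ m m′ x e with ℕP.<-cmp m m′
... | tri< m<m′ _ _    = inj₁ m<m′
... | tri≈ _ refl _    = inj₂ (refl , trans (sym (lex-≡ {m} x refl)) e)
... | tri> _ _ m′<m    = contradiction (trans (sym (lex-> x m′<m)) e) false≢true

lex-StrictTotal : ∀ {X : Set} (v : X → ℕ) {τ : X → X → Bool} → StrictTotal τ → StrictTotal (λ a b → lex (v a) (v b) (τ a b))
lex-StrictTotal v {τ} S = record { total = tot ; trans′ = tr }
  where
  open StrictTotal S
  tot : ∀ {a b} → a ≢ b → lex (v a) (v b) (τ a b) ≡ not (lex (v b) (v a) (τ b a))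
  tot {a} {b} a≢b with ℕP.<-cmp (v a) (v b)
  ... | tri< l _ _ = trans (lex-< (τ a b) l) (cong not (sym (lex-> (τ b a) l)))
  ... | tri≈ _ e _ = trans (lex-≡ (τ a b) e) (trans (total a≢b) (cong not (sym (lex-≡ (τ b a) (sym e)))))
  ... | tri> _ _ l = trans (lex-> (τ a b) l) (cong not (sym (lex-< (τ b a) l)))
  tr : ∀ {a b c} → lex (v a) (v b) (τ a b) ≡ true → lex (v b) (v c) (τ b c) ≡ true → lex (v a) (v c) (τ a c) ≡ true
  tr {a} {b} {c} p q with lex⁻ (v a) (v b) (τ a b) p | lex⁻ (v b) (v c) (τ b c) q
  ... | inj₁ l       | inj₁ l′       = lex-< (τ a c) (ℕP.<-trans l l′)
  ... | inj₁ l       | inj₂ (e , _)  = lex-< (τ a c) (ℕP.<-≤-trans l (ℕP.≤-reflexive e))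
  ... | inj₂ (e , _) | inj₁ l        = lex-< (τ a c) (ℕP.≤-<-trans (ℕP.≤-reflexive e) l)
  ... | inj₂ (e , r) | inj₂ (e′ , r′) = trans (lex-≡ (τ a c) (trans e e′)) (trans′ r r′)

<ᵇ⁻ : ∀ m n → (m <ᵇ n) ≡ true → m < n
<ᵇ⁻ m n e with m <? n
... | yes l = l
... | no ¬l = contradiction (trans (sym (<ᵇ-false (ℕP.≮⇒≥ ¬l))) e) false≢true

<ᵇ-flip : ∀ {m n} → m ≢ n → (m <ᵇ n) ≡ not (n <ᵇ m)
<ᵇ-flip {m} {n} m≢n with ℕP.<-cmp m n
... | tri< l _ _ = trans (<ᵇ-true l) (cong not (sym (<ᵇ-false (ℕP.<⇒≤ l))))
... | tri≈ _ e _ = contradiction e m≢n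
... | tri> _ _ l = trans (<ᵇ-false (ℕP.<⇒≤ l)) (cong not (sym (<ᵇ-true l)))

module _ {X : Set} (γ : X → ℕ) (γ-inj : ∀ {a b} → γ a ≡ γ b → a ≡ b) where

  above-StrictTotal : StrictTotal (λ a b → not (γ b <ᵇ γ a))
  above-StrictTotal = record
    { total = λ a≢b → cong not (<ᵇ-flip (λ e → a≢b (γ-inj (sym e))))
    ; trans′ = λ {a} {b} {c} p q → cong not (<ᵇ-false (ℕP.≤-trans (le a b p) (le b c q))) }
    where
    le : ∀ a b → not (γ b <ᵇ γ a) ≡ true → γ a ≤ γ b
    le a b p = ℕP.≮⇒≥ λ l → not-true p (<ᵇ-true l)

  -- With the signs fixed, this is the order in which elements of equal absolute value have to come:
  -- first the negative ones with decreasing labels, then the positive ones with increasing labels.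
  rK-StrictTotal : (y : X → Bool) → StrictTotal (λ a b → rK (γ b <ᵇ γ a) (y a) (y b))
  rK-StrictTotal y = record { total = tot ; trans′ = tr }
    where
    tot : ∀ {a b} → a ≢ b → rK (γ b <ᵇ γ a) (y a) (y b) ≡ not (rK (γ a <ᵇ γ b) (y b) (y a))
    tot {a} {b} a≢b rewrite <ᵇ-flip {γ b} {γ a} (λ e → a≢b (γ-inj (sym e))) with γ a <ᵇ γ b | y a | y b
    ... | true  | true  | true  = refl
    ... | true  | true  | false = refl
    ... | true  | false | true  = refl
    ... | true  | false | false = refl
    ... | false | true  | true  = refl
    ... | false | true  | false = refl
    ... | false | false | true  = refl
    ... | false | false | false = refl
    rK-neg : ∀ d → rK d false false ≡ true → d ≡ true
    rK-neg true _ = refl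
    rK-pos : ∀ d → rK d true true ≡ true → d ≡ false
    rK-pos false _ = refl
    rK-up : ∀ d → rK d false true ≡ true
    rK-up true  = refl
    rK-up false = refl
    rK-down : ∀ d → rK d true false ≢ true
    rK-down true  ()
    rK-down false ()
    tr : ∀ {a b c} → rK (γ b <ᵇ γ a) (y a) (y b) ≡ true → rK (γ c <ᵇ γ b) (y b) (y c) ≡ true → rK (γ c <ᵇ γ a) (y a) (y c) ≡ true
    tr {a} {b} {c} p q with y a | y b | y c
    ... | false | _     | true  = rK-up (γ c <ᵇ γ a)
    ... | false | false | false = cong (λ d → rK d false false)
      (<ᵇ-true (ℕP.<-trans (<ᵇ⁻ (γ c) (γ b) (rK-neg _ q)) (<ᵇ⁻ (γ b) (γ a) (rK-neg _ p))))
    ... | false | true  | false = contradiction q (rK-down (γ c <ᵇ γ b))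
    ... | true  | false | _     = contradiction p (rK-down (γ b <ᵇ γ a))
    ... | true  | true  | false = contradiction q (rK-down (γ c <ᵇ γ b))
    ... | true  | true  | true  = cong (λ d → rK d true true)
      (<ᵇ-false (ℕP.≤-trans (ge {γ b} {γ a} (rK-pos _ p)) (ge {γ c} {γ b} (rK-pos _ q))))
      where
      ge : ∀ {m n} → (m <ᵇ n) ≡ false → n ≤ m
      ge e = ℕP.≮⇒≥ λ l → false≢true (trans (sym e) (<ᵇ-true l))

-- Enriched partitions

module AK = Assignments signs (λ _ → 1ℚ)

∑-allSigns : ∀ n {φ : (Fin n → Bool) → ℚ} → AK.Ext φ → ∑ (allSigns n) (λ s → φ (Vec.lookup s)) ≡ AK.∑-all n φ
∑-allSigns zero    {φ} E = trans (+-identityʳ _) (E λ ())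
∑-allSigns (suc n) {φ} E = begin
  ∑ (map (true Vec.∷_) (allSigns n) ++ map (false Vec.∷_) (allSigns n)) (λ s → φ (Vec.lookup s))
    ≡⟨ ∑-++ (map (true Vec.∷_) (allSigns n)) _ _ ⟩
  ∑ (map (true Vec.∷_) (allSigns n)) (λ s → φ (Vec.lookup s)) + ∑ (map (false Vec.∷_) (allSigns n)) (λ s → φ (Vec.lookup s))
    ≡⟨ cong₂ _+_ (half true) (half false) ⟩
  1ℚ * AK.∑-all n (φ ∘ AK.cons true) + 1ℚ * AK.∑-all n (φ ∘ AK.cons false)
    ≡⟨ cong (1ℚ * AK.∑-all n (φ ∘ AK.cons true) +_) (+-identityʳ _) ⟨
  1ℚ * AK.∑-all n (φ ∘ AK.cons true) + (1ℚ * AK.∑-all n (φ ∘ AK.cons false) + 0ℚ) ∎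
  where
  open ≡-Reasoning
  half : ∀ v → ∑ (map (v Vec.∷_) (allSigns n)) (λ s → φ (Vec.lookup s)) ≡ 1ℚ * AK.∑-all n (φ ∘ AK.cons v)
  half v = trans (∑-map (v Vec.∷_) (allSigns n) _) (trans
    (∑-cong (allSigns n) λ s → E λ { zero → refl ; (suc i) → refl })
    (trans (∑-allSigns n (E ∘ AK.cons-cong v)) (sym (*-identityˡ _))))

below : ∀ {n} → FinPoset n → Fin n → Fin n → Bool
below P a b = ⌊ dec P a b ⌋ ∧ not ⌊ a Fin.≟ b ⌋

below-irrefl : ∀ {n} (P : FinPoset n) a → below P a a ≡ false
below-irrefl P a with a Fin.≟ a
... | yes _  = ∧-zeroʳ ⌊ dec P a a ⌋
... | no a≢a = contradiction refl a≢a

descents : ∀ {n} → Permutation′ n → List (Fin n) → ℕ → Bool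
descents γ = desc (λ a b → toℕ (γ ⟨$⟩ʳ b) <ᵇ toℕ (γ ⟨$⟩ʳ a))

module _ {n : ℕ} (P : FinPoset n) (γ σ : Permutation′ n) (w : List ℕ) where

  private
    label : Fin n → ℕ
    label a = toℕ (γ ⟨$⟩ʳ a)
    m : Fin n → ℕ
    m a = letter w (σ ⟨$⟩ʳ a)

    label-injective : ∀ {a b} → label a ≡ label b → a ≡ b
    label-injective {a} {b} e = trans (sym (inverseˡ γ)) (trans (cong (γ ⟨$⟩ˡ_) (FinP.toℕ-injective e)) (inverseˡ γ))

    condK : (Fin n → Bool) → Fin n → Fin n → Bool
    condK y a b =
      not (below P a b) ∨
        (((m a <ᵇ m b) ∨ ((m a ≡ᵇ m b) ∧ (not (y a) ∨ y b)))
        ∧ (not ((m a ≡ᵇ m b) ∧ y a ∧ y b) ∨ (label a <ᵇ label b))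
        ∧ (not ((m a ≡ᵇ m b) ∧ not (y a) ∧ not (y b)) ∨ (label b <ᵇ label a)))

  precedes : (Fin n → Bool) → Fin n → Fin n → Bool
  precedes y a b = lex (m a) (m b) (rK (label b <ᵇ label a) (y a) (y b))

  precedes-StrictTotal : ∀ y → StrictTotal (precedes y)
  precedes-StrictTotal y = lex-StrictTotal m (rK-StrictTotal label label-injective y)

  private
    -- For a ≠ b the labels differ, so at equal absolute values exactly one of the two label
    -- conditions can be met; together with -k ≺ k this leaves precisely the pairs of signs allowed
    -- by `rK`.
    condK-precedes : ∀ y a b → condK y a b ≡ not (below P a b) ∨ precedes y a b
    condK-precedes y a b with a Fin.≟ b
    ... | yes _ rewrite ∧-zeroʳ ⌊ dec P a b ⌋ = refl
    ... | no a≢b = cong (not (⌊ dec P a b ⌋ ∧ true) ∨_) eq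
      where
      eq : ((m a <ᵇ m b) ∨ ((m a ≡ᵇ m b) ∧ (not (y a) ∨ y b)))
        ∧ (not ((m a ≡ᵇ m b) ∧ y a ∧ y b) ∨ (label a <ᵇ label b))
        ∧ (not ((m a ≡ᵇ m b) ∧ not (y a) ∧ not (y b)) ∨ (label b <ᵇ label a)) ≡ precedes y a b
      eq with ℕP.<-cmp (m a) (m b)
      ... | tri< l ne _ rewrite <ᵇ-true l | ≡ᵇ-false ne = refl
      ... | tri> _ ne l rewrite <ᵇ-false (ℕP.<⇒≤ l) | ≡ᵇ-false ne = refl
      ... | tri≈ _ e _ rewrite <ᵇ-false (ℕP.≤-reflexive (sym e)) | ≡ᵇ-true e
          | <ᵇ-flip {label b} {label a} (λ e → a≢b (label-injective (sym e))) with label a <ᵇ label b | y a | y b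
      ... | true  | true  | true  = refl
      ... | true  | true  | false = refl
      ... | true  | false | true  = refl
      ... | true  | false | false = refl
      ... | false | true  | true  = refl
      ... | false | true  | false = refl
      ... | false | false | true  = refl
      ... | false | false | false = refl

    allᵇ-cong : ∀ {X : Set} {p q : X → Bool} xs → (∀ x → p x ≡ q x) → allᵇ p xs ≡ allᵇ q xs
    allᵇ-cong []       e = refl
    allᵇ-cong (x ∷ xs) e = cong₂ _∧_ (e x) (allᵇ-cong xs e)

    precedes-cong : ∀ {y z} → (∀ i → y i ≡ z i) → ∀ a b → precedes y a b ≡ precedes z a b
    precedes-cong e a b = cong₂ (λ s s′ → lex (m a) (m b) (rK (label b <ᵇ label a) s s′)) (e a) (e b)

  K-∑-all : length w ≡ n → K P γ σ w ≡ AK.∑-all n λ y → ⟦ partition (below P) (precedes y) (allFin n) ⟧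
  K-∑-all l rewrite ≡ᵇ-true l = trans
    (∑-cong (allSigns n) λ s → cong ⟦_⟧ (allᵇ-cong (allFin n) λ a → allᵇ-cong (allFin n) λ b → condK-precedes (Vec.lookup s) a b))
    (∑-allSigns n λ e → cong ⟦_⟧ (allᵇ-cong (allFin n) λ a → allᵇ-cong (allFin n) λ b →
      cong (not (below P a b) ∨_) (precedes-cong e a b)))

  ∑-all-linked : ∀ {π} → π ↭ allFin n → AK.∑-all n (λ y → ⟦ linked (precedes y) π ⟧) ≡ TK.total (descents γ π) (map m π)
  ∑-all-linked {π} p = trans
    (AK.∑-all-cong n λ y → cong ⟦_⟧ (sym (link-desc (λ d a b → lex (m a) (m b) (rK d (y a) (y b))) (λ a b → label b <ᵇ label a) π)))
    (AK.∑-all-total rK m true (descents γ π) p)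

  -- For each choice of signs, sorting by `precedes y` singles out one linear order. Exchanging the
  -- sum over signs with the sum over orders leaves one chain count for each linear extension.
  K-linear-extensions : length w ≡ n →
    K P γ σ w ≡ ∑ (perms (allFin n)) (λ π → ⟦ ext (below P) π ⟧ * TK.total (descents γ π) (map m π))
  K-linear-extensions l = begin
    K P γ σ w
      ≡⟨ K-∑-all l ⟩
    AK.∑-all n (λ y → ⟦ partition (below P) (precedes y) (allFin n) ⟧)
      ≡⟨ AK.∑-all-cong n (λ y → ∑-linear-extensions (below-irrefl P) (precedes-StrictTotal y) (allFin⁺ n)) ⟩
    AK.∑-all n (λ y → ∑ (perms (allFin n)) (λ π → ⟦ ext (below P) π ⟧ * ⟦ linked (precedes y) π ⟧))
      ≡⟨ AK.∑-all-linear n (perms (allFin n)) (λ π → ⟦ ext (below P) π ⟧) (λ π y → ⟦ linked (precedes y) π ⟧) ⟩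
    ∑ (perms (allFin n)) (λ π → ⟦ ext (below P) π ⟧ * AK.∑-all n (λ y → ⟦ linked (precedes y) π ⟧))
      ≡⟨ ∑-cong-All (perms-↭ (allFin n)) (λ π p → cong (⟦ ext (below P) π ⟧ *_) (∑-all-linked p)) ⟩
    ∑ (perms (allFin n)) (λ π → ⟦ ext (below P) π ⟧ * TK.total (descents γ π) (map m π)) ∎
    where open ≡-Reasoning

below-chain⁻ : ∀ {n} (a b : Fin n) → below (chain n) a b ≡ true → a Fin.< b
below-chain⁻ {n} a b e with a FinP.≤? b | a Fin.≟ b
... | yes a≤b | no a≢b = FinP.≤∧≢⇒< a≤b a≢b
below-chain⁻ {n} a b () | yes _ | yes _
below-chain⁻ {n} a b () | no _  | _

below-chain⁺ : ∀ {n} {a b : Fin n} → a Fin.< b → below (chain n) a b ≡ true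
below-chain⁺ {a = a} {b} l with a FinP.≤? b | a Fin.≟ b
... | yes _  | no _    = refl
... | yes _  | yes a≡b = contradiction a≡b (FinP.<⇒≢ l)
... | no a≰b | _       = contradiction (ℕP.<⇒≤ l) a≰b

partition-chain : ∀ n {ρ} → StrictTotal ρ → partition (below (chain n)) ρ (allFin n) ≡ linked ρ (allFin n)
partition-chain n {ρ} S = bool-ext to from
  where
  open StrictTotal S
  to : partition (below (chain n)) ρ (allFin n) ≡ true → linked ρ (allFin n) ≡ true
  to e = linked⁺ (AllPairs⇒Linked (AllPairsP.tabulate⁺-< λ {a} {b} a<b →
    partition⁻ {lt = below (chain n)} {ρ} (allFin n) e (∈-allFin a) (∈-allFin b) (below-chain⁺ a<b)))
  from : linked ρ (allFin n) ≡ true → partition (below (chain n)) ρ (allFin n) ≡ true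
  from e = partition⁺ (allFin n) λ {a} {b} a∈ b∈ ab → pick (below-chain⁻ a b ab)
    (AllPairs-trichotomy (AllPairs.zip (Linked⇒AllPairs trans′ (linked⁻ (allFin n) e) , AllPairsP.tabulate⁺-< id)) a∈ b∈)
    where
    pick : ∀ {a b : Fin n} → a Fin.< b → a ≡ b ⊎ (ρ a b ≡ true × a Fin.< b) ⊎ (ρ b a ≡ true × b Fin.< a) → ρ a b ≡ true
    pick l (inj₁ e)             = contradiction e (FinP.<⇒≢ l)
    pick l (inj₂ (inj₁ (r , _)))  = r
    pick l (inj₂ (inj₂ (_ , l′))) = contradiction l′ (ℕP.<-asym l)

K-chain : ∀ {n} (γ σ : Permutation′ n) w → length w ≡ n →
  K (chain n) γ σ w ≡ TK.total (descents γ (allFin n)) (map (letter w) (image σ))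
K-chain {n} γ σ w l = begin
  K (chain n) γ σ w
    ≡⟨ K-∑-all (chain n) γ σ w l ⟩
  AK.∑-all n (λ y → ⟦ partition (below (chain n)) (precedes (chain n) γ σ w y) (allFin n) ⟧)
    ≡⟨ AK.∑-all-cong n (λ y → cong ⟦_⟧ (partition-chain n (precedes-StrictTotal (chain n) γ σ w y))) ⟩
  AK.∑-all n (λ y → ⟦ linked (precedes (chain n) γ σ w y) (allFin n) ⟧)
    ≡⟨ ∑-all-linked (chain n) γ σ w ↭-refl ⟩
  TK.total (descents γ (allFin n)) (map (letter w ∘ (σ ⟨$⟩ʳ_)) (allFin n))
    ≡⟨ cong (TK.total (descents γ (allFin n))) (map-∘ (allFin n)) ⟩
  TK.total (descents γ (allFin n)) (map (letter w) (image σ)) ∎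
  where open ≡-Reasoning

-- Interpolating Θ between the T n

⟨$⟩ʳ-injective : ∀ {n} (σ : Permutation′ n) {i j} → σ ⟨$⟩ʳ i ≡ σ ⟨$⟩ʳ j → i ≡ j
⟨$⟩ʳ-injective σ e = trans (sym (inverseˡ σ)) (trans (cong (σ ⟨$⟩ˡ_) e) (inverseˡ σ))

image-↭ : ∀ {n} (σ : Permutation′ n) → image σ ↭ allFin n
image-↭ {n} σ = ∼bag⇒↭ (unique∧set⇒bag (Unique.map⁺ (⟨$⟩ʳ-injective σ) (allFin⁺ n)) (allFin⁺ n)
  (mk⇔ (λ _ → ∈-allFin _) (λ _ → subst (_∈ image σ) (inverseʳ σ) (∈-map⁺ (σ ⟨$⟩ʳ_) (∈-allFin (σ ⟨$⟩ˡ _))))))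

descents-allFin : ∀ {n} (γ : Permutation′ n) k →
  descents γ (allFin n) k ≡ (suc k <ᵇ n) ∧ (permℕ γ (suc (suc k)) <ᵇ permℕ γ (suc k))
descents-allFin {n} γ k = begin
  desc (λ a b → f b <ᵇ f a) (allFin n) k
    ≡⟨ desc-map f (λ x y → y <ᵇ x) (allFin n) k ⟨
  desc (λ x y → y <ᵇ x) (map f (allFin n)) k
    ≡⟨ cong (λ l → desc (λ x y → y <ᵇ x) l k)
         (trans (map-tabulate id f) (tabulate-cong λ i → sym (permℕ-toℕ γ i))) ⟩
  desc (λ x y → y <ᵇ x) (tabulate {n = n} (h ∘ toℕ)) k
    ≡⟨ desc-tabulate (λ x y → y <ᵇ x) h n k ⟩
  (suc k <ᵇ n) ∧ (h (suc k) <ᵇ h k) ∎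
  where
  open ≡-Reasoning
  f : Fin n → ℕ
  f a = suc (toℕ (γ ⟨$⟩ʳ a))
  h : ℕ → ℕ
  h k = permℕ γ (suc k)

permℕ-injective : ∀ {n} (γ : Permutation′ n) {i j} → i < n → j < n → permℕ γ (suc i) ≡ permℕ γ (suc j) → i ≡ j
permℕ-injective γ {i} {j} i<n j<n e = begin
  i                 ≡⟨ FinP.toℕ-fromℕ< i<n ⟨
  toℕ (fromℕ< i<n)  ≡⟨ cong toℕ (⟨$⟩ʳ-injective γ (FinP.toℕ-injective (ℕP.suc-injective (trans (sym (value i<n)) (trans e (value j<n)))))) ⟩
  toℕ (fromℕ< j<n)  ≡⟨ FinP.toℕ-fromℕ< j<n ⟩
  j                 ∎
  where
  open ≡-Reasoning
  value : ∀ {i} (p : i < _) → permℕ γ (suc i) ≡ suc (toℕ (γ ⟨$⟩ʳ fromℕ< p))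
  value p = trans (cong (λ k → permℕ γ (suc k)) (sym (FinP.toℕ-fromℕ< p))) (permℕ-toℕ γ (fromℕ< p))

-- Index k of `peaks` is position k + 2 counted from 1. `Peak` asks for an ascent where `peaks` asks
-- for a non-descent; these agree because γ takes distinct values.
peaks-descents : ∀ {n} (γ : Permutation′ n) k → peaks (descents γ (allFin n)) k ≡ Peak γ (suc (suc k))
peaks-descents {n} γ k =
  trans (cong₂ (λ x y → x ∧ not y) (descents-allFin γ (suc k)) (descents-allFin γ k)) (inner (permℕ γ) distinct)
  where
  distinct : suc (suc k) < n → permℕ γ (suc k) ≢ permℕ γ (suc (suc k))
  distinct l e = ℕP.1+n≢n (sym (permℕ-injective γ (ℕP.<-trans (ℕP.n<1+n k) l′) l′ e))
    where l′ = ℕP.<-trans (ℕP.n<1+n (suc k)) l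
  inner : (p : ℕ → ℕ) → (suc (suc k) < n → p (suc k) ≢ p (suc (suc k))) →
    ((suc (suc k) <ᵇ n) ∧ (p (suc (suc (suc k))) <ᵇ p (suc (suc k)))) ∧ not ((suc k <ᵇ n) ∧ (p (suc (suc k)) <ᵇ p (suc k)))
      ≡ (suc (suc k) <ᵇ n) ∧ (p (suc k) <ᵇ p (suc (suc k))) ∧ (p (suc (suc (suc k))) <ᵇ p (suc (suc k)))
  inner p d with ℕP.<-≤-connex (suc (suc k)) n
  ... | inj₂ ge rewrite <ᵇ-false ge = refl
  ... | inj₁ l rewrite <ᵇ-true l | <ᵇ-true (ℕP.<-trans (ℕP.n<1+n (suc k)) l) | <ᵇ-flip (d l) =
    ∧-comm (p (suc (suc (suc k))) <ᵇ p (suc (suc k))) _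

F-value : PeakChoice → Pair → List ℕ → ℕ → ℚ
F-value g α w zero    = ΘK g α w
F-value g α w (suc N) = T (suc N) (F α) w

K-degree : ∀ {n} (P : FinPoset n) γ σ w → length w ≢ n → K P γ σ w ≡ 0ℚ
K-degree P γ σ w l rewrite ≡ᵇ-false l = refl

-- Interpolation produces at 0 the enriched count with strictness pattern A. Validity of `g` says
-- that the descents of `g α` have the same peaks as A, and by `total-K-peaks` the count sees
-- nothing else.
F-value-Poly : ∀ g → ValidPeakChoice g → ∀ α → IsStandard α → ∀ w → Poly (F-value g α w)
F-value-Poly g valid α@(pair n A σ) standard w = Poly-cong eq (chainSeries-Poly (A ∘ suc) (image-↭ σ) w)
  where
  eq : ∀ N → chainSeries-value n (A ∘ suc) (image σ) w N ≡ F-value g α w N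
  eq (suc N) = T-cong (suc N) w λ x → sym (F-chainSeries n A σ x)
  eq zero with length w ℕ.≟ n
  ... | no l = trans (cong (if_then TK.total (A ∘ suc) (map (letter w) (image σ)) else 0ℚ) (≡ᵇ-false l))
                     (sym (K-degree (chain n) (g α) σ w l))
  ... | yes l = trans (cong (if_then TK.total (A ∘ suc) (map (letter w) (image σ)) else 0ℚ) (≡ᵇ-true l)) (begin
    TK.total (A ∘ suc) (map (letter w) (image σ))
      ≡⟨ total-K-peaks (map (letter w) (image σ)) (λ k → sym (trans (peaks-descents (g α) k) (valid α standard (suc (suc k))))) ⟩
    TK.total (descents (g α) (allFin n)) (map (letter w) (image σ))
      ≡⟨ K-chain (g α) σ w l ⟨
    K (chain n) (g α) σ w ∎)
    where open ≡-Reasoning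

Θ-value : PeakChoice → Comb → List ℕ → ℕ → ℚ
Θ-value g c w n = ∑ c λ t → proj₁ t * F-value g (proj₂ t) w n

Θ-value-suc : ∀ g c w N → Θ-value g c w (suc N) ≡ T (suc N) (evalF c) w
Θ-value-suc g c w N = sym (T-linear (suc N) c proj₁ (λ t → F (proj₂ t)) w)

module _ (g : PeakChoice) (valid : ValidPeakChoice g) where

  Θ-value-Poly : ∀ {c} → StdComb c → ∀ w → Poly (Θ-value g c w)
  Θ-value-Poly std w = Poly-∑ std λ t standard → Poly-* (Poly-const (proj₁ t)) (F-value-Poly g valid (proj₂ t) standard w)

-- Products and coproducts

T-+ : ∀ n k (f h : Series) w → T n (λ x → k * f x + h x) w ≡ k * T n f w + T n h w
T-+ n k f h w = begin
  T n (λ x → k * f x + h x) w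
    ≡⟨ T-cong n w (λ x → cong (k * f x +_) (sym (trans (+-identityʳ _) (*-identityˡ (h x))))) ⟩
  T n (λ x → ∑ ((k , f) ∷ (1ℚ , h) ∷ []) (λ i → proj₁ i * proj₂ i x)) w
    ≡⟨ T-linear n ((k , f) ∷ (1ℚ , h) ∷ []) proj₁ proj₂ w ⟩
  k * T n f w + (1ℚ * T n h w + 0ℚ)
    ≡⟨ cong (k * T n f w +_) (trans (+-identityʳ _) (*-identityˡ (T n h w))) ⟩
  k * T n f w + T n h w ∎
  where open ≡-Reasoning

⋆-∷ : ∀ f g m w → (f ⋆ g) (m ∷ w) ≡ f [] * g (m ∷ w) + ((f ∘ (m ∷_)) ⋆ g) w
⋆-∷ f g m w = cong (f [] * g (m ∷ w) +_) (trans
  (cong (λ l → ∑ l (λ k → f (take k (m ∷ w)) * g (drop k (m ∷ w)))) (sym (map-upTo suc (suc (length w)))))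
  (∑-map suc (upTo (suc (length w))) (λ k → f (take k (m ∷ w)) * g (drop k (m ∷ w)))))

⋆-linearˡ : ∀ {X : Set} (xs : List X) (c : X → ℚ) (f : X → Series) g w →
  ((λ x → ∑ xs (λ i → c i * f i x)) ⋆ g) w ≡ ∑ xs (λ i → c i * (f i ⋆ g) w)
⋆-linearˡ xs c f g w = begin
  ∑ ks (λ k → ∑ xs (λ i → c i * f i (take k w)) * g (drop k w))
    ≡⟨ ∑-cong ks (λ k → trans (sym (∑-*ʳ xs (g (drop k w)) _)) (∑-cong xs λ i → *-assoc (c i) (f i (take k w)) (g (drop k w)))) ⟩
  ∑ ks (λ k → ∑ xs (λ i → c i * (f i (take k w) * g (drop k w))))
    ≡⟨ ∑-swap ks xs _ ⟩
  ∑ xs (λ i → ∑ ks (λ k → c i * (f i (take k w) * g (drop k w))))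
    ≡⟨ ∑-cong xs (λ i → ∑-*ˡ ks (c i) _) ⟩
  ∑ xs (λ i → c i * (f i ⋆ g) w) ∎
  where
  open ≡-Reasoning
  ks = upTo (suc (length w))

-- The substitution acts letter by letter and so commutes with cutting a word in two. The induction
-- peels off the first letter, with `⋆-∷` separating the cut in front of it from all the others.
T-⋆ : ∀ n f g w → T n (f ⋆ g) w ≡ (T n f ⋆ T n g) w
T-⋆ n f g []      = refl
T-⋆ n f g (m ∷ w) = begin
  ∑ (allFin n) (λ t → wt (toℕ t) * T n (λ x → (f ⋆ g) (enc m t ∷ x)) w)
    ≡⟨ ∑-cong (allFin n) (λ t → cong (wt (toℕ t) *_) (trans (T-cong n w (⋆-∷ f g (enc m t)))
         (trans (T-+ n (f []) (λ x → g (enc m t ∷ x)) (f′ t ⋆ g) w) (cong (f [] * g′ t +_) (T-⋆ n (f′ t) g w))))) ⟩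
  ∑ (allFin n) (λ t → wt (toℕ t) * (f [] * g′ t + (T n (f′ t) ⋆ T n g) w))
    ≡⟨ ∑-cong (allFin n) (λ t → trans (*-distribˡ-+ (wt (toℕ t)) (f [] * g′ t) _)
         (cong (_+ wt (toℕ t) * (T n (f′ t) ⋆ T n g) w) (*-left-comm (wt (toℕ t)) (f []) (g′ t)))) ⟩
  ∑ (allFin n) (λ t → f [] * (wt (toℕ t) * g′ t) + wt (toℕ t) * (T n (f′ t) ⋆ T n g) w)
    ≡⟨ ∑-+ (allFin n) _ _ ⟩
  ∑ (allFin n) (λ t → f [] * (wt (toℕ t) * g′ t)) + ∑ (allFin n) (λ t → wt (toℕ t) * (T n (f′ t) ⋆ T n g) w)
    ≡⟨ cong₂ _+_ (∑-*ˡ (allFin n) (f []) _) (sym (⋆-linearˡ (allFin n) (wt ∘ toℕ) (λ t → T n (f′ t)) (T n g) w)) ⟩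
  f [] * T n g (m ∷ w) + ((T n f ∘ (m ∷_)) ⋆ T n g) w
    ≡⟨ ⋆-∷ (T n f) (T n g) m w ⟨
  (T n f ⋆ T n g) (m ∷ w) ∎
  where
  open ≡-Reasoning
  f′ = λ t x → f (enc m t ∷ x)
  g′ = λ t → T n (λ x → g (enc m t ∷ x)) w

T₂ : ℕ → Series₂ → Series₂
T₂ n f u v = T n (λ x → T n (f x) v) u

T₂-linear : ∀ {X : Set} n (xs : List X) (c : X → ℚ) (f : X → Series₂) u v →
  T₂ n (λ x y → ∑ xs (λ i → c i * f i x y)) u v ≡ ∑ xs (λ i → c i * T₂ n (f i) u v)
T₂-linear n xs c f u v = trans
  (T-cong n u λ x → T-linear n xs c (λ i → f i x) v)
  (T-linear n xs c (λ i x → T n (f i x) v) u)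

T₂-+ : ∀ n (f h : Series₂) u v → T₂ n (λ x y → 1ℚ * f x y + h x y) u v ≡ 1ℚ * T₂ n f u v + T₂ n h u v
T₂-+ n f h u v = trans (T-cong n u λ x → T-+ n 1ℚ (f x) (h x) v) (T-+ n 1ℚ (λ x → T n (f x) v) (λ x → T n (h x) v) u)

-- The coproduct before the second word is shifted. In this form it commutes with T n letter by
-- letter, and the shift can be treated on its own.
∑-shuffles : Series → Series₂
∑-shuffles f u v = ∑ (shuffles u v) f

shuffles-[]ʳ : ∀ u → shuffles u [] ≡ u ∷ []
shuffles-[]ʳ []      = refl
shuffles-[]ʳ (_ ∷ _) = refl

private
  first-left first-right : Series → Series₂
  first-left f []      y = 0ℚ
  first-left f (e ∷ x) y = ∑-shuffles (f ∘ (e ∷_)) x y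
  first-right f x []      = 0ℚ
  first-right f x (e ∷ y) = ∑-shuffles (f ∘ (e ∷_)) x y

  ∑-shuffles-∷ : ∀ f a u b v → ∑-shuffles f (a ∷ u) (b ∷ v)
    ≡ first-left f (a ∷ u) (b ∷ v) + first-right f (a ∷ u) (b ∷ v)
  ∑-shuffles-∷ f a u b v = trans (∑-++ (map (a ∷_) (shuffles u (b ∷ v))) _ f)
    (cong₂ _+_ (∑-map (a ∷_) (shuffles u (b ∷ v)) f) (∑-map (b ∷_) (shuffles (a ∷ u) v) f))

  nonempty-shuffles : ∀ f x y {m k} → length x ≡ suc m → length y ≡ suc k →
    ∑-shuffles f x y ≡ 1ℚ * first-left f x y + first-right f x y
  nonempty-shuffles f (a ∷ x) (b ∷ y) _ _ =
    trans (∑-shuffles-∷ f a x b y) (cong (_+ ∑-shuffles (f ∘ (b ∷_)) (a ∷ x) y)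
    (sym (*-identityˡ (∑-shuffles (f ∘ (a ∷_)) x (b ∷ y)))))

∑-shuffles-T : ∀ n f u v → ∑-shuffles (T n f) u v ≡ T₂ n (∑-shuffles f) u v
∑-shuffles-T n f []      v  = trans (+-identityʳ (T n f v)) (T-cong n v λ y → sym (+-identityʳ (f y)))
∑-shuffles-T n f u@(_ ∷ _) [] = trans (+-identityʳ (T n f u))
  (T-cong n u λ x → trans (sym (+-identityʳ (f x))) (cong (λ l → ∑ l f) (sym (shuffles-[]ʳ x))))
∑-shuffles-T n f (a ∷ u) (b ∷ v) = begin
  ∑-shuffles (T n f) (a ∷ u) (b ∷ v)
    ≡⟨ ∑-shuffles-∷ (T n f) a u b v ⟩
  ∑ (shuffles u (b ∷ v)) (λ x → T n f (a ∷ x)) + ∑ (shuffles (a ∷ u) v) (λ x → T n f (b ∷ x))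
    ≡⟨ cong₂ _+_ (pull a u (b ∷ v)) (pull b (a ∷ u) v) ⟩
  ∑ (allFin n) (λ t → wt (toℕ t) * T₂ n (∑-shuffles (f ∘ (enc a t ∷_))) u (b ∷ v))
    + ∑ (allFin n) (λ t → wt (toℕ t) * T₂ n (∑-shuffles (f ∘ (enc b t ∷_))) (a ∷ u) v)
    ≡⟨ cong₂ _+_ (sym (*-identityˡ (T₂ n (first-left f) (a ∷ u) (b ∷ v))))
         (sym (T-linear n (allFin n) (wt ∘ toℕ) (λ t x → T n (∑-shuffles (f ∘ (enc b t ∷_)) x) v) (a ∷ u))) ⟩
  1ℚ * T₂ n (first-left f) (a ∷ u) (b ∷ v) + T₂ n (first-right f) (a ∷ u) (b ∷ v)
    ≡⟨ T₂-+ n (first-left f) (first-right f) (a ∷ u) (b ∷ v) ⟨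
  T₂ n (λ x y → 1ℚ * first-left f x y + first-right f x y) (a ∷ u) (b ∷ v)
    -- T n evaluates its argument only at words of the given length, so the split by the first
    -- letter may be used although it is established for nonempty words.
    ≡⟨ T-cong-length n (a ∷ u) (λ x l → T-cong-length n (b ∷ v) λ y l′ → nonempty-shuffles f x y l l′) ⟨
  T₂ n (∑-shuffles f) (a ∷ u) (b ∷ v) ∎
  where
  open ≡-Reasoning
  pull : ∀ m x y → ∑ (shuffles x y) (λ z → T n f (m ∷ z))
    ≡ ∑ (allFin n) (λ t → wt (toℕ t) * T₂ n (∑-shuffles (f ∘ (enc m t ∷_))) x y)
  pull m x y = trans (∑-swap (shuffles x y) (allFin n) _)
    (∑-cong (allFin n) λ t → trans (∑-*ˡ (shuffles x y) (wt (toℕ t)) (T n (f ∘ (enc m t ∷_))))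
       (cong (wt (toℕ t) *_) (∑-shuffles-T n (f ∘ (enc m t ∷_)) x y)))

T-cong-letters : ∀ n {P : ℕ → Set} {f g : Series} {w} → All (λ m → ∀ (t : Fin n) → P (enc m t)) w →
  (∀ x → All P x → f x ≡ g x) → T n f w ≡ T n g w
T-cong-letters n []       e = e [] []
T-cong-letters n (p ∷ ps) e =
  ∑-cong (allFin n) λ t → cong (wt (toℕ t) *_) (T-cong-letters n ps λ x q → e _ (p t ∷ q))

enc-shift : ∀ {n} m c (t : Fin n) → enc (m ℕ.+ c) t ≡ enc m t ℕ.+ c ℕ.* n
enc-shift {n} m c t = trans (cong ((n ∸ suc (toℕ t)) ℕ.+_) (ℕP.*-distribʳ-+ n m c)) (sym (ℕP.+-assoc (n ∸ suc (toℕ t)) (m ℕ.* n) (c ℕ.* n)))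

-- The c windows skipped by the shift hold c * n letters.
T-shift : ∀ n c f v → T n f (map (ℕ._+ c) v) ≡ T n (f ∘ map (ℕ._+ c ℕ.* n)) v
T-shift n c f []      = refl
T-shift n c f (m ∷ v) = ∑-cong (allFin n) λ t → cong (wt (toℕ t) *_) (trans
  (T-shift n c (λ x → f (enc (m ℕ.+ c) t ∷ x)) v)
  (T-cong n v λ x → cong (λ e → f (e ∷ map (ℕ._+ c ℕ.* n) x)) (enc-shift m c t)))

-- Invariance under order-preserving relabelling

OrderPreserving : (ℕ → ℕ → Set) → Set
OrderPreserving R = ∀ {a b a′ b′} → R a b → R a′ b′ → (a <ᵇ a′) ≡ (b <ᵇ b′)

-- The coefficients of an element of NCQSym depend only on the relative
-- order of the letters.
QSym : Series → Set₁
QSym f = ∀ {R} → OrderPreserving R → ∀ {w w′} → Pointwise R w w′ → f w ≡ f w′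

-- Relabellings of the two alphabets glue to one of the merged alphabet as long as `c` and `c′`
-- exceed all low letters. Relations, unlike functions, only have to speak of the letters that
-- occur.
data Merged (R S : ℕ → ℕ → Set) (c c′ : ℕ) : ℕ → ℕ → Set where
  low  : ∀ {a b} → R a b → a < c → b < c′ → Merged R S c c′ a b
  high : ∀ {a b} → S a b → Merged R S c c′ (a ℕ.+ c) (b ℕ.+ c′)

<ᵇ-+ : ∀ a b c → (a ℕ.+ c <ᵇ b ℕ.+ c) ≡ (a <ᵇ b)
<ᵇ-+ a b c with ℕP.<-≤-connex a b
... | inj₁ l = trans (<ᵇ-true (ℕP.+-monoˡ-< c l)) (sym (<ᵇ-true l))
... | inj₂ l = trans (<ᵇ-false (ℕP.+-monoˡ-≤ c l)) (sym (<ᵇ-false l))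

Merged-OrderPreserving : ∀ {R S c c′} → OrderPreserving R → OrderPreserving S → OrderPreserving (Merged R S c c′)
Merged-OrderPreserving {c = c} {c′} oR oS (low r _ _)  (low r′ _ _) = oR r r′
Merged-OrderPreserving {c = c} {c′} oR oS (low {a} {b} _ l l′) (high {a′} {b′} _) =
  trans (<ᵇ-true (ℕP.<-≤-trans l (ℕP.m≤n+m c a′))) (sym (<ᵇ-true (ℕP.<-≤-trans l′ (ℕP.m≤n+m c′ b′))))
Merged-OrderPreserving {c = c} {c′} oR oS (high {a} {b} _) (low {a′} {b′} _ l l′) =
  trans (<ᵇ-false (ℕP.<⇒≤ (ℕP.<-≤-trans l (ℕP.m≤n+m c a)))) (sym (<ᵇ-false (ℕP.<⇒≤ (ℕP.<-≤-trans l′ (ℕP.m≤n+m c′ b)))))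
Merged-OrderPreserving {c = c} {c′} oR oS (high {a} {b} s) (high {a′} {b′} s′) =
  trans (<ᵇ-+ a a′ c) (trans (oS s s′) (sym (<ᵇ-+ b b′ c′)))

shuffles-Pointwise : ∀ {R : ℕ → ℕ → Set} {u u′ v v′} → Pointwise R u u′ → Pointwise R v v′ →
  Pointwise (Pointwise R) (shuffles u v) (shuffles u′ v′)
shuffles-Pointwise []       q        = q ∷ []
shuffles-Pointwise (r ∷ p)  []       = (r ∷ p) ∷ []
shuffles-Pointwise (r ∷ p)  (s ∷ q)  = Pointwise.++⁺
  (Pointwise.map⁺ _ _ (Pointwise.map (r ∷_) (shuffles-Pointwise p (s ∷ q))))
  (Pointwise.map⁺ _ _ (Pointwise.map (s ∷_) (shuffles-Pointwise (r ∷ p) q)))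

∑-Pointwise : ∀ {R : List ℕ → List ℕ → Set} {f} → (∀ {x y} → R x y → f x ≡ f y) →
  ∀ {xs ys} → Pointwise R xs ys → ∑ xs f ≡ ∑ ys f
∑-Pointwise e []      = refl
∑-Pointwise e (r ∷ p) = cong₂ _+_ (e r) (∑-Pointwise e p)

Merged-low : ∀ {R S c c′ u u′} → Pointwise R u u′ → All (_< c) u → All (_< c′) u′ → Pointwise (Merged R S c c′) u u′
Merged-low []      []      []        = []
Merged-low (r ∷ p) (l ∷ a) (l′ ∷ a′) = low r l l′ ∷ Merged-low p a a′

∑-shuffles-QSym : ∀ {f} → QSym f → ∀ {R S} → OrderPreserving R → OrderPreserving S →
  ∀ {u u′ v v′} → Pointwise R u u′ → Pointwise S v v′ →
  ∀ {c c′} → All (_< c) u → All (_< c′) u′ → ∑-shuffles f u (map (ℕ._+ c) v) ≡ ∑-shuffles f u′ (map (ℕ._+ c′) v′)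
∑-shuffles-QSym q oR oS p r a a′ = ∑-Pointwise (q (Merged-OrderPreserving oR oS))
  (shuffles-Pointwise (Merged-low p a a′) (Pointwise.map⁺ _ _ (Pointwise.map high r)))

maxL-bound : ∀ u → All (_< suc (maxL u)) u
maxL-bound []      = []
maxL-bound (x ∷ u) = s≤s (ℕP.m≤m⊔n x (maxL u)) ∷ All.map (λ l → ℕP.≤-trans l (s≤s (ℕP.m≤n⊔m x (maxL u)))) (maxL-bound u)

≡-OrderPreserving : OrderPreserving _≡_
≡-OrderPreserving refl refl = refl

Δ-QSym : ∀ {f} → QSym f → ∀ {R S} → OrderPreserving R → OrderPreserving S →
  ∀ {u u′ v v′} → Pointwise R u u′ → Pointwise S v v′ → Δ f u v ≡ Δ f u′ v′
Δ-QSym q oR oS {u} {u′} p r = ∑-shuffles-QSym q oR oS p r (maxL-bound u) (maxL-bound u′)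

-- After the substitution the second word is shifted by c * n, whereas `Δ` would shift it by one
-- more than the maximum of the new first word. Both shifts exceed every letter of that word, and a
-- quasisymmetric f cannot tell them apart.
Δ-T : ∀ n {f} → QSym f → ∀ u v → Δ (T n f) u v ≡ T₂ n (Δ f) u v
Δ-T n {f} q u v = begin
  ∑-shuffles (T n f) u (map (ℕ._+ c) v)
    ≡⟨ ∑-shuffles-T n f u (map (ℕ._+ c) v) ⟩
  T n (λ x → T n (∑-shuffles f x) (map (ℕ._+ c) v)) u
    ≡⟨ T-cong n u (λ x → T-shift n c (∑-shuffles f x) v) ⟩
  T n (λ x → T n (λ y → ∑-shuffles f x (map (ℕ._+ c ℕ.* n) y)) v) u
    ≡⟨ T-cong-letters n (All.map (λ {m} l t → ℕP.<-≤-trans (enc-lower m t) (ℕP.*-monoˡ-≤ n l)) (maxL-bound u))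
         (λ x a → T-cong n v λ y → ∑-shuffles-QSym q {R = _≡_} {S = _≡_} ≡-OrderPreserving ≡-OrderPreserving
            (Pointwise.refl refl) (Pointwise.refl refl) a (maxL-bound x)) ⟩
  T n (λ x → T n (Δ f x) v) u ∎
  where
  open ≡-Reasoning
  c = suc (maxL u)

letter-Pointwise : ∀ {R : ℕ → ℕ → Set} {w w′} → Pointwise R w w′ → ∀ (p : Fin (length w)) → R (letter w p) (letter w′ p)
letter-Pointwise (r ∷ _) zero    = r
letter-Pointwise (_ ∷ q) (suc p) = letter-Pointwise q p

≤ᵇ-not-<ᵇ : ∀ m n → (m ≤ᵇ n) ≡ not (n <ᵇ m)
≤ᵇ-not-<ᵇ m n with ℕP.<-≤-connex n m
... | inj₁ l = trans (≤ᵇ-<ᵇ-suc m n) (trans (<ᵇ-false l) (cong not (sym (<ᵇ-true l))))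
... | inj₂ l = trans (≤ᵇ-<ᵇ-suc m n) (trans (<ᵇ-true (s≤s l)) (cong not (sym (<ᵇ-false l))))

st-cong : ∀ d x y x′ y′ → (x <ᵇ y) ≡ (x′ <ᵇ y′) → (y <ᵇ x) ≡ (y′ <ᵇ x′) → st d x y ≡ st d x′ y′
st-cong d x y x′ y′ e e′ rewrite ≤ᵇ-not-<ᵇ x y | ≤ᵇ-not-<ᵇ x′ y′ | e | e′ = refl

chainSeries-QSym : ∀ n b π → QSym (chainSeries n b π)
chainSeries-QSym n b π o {w} {w′} p with length w ℕ.≟ n
... | no l = trans (chainSeries-degree b π w l) (sym (chainSeries-degree b π w′ (l ∘ trans (Pointwise-length p))))
... | yes refl rewrite sym (Pointwise-length p) = cong (λ x → if length w ≡ᵇ length w then ⟦ x ⟧ else 0ℚ) (begin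
  link st b (map (letter w) π)
    ≡⟨ link-map (letter w) st b π ⟩
  link (λ d i j → st d (letter w i) (letter w j)) b π
    ≡⟨ link-cong (λ d i j → st-cong d (letter w i) (letter w j) (letter w′ i) (letter w′ j) (o (at i) (at j)) (o (at j) (at i))) b π ⟩
  link (λ d i j → st d (letter w′ i) (letter w′ j)) b π
    ≡⟨ link-map (letter w′) st b π ⟨
  link st b (map (letter w′) π) ∎)
  where
  open ≡-Reasoning
  at = letter-Pointwise p

QSym-cong : ∀ {f g} → f ≈ g → QSym f → QSym g
QSym-cong e q o p = trans (sym (e _)) (trans (q o p) (e _))

F-QSym : ∀ α → QSym (F α)
F-QSym α@(pair n A σ) = QSym-cong (λ w → sym (F-chainSeries n A σ w)) (chainSeries-QSym n (A ∘ suc) (image σ))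

∑-QSym : ∀ {X : Set} (xs : List X) (c : X → ℚ) (f : X → Series) → (∀ i → QSym (f i)) → QSym (λ w → ∑ xs (λ i → c i * f i w))
∑-QSym xs c f q o p = ∑-cong xs λ i → cong (c i *_) (q i o p)

evalF-QSym : ∀ c → QSym (evalF c)
evalF-QSym c = ∑-QSym c proj₁ (λ t → F (proj₂ t)) (λ t → F-QSym (proj₂ t))

take-Pointwise : ∀ {R : ℕ → ℕ → Set} k {w w′} → Pointwise R w w′ → Pointwise R (take k w) (take k w′)
take-Pointwise zero    p       = []
take-Pointwise (suc k) []      = []
take-Pointwise (suc k) (r ∷ p) = r ∷ take-Pointwise k p

drop-Pointwise : ∀ {R : ℕ → ℕ → Set} k {w w′} → Pointwise R w w′ → Pointwise R (drop k w) (drop k w′)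
drop-Pointwise zero    p       = p
drop-Pointwise (suc k) []      = []
drop-Pointwise (suc k) (r ∷ p) = drop-Pointwise k p

⋆-QSym : ∀ {f g} → QSym f → QSym g → QSym (f ⋆ g)
⋆-QSym {f} {g} qf qg o {w} {w′} p = trans
  (∑-cong (upTo (suc (length w))) λ k → cong₂ _*_ (qf o (take-Pointwise k p)) (qg o (drop-Pointwise k p)))
  (cong (λ l → ∑ (upTo (suc l)) (λ k → f (take k w′) * g (drop k w′))) (Pointwise-length p))

-- Expansion in the standard basis

tabulate-lookup-cast : ∀ {X : Set} (l : List X) {n} (e : n ≡ length l) → tabulate (λ i → lookup l (cast e i)) ≡ l
tabulate-lookup-cast l refl = trans (tabulate-cong λ i → cong (lookup l) (FinP.cast-is-id refl i)) (tabulate-lookup l)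

lookup-allFin : ∀ n (e : length (allFin n) ≡ n) i → lookup (allFin n) i ≡ cast e i
lookup-allFin n e i = begin
  lookup (allFin n) i                               ≡⟨ cong (lookup (allFin n)) (FinP.cast-involutive (sym e′) e′ i) ⟨
  lookup (allFin n) (cast (sym e′) (cast e′ i))     ≡⟨ lookup-tabulate id (cast e′ i) ⟩
  cast e′ i                                         ∎
  where
  open ≡-Reasoning
  e′ = length-tabulate {n = n} id

listPermutation : ∀ {n} {π : List (Fin n)} → π ↭ allFin n → Σ (Permutation′ n) λ σ → image σ ≡ π
listPermutation {n} {π} p = τ , (begin
  map (τ ⟨$⟩ʳ_) (allFin n)                          ≡⟨ map-tabulate id (τ ⟨$⟩ʳ_) ⟩
  tabulate (τ ⟨$⟩ʳ_)                                ≡⟨ tabulate-cong τ-lookup ⟩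
  tabulate (λ i → lookup π (cast (sym len) i))      ≡⟨ tabulate-lookup-cast π (sym len) ⟩
  π ∎)
  where
  open ≡-Reasoning
  e = length-tabulate {n = n} id
  len : length π ≡ n
  len = trans (↭-length p) e
  τ : Permutation′ n
  τ = cast-id (sym len) ∘ₚ onIndices (↭⇒↭ₛ p) ∘ₚ cast-id e
  τ-lookup : ∀ i → τ ⟨$⟩ʳ i ≡ lookup π (cast (sym len) i)
  τ-lookup i = sym (trans (onIndices-lookup (setoid _) (↭⇒↭ₛ p) (cast (sym len) i)) (lookup-allFin n e _))

permutations : ∀ n → List (Permutation′ n)
permutations n = All.reduce (λ p → proj₁ (listPermutation p)) (perms-↭ (allFin n))

∑-permutations : ∀ n (h : List (Fin n) → ℚ) → ∑ (permutations n) (h ∘ image) ≡ ∑ (perms (allFin n)) h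
∑-permutations n h = go (perms-↭ (allFin n))
  where
  go : ∀ {l} (a : All (_↭ allFin n) l) → ∑ (All.reduce (λ p → proj₁ (listPermutation p)) a) (h ∘ image) ≡ ∑ l h
  go []      = refl
  go (p ∷ a) = cong₂ _+_ (cong h (proj₂ (listPermutation p))) (go a)

st-lex : ∀ d x y → st d x y ≡ lex x y (not d)
st-lex d x y with ℕP.<-cmp x y
... | tri< l _ _ = trans (st-< d l) (sym (lex-< (not d) l))
... | tri≈ _ e _ = trans (st-≡ d e) (sym (lex-≡ (not d) e))
... | tri> _ _ l = trans (st-> d l) (sym (lex-> (not d) l))

-- A word has exactly one standardisation: its positions sorted by letter, ties broken from left to
-- right. Strictness at the descents of σ says precisely that `image σ` is this ordering.
∑-standardisations : ∀ n w → ∑ (permutations n) (λ σ → ⟦ link st (descents σ (allFin n)) (map (letter w) (image σ)) ⟧) ≡ 1ℚ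
∑-standardisations n w = begin
  ∑ (permutations n) (λ σ → ⟦ link st (descents σ (allFin n)) (map (letter w) (image σ)) ⟧)
    ≡⟨ ∑-cong (permutations n) (λ σ → cong ⟦_⟧ (eq σ)) ⟩
  ∑ (permutations n) (λ σ → ⟦ linked ρ (image σ) ⟧)
    ≡⟨ ∑-permutations n (λ π → ⟦ linked ρ π ⟧) ⟩
  ∑ (perms (allFin n)) (λ π → ⟦ linked ρ π ⟧)
    ≡⟨ Sorting.∑-perms (lex-StrictTotal (letter w) (above-StrictTotal toℕ FinP.toℕ-injective)) (allFin⁺ n) ⟩
  1ℚ ∎
  where
  open ≡-Reasoning
  ρ : Fin n → Fin n → Bool
  ρ p q = lex (letter w p) (letter w q) (not (toℕ q <ᵇ toℕ p))
  eq : ∀ σ → link st (descents σ (allFin n)) (map (letter w) (image σ)) ≡ linked ρ (image σ)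
  eq σ = begin
    link st (descents σ (allFin n)) (map (letter w) (map (σ ⟨$⟩ʳ_) (allFin n)))
      ≡⟨ link-map (letter w) st (descents σ (allFin n)) (image σ) ⟩
    link (λ d p q → st d (letter w p) (letter w q)) (descents σ (allFin n)) (map (σ ⟨$⟩ʳ_) (allFin n))
      ≡⟨ link-map (σ ⟨$⟩ʳ_) _ (descents σ (allFin n)) (allFin n) ⟩
    link (λ d p q → st d (letter w (σ ⟨$⟩ʳ p)) (letter w (σ ⟨$⟩ʳ q))) (descents σ (allFin n)) (allFin n)
      ≡⟨ link-cong (λ d p q → st-lex d (letter w (σ ⟨$⟩ʳ p)) (letter w (σ ⟨$⟩ʳ q))) (descents σ (allFin n)) (allFin n) ⟩
    link (λ d p q → lex (letter w (σ ⟨$⟩ʳ p)) (letter w (σ ⟨$⟩ʳ q)) (not d)) (descents σ (allFin n)) (allFin n)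
      ≡⟨ link-desc _ (λ a b → toℕ (σ ⟨$⟩ʳ b) <ᵇ toℕ (σ ⟨$⟩ʳ a)) (allFin n) ⟩
    linked (λ p q → ρ (σ ⟨$⟩ʳ p) (σ ⟨$⟩ʳ q)) (allFin n)
      ≡⟨ link-map (σ ⟨$⟩ʳ_) (λ _ → ρ) (λ _ → false) (allFin n) ⟨
    linked ρ (map (σ ⟨$⟩ʳ_) (allFin n)) ∎

-- Inclusion-exclusion over strictness patterns

bit : List Bool → ℕ → Bool
bit []      k       = false
bit (b ∷ A) zero    = b
bit (b ∷ A) (suc k) = bit A k

ascents : List ℕ → List Bool
ascents []          = []
ascents (x ∷ [])    = []
ascents (x ∷ y ∷ l) = (x <ᵇ y) ∷ ascents (y ∷ l)

Term : Set
Term = List Bool × ℚ × List Bool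

both-strict neither cancel : Term → Term
both-strict (S , c , A) = true ∷ S , c , true ∷ A
neither     (S , c , A) = false ∷ S , c , false ∷ A
cancel      (S , c , A) = false ∷ S , -1ℚ * c , true ∷ A

-- M_(S,σ) = ∑ (-1)^|A∖S| F_(A,σ) over A ⊇ S, expanded for all S ⊇ D at once
-- as a list of triples (S , sign , A).
terms : (ℕ → Bool) → ℕ → List Term
terms D zero    = ([] , 1ℚ , []) ∷ []
terms D (suc k) =
  map both-strict (terms (D ∘ suc) k)
    ++ (if D 0 then [] else map neither (terms (D ∘ suc) k) ++ map cancel (terms (D ∘ suc) k))

term-value : (List Bool → ℚ) → List ℕ → Term → ℚ
term-value h v t = h (proj₁ t) * (proj₁ (proj₂ t) * ⟦ link st (bit (proj₂ (proj₂ t))) v ⟧)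

-- The function h is arbitrary so that the induction can absorb the first bit of S into it. At the
-- first step, S containing it contributes [x < y] and S avoiding it contributes [x ≤ y] - [x < y] =
-- [x = y]; only the bit that records the actual ascent survives.
∑-terms-step : ∀ x y l D →
 (∀ h → ∑ (terms (D ∘ suc) (length l)) (term-value h (y ∷ l)) ≡ h (ascents (y ∷ l)) * ⟦ link st (D ∘ suc) (y ∷ l) ⟧) →
 ∀ h → ∑ (terms D (suc (length l))) (term-value h (x ∷ y ∷ l)) ≡ h (ascents (x ∷ y ∷ l)) * ⟦ link st D (x ∷ y ∷ l) ⟧
∑-terms-step x y l D IH h = trans (∑-++ (map both-strict ts) _ val) (finish (D 0) refl)
  where
  open ≡-Reasoning
  v′ = y ∷ l
  ts = terms (D ∘ suc) (length l)
  val = term-value h (x ∷ y ∷ l)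
  L = ⟦ link st (D ∘ suc) v′ ⟧
  I : Bool → ℚ
  I b = h (b ∷ ascents v′) * L
  move : ∀ a b c d e → a * ((b * c) * (d * e)) ≡ (b * d) * (a * (c * e))
  move = solve 5 (λ a b c d e → a :* ((b :* c) :* (d :* e)) := (b :* d) :* (a :* (c :* e))) refl
  part : ∀ (F : Term → Term) s k b →
    (∀ S c A → F (S , c , A) ≡ (s ∷ S , k * c , b ∷ A)) → ∑ (map F ts) val ≡ (k * ⟦ st b x y ⟧) * I s
  part F s k b e = begin
    ∑ (map F ts) val
      ≡⟨ ∑-map F ts val ⟩
    ∑ ts (λ t → val (F t))
      ≡⟨ ∑-cong ts (λ (S , c , A) → trans (cong val (e S c A)) (trans
           (cong (λ z → h (s ∷ S) * ((k * c) * z)) (⟦∧⟧ (st b x y) (link st (bit A) v′)))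
           (move (h (s ∷ S)) k c ⟦ st b x y ⟧ _))) ⟩
    ∑ ts (λ (S , c , A) → (k * ⟦ st b x y ⟧) * (h (s ∷ S) * (c * ⟦ link st (bit A) v′ ⟧)))
      ≡⟨ ∑-*ˡ ts (k * ⟦ st b x y ⟧) _ ⟩
    (k * ⟦ st b x y ⟧) * ∑ ts (λ (S , c , A) → h (s ∷ S) * (c * ⟦ link st (bit A) v′ ⟧))
      ≡⟨ cong ((k * ⟦ st b x y ⟧) *_) (IH (λ S → h (s ∷ S))) ⟩
    (k * ⟦ st b x y ⟧) * I s ∎
  part₁ : ∑ (map both-strict ts) val ≡ (1ℚ * ⟦ st true x y ⟧) * I true
  part₁ = part both-strict true 1ℚ true (λ S c A → cong (λ c → true ∷ S , c , true ∷ A) (sym (*-identityˡ c)))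
  part₂ : ∑ (map neither ts) val ≡ (1ℚ * ⟦ st false x y ⟧) * I false
  part₂ = part neither false 1ℚ false (λ S c A → cong (λ c → false ∷ S , c , false ∷ A) (sym (*-identityˡ c)))
  part₃ : ∑ (map cancel ts) val ≡ (-1ℚ * ⟦ st true x y ⟧) * I false
  part₃ = part cancel false -1ℚ true (λ S c A → refl)
  rhs : ∀ d → h ((x <ᵇ y) ∷ ascents v′) * ⟦ st d x y ∧ link st (D ∘ suc) v′ ⟧ ≡ ⟦ st d x y ⟧ * I (x <ᵇ y)
  rhs d = trans (cong (h ((x <ᵇ y) ∷ ascents v′) *_) (⟦∧⟧ (st d x y) (link st (D ∘ suc) v′)))
    (*-left-comm (h ((x <ᵇ y) ∷ ascents v′)) ⟦ st d x y ⟧ L)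
  strict : ∀ (J : Bool → ℚ) → (1ℚ * ⟦ st true x y ⟧) * J true + 0ℚ ≡ ⟦ st true x y ⟧ * J (x <ᵇ y)
  strict J with ℕP.<-cmp x y
  ... | tri< l _ _ rewrite st-< true l | <ᵇ-true l = solve 1 (λ j → (con 1ℚ :* con 1ℚ) :* j :+ con 0ℚ := con 1ℚ :* j) refl (J true)
  ... | tri≈ _ e _ rewrite st-≡ true e = solve 2 (λ j k → (con 1ℚ :* con 0ℚ) :* j :+ con 0ℚ := con 0ℚ :* k) refl (J true) (J (x <ᵇ y))
  ... | tri> _ _ l rewrite st-> true l = solve 2 (λ j k → (con 1ℚ :* con 0ℚ) :* j :+ con 0ℚ := con 0ℚ :* k) refl (J true) (J (x <ᵇ y))
  weak : ∀ (J : Bool → ℚ) → (1ℚ * ⟦ st true x y ⟧) * J true + ((1ℚ * ⟦ st false x y ⟧) * J false + (-1ℚ * ⟦ st true x y ⟧) * J false)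
    ≡ ⟦ st false x y ⟧ * J (x <ᵇ y)
  weak J with ℕP.<-cmp x y
  ... | tri< l _ _ rewrite st-< true l | st-< false l | <ᵇ-true l =
    solve 2 (λ j k → (con 1ℚ :* con 1ℚ) :* j :+ ((con 1ℚ :* con 1ℚ) :* k :+ (con -1ℚ :* con 1ℚ) :* k) := con 1ℚ :* j) refl (J true) (J false)
  ... | tri≈ _ e _ rewrite st-≡ true e | st-≡ false e | <ᵇ-false (ℕP.≤-reflexive (sym e)) =
    solve 2 (λ j k → (con 1ℚ :* con 0ℚ) :* j :+ ((con 1ℚ :* con 1ℚ) :* k :+ (con -1ℚ :* con 0ℚ) :* k) := con 1ℚ :* k) refl (J true) (J false)
  ... | tri> _ _ l rewrite st-> true l | st-> false l =
    solve 3 (λ j k m → (con 1ℚ :* con 0ℚ) :* j :+ ((con 1ℚ :* con 0ℚ) :* k :+ (con -1ℚ :* con 0ℚ) :* k) := con 0ℚ :* m) refl (J true) (J false) (J (x <ᵇ y))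
  finish : ∀ d → D 0 ≡ d → ∑ (map both-strict ts) val + ∑ (if D 0 then [] else map neither ts ++ map cancel ts) val
    ≡ h ((x <ᵇ y) ∷ ascents v′) * ⟦ st (D 0) x y ∧ link st (D ∘ suc) v′ ⟧
  finish true e rewrite e = trans (cong (_+ 0ℚ) part₁) (trans (strict I) (sym (rhs true)))
  finish false e rewrite e = trans (cong₂ _+_ part₁ (trans (∑-++ (map neither ts) (map cancel ts) val) (cong₂ _+_ part₂ part₃)))
    (trans (weak I) (sym (rhs false)))

∑-terms : ∀ v D (h : List Bool → ℚ) →
  ∑ (terms D (length v ∸ 1)) (term-value h v) ≡ h (ascents v) * ⟦ link st D v ⟧
∑-terms []       D h = solve 1 (λ x → x :* (con 1ℚ :* con 1ℚ) :+ con 0ℚ := x :* con 1ℚ) refl (h [])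
∑-terms (x ∷ []) D h = solve 1 (λ x → x :* (con 1ℚ :* con 1ℚ) :+ con 0ℚ := x :* con 1ℚ) refl (h [])
∑-terms (x ∷ y ∷ l) D h = ∑-terms-step x y l D (∑-terms (y ∷ l) (D ∘ suc)) h

Admissible : (ℕ → Bool) → ℕ → List Bool → Set
Admissible D k A = length A ≡ k × (∀ i → i < k → D i ≡ true → bit A i ≡ true)

terms-Admissible : ∀ D k → All (λ t → Admissible D k (proj₂ (proj₂ t))) (terms D k)
terms-Admissible D zero    = (refl , λ _ ()) ∷ []
terms-Admissible D (suc k) = AllP.++⁺ (AllP.map⁺ (All.map strict IH)) (rest (D 0) refl)
  where
  IH = terms-Admissible (D ∘ suc) k
  strict : ∀ {A} → Admissible (D ∘ suc) k A → Admissible D (suc k) (true ∷ A)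
  strict (l , a) = cong suc l , λ { zero _ _ → refl ; (suc i) (s≤s i<k) → a i i<k }
  weak : D 0 ≡ false → ∀ b {A} → Admissible (D ∘ suc) k A → Admissible D (suc k) (b ∷ A)
  weak e b (l , a) = cong suc l , λ { zero _ D0 → contradiction (trans (sym e) D0) false≢true ; (suc i) (s≤s i<k) → a i i<k }
  rest : ∀ d → D 0 ≡ d → All (λ t → Admissible D (suc k) (proj₂ (proj₂ t)))
    (if D 0 then [] else map neither (terms (D ∘ suc) k) ++ map cancel (terms (D ∘ suc) k))
  rest true  e rewrite e = []
  rest false e rewrite e = AllP.++⁺ (AllP.map⁺ (All.map (weak e false) IH)) (AllP.map⁺ (All.map (weak e true) IH))

-- The number of ascents before place i, hence the smallest weakly increasing word, rising by one at
-- each place of S.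
level : List Bool → ℕ → ℕ
level S       zero    = 0
level []      (suc i) = 0
level (b ∷ S) (suc i) = (if b then 1 else 0) ℕ.+ level S i

SameOrder : ℕ → ℕ → ℕ → ℕ → Set
SameOrder a l a′ l′ = (a ≡ a′ × l ≡ l′) ⊎ (a < a′ × l < l′)

SameOrder-<ᵇ : ∀ {a l a′ l′} → SameOrder a l a′ l′ → (a <ᵇ a′) ≡ (l <ᵇ l′)
SameOrder-<ᵇ {a} {l} (inj₁ (refl , refl)) = trans (<ᵇ-false (ℕP.≤-refl {a})) (sym (<ᵇ-false (ℕP.≤-refl {l})))
SameOrder-<ᵇ (inj₂ (p , q)) = trans (<ᵇ-true p) (sym (<ᵇ-true q))

SameOrder->ᵇ : ∀ {a l a′ l′} → SameOrder a l a′ l′ → (a′ <ᵇ a) ≡ (l′ <ᵇ l)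
SameOrder->ᵇ {a} {l} (inj₁ (refl , refl)) = trans (<ᵇ-false (ℕP.≤-refl {a})) (sym (<ᵇ-false (ℕP.≤-refl {l})))
SameOrder->ᵇ (inj₂ (p , q)) = trans (<ᵇ-false (ℕP.<⇒≤ p)) (sym (<ᵇ-false (ℕP.<⇒≤ q)))

level-head : ∀ D v → link st D v ≡ true → ∀ j → j < length v → SameOrder (nth v 0) 0 (nth v j) (level (ascents v) j)
level-head D (x ∷ v)     s zero    _ = inj₁ (refl , refl)
level-head D (x ∷ [])    s (suc j) (s≤s ())
level-head D (x ∷ y ∷ l) s (suc j) (s≤s j<)
  with ℕP.<-cmp x y | level-head (D ∘ suc) (y ∷ l) (∧-conicalʳ (st (D 0) x y) _ s) j j<
... | tri< p _ _    | inj₁ (e , _)  rewrite <ᵇ-true p = inj₂ (ℕP.<-≤-trans p (ℕP.≤-reflexive e) , s≤s z≤n)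
... | tri< p _ _    | inj₂ (q , _)  rewrite <ᵇ-true p = inj₂ (ℕP.<-trans p q , s≤s z≤n)
... | tri≈ _ refl _ | r             rewrite <ᵇ-false (ℕP.≤-refl {x}) = r
... | tri> _ _ p    | _             = contradiction (trans (sym (st-> (D 0) p)) (∧-conicalˡ (st (D 0) x y) _ s)) false≢true

level-SameOrder : ∀ D v → link st D v ≡ true → ∀ i j → i ≤ j → j < length v →
  SameOrder (nth v i) (level (ascents v) i) (nth v j) (level (ascents v) j)
level-SameOrder D v           s zero    j       _         j<       = level-head D v s j j<
level-SameOrder D (x ∷ [])    s (suc i) (suc j) _         (s≤s ())
level-SameOrder D (x ∷ y ∷ l) s (suc i) (suc j) (s≤s i≤j) (s≤s j<)
  with level-SameOrder (D ∘ suc) (y ∷ l) (∧-conicalʳ (st (D 0) x y) _ s) i j i≤j j<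
... | inj₁ (e , e′) = inj₁ (e , cong ((if x <ᵇ y then 1 else 0) ℕ.+_) e′)
... | inj₂ (q , q′) = inj₂ (q , ℕP.+-monoʳ-< (if x <ᵇ y then 1 else 0) q′)

level-<ᵇ : ∀ D v → link st D v ≡ true → ∀ {i j} → i < length v → j < length v →
  (nth v i <ᵇ nth v j) ≡ (level (ascents v) i <ᵇ level (ascents v) j)
level-<ᵇ D v s {i} {j} i< j< with ℕP.≤-total i j
... | inj₁ i≤j = SameOrder-<ᵇ (level-SameOrder D v s i j i≤j j<)
... | inj₂ j≤i = SameOrder->ᵇ (level-SameOrder D v s j i j≤i i<)

-- Read along σ this word gives the levels of S, so for S containing the descents of σ the value of
-- a quasisymmetric series here is its coefficient on M_(S,σ).
representative : ∀ {n} → Permutation′ n → List Bool → List ℕ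
representative σ S = tabulate λ p → level S (toℕ (σ ⟨$⟩ˡ p))

Pointwise-tabulate : ∀ {R : ℕ → ℕ → Set} w (g : Fin (length w) → ℕ) → (∀ p → R (letter w p) (g p)) → Pointwise R w (tabulate g)
Pointwise-tabulate []      g r = []
Pointwise-tabulate (x ∷ w) g r = r zero ∷ Pointwise-tabulate w (g ∘ suc) (r ∘ suc)

sorted-letters : ∀ {n} → Permutation′ n → List ℕ → List ℕ
sorted-letters σ w = map (letter w) (image σ)

sorted-letters-tabulate : ∀ {n} (σ : Permutation′ n) w → sorted-letters σ w ≡ tabulate (λ i → letter w (σ ⟨$⟩ʳ i))
sorted-letters-tabulate σ w = trans (cong (map (letter w)) (map-tabulate id (σ ⟨$⟩ʳ_))) (map-tabulate (σ ⟨$⟩ʳ_) (letter w))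

-- The relabelling `R` sends each letter of w to its level in the sorted word. It preserves order
-- because letters and levels rise at the same places.
QSym-representative : ∀ {f} → QSym f → ∀ {n} (σ : Permutation′ n) D w → length w ≡ n →
  link st D (sorted-letters σ w) ≡ true → f w ≡ f (representative σ (ascents (sorted-letters σ w)))
QSym-representative {f} q σ D w refl s = q {R} order
  (Pointwise-tabulate w _ λ p → p , refl , refl)
  where
  n = length w
  v = sorted-letters σ w
  R : ℕ → ℕ → Set
  R a b = ∃ λ (p : Fin n) → a ≡ letter w p × b ≡ level (ascents v) (toℕ (σ ⟨$⟩ˡ p))
  bound : ∀ (i : Fin n) → toℕ i < length v
  bound i = ℕP.<-≤-trans (FinP.toℕ<n i) (ℕP.≤-reflexive (sym (trans (cong length (sorted-letters-tabulate σ w)) (length-tabulate {n = n} (λ i → letter w (σ ⟨$⟩ʳ i))))))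
  at : ∀ p → nth v (toℕ (σ ⟨$⟩ˡ p)) ≡ letter w p
  at p = trans (cong (λ l → nth l (toℕ (σ ⟨$⟩ˡ p))) (sorted-letters-tabulate σ w))
    (trans (nth-tabulate (λ i → letter w (σ ⟨$⟩ʳ i)) (σ ⟨$⟩ˡ p)) (cong (letter w) (inverseʳ σ)))
  order : OrderPreserving R
  order (p , refl , refl) (p′ , refl , refl) = trans (cong₂ _<ᵇ_ (sym (at p)) (sym (at p′)))
    (level-<ᵇ D v s (bound (σ ⟨$⟩ˡ p)) (bound (σ ⟨$⟩ˡ p′)))

subset : List Bool → ℕ → Bool
subset A zero    = false
subset A (suc k) = bit A k

BasisTerm : Set
BasisTerm = List ℕ × ℚ × Pair

contribution : Series → List ℕ → BasisTerm → ℚ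
contribution f w (r , c , α) = f r * (c * F α w)

basisTerm : ∀ {n} → Permutation′ n → Term → BasisTerm
basisTerm σ (S , c , A) = representative σ S , c , pair _ (subset A) σ

basis : ℕ → List BasisTerm
basis n = concatMap (λ σ → map (basisTerm σ) (terms (descents σ (allFin n)) (n ∸ 1))) (permutations n)

length-sorted-letters : ∀ {n} (σ : Permutation′ n) w → length (sorted-letters σ w) ≡ n
length-sorted-letters {n} σ w = trans (length-map (letter w) (image σ)) (trans (length-map (σ ⟨$⟩ʳ_) (allFin n)) (length-tabulate id))

-- The value f w is assigned to the one σ that standardises w, read off at the representative, and
-- spread over the sets A by inclusion-exclusion. In the result the coefficients `f r * c` no longer
-- mention w, so they define a combination.
expansion : ∀ {f} → QSym f → ∀ n w → length w ≡ n → f w ≡ ∑ (basis n) (contribution f w)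
expansion {f} q n w l = begin
  f w
    ≡⟨ *-identityˡ (f w) ⟨
  1ℚ * f w
    ≡⟨ cong (_* f w) (∑-standardisations n w) ⟨
  ∑ (permutations n) (λ σ → ⟦ link st (D σ) (v σ) ⟧) * f w
    ≡⟨ ∑-*ʳ (permutations n) (f w) _ ⟨
  ∑ (permutations n) (λ σ → ⟦ link st (D σ) (v σ) ⟧ * f w)
    ≡⟨ ∑-cong (permutations n) summand ⟩
  ∑ (permutations n) (λ σ → ∑ (map (basisTerm σ) (terms (D σ) (n ∸ 1))) (contribution f w))
    ≡⟨ ∑-concatMap _ (permutations n) (contribution f w) ⟨
  ∑ (basis n) (contribution f w) ∎
  where
  open ≡-Reasoning
  D : Permutation′ n → ℕ → Bool
  D σ = descents σ (allFin n)
  v : Permutation′ n → List ℕ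
  v σ = sorted-letters σ w
  F-value′ : ∀ σ A → F (pair n (subset A) σ) w ≡ ⟦ link st (bit A) (v σ) ⟧
  F-value′ σ A = trans (F-chainSeries n (subset A) σ w) (cong (λ b → if b then ⟦ link st (bit A) (v σ) ⟧ else 0ℚ) (≡ᵇ-true l))
  select : ∀ σ → ⟦ link st (D σ) (v σ) ⟧ * f w ≡ f (representative σ (ascents (v σ))) * ⟦ link st (D σ) (v σ) ⟧
  select σ with link st (D σ) (v σ) in s
  ... | true  = trans (*-comm 1ℚ (f w)) (cong (_* 1ℚ) (QSym-representative q σ (D σ) w l s))
  ... | false = trans (*-zeroˡ (f w)) (sym (*-zeroʳ (f (representative σ (ascents (v σ))))))
  summand : ∀ σ → ⟦ link st (D σ) (v σ) ⟧ * f w ≡ ∑ (map (basisTerm σ) (terms (D σ) (n ∸ 1))) (contribution f w)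
  summand σ = begin
    ⟦ link st (D σ) (v σ) ⟧ * f w
      ≡⟨ select σ ⟩
    f (representative σ (ascents (v σ))) * ⟦ link st (D σ) (v σ) ⟧
      ≡⟨ ∑-terms (v σ) (D σ) (f ∘ representative σ) ⟨
    ∑ (terms (D σ) (length (v σ) ∸ 1)) (term-value (f ∘ representative σ) (v σ))
      ≡⟨ cong (λ k → ∑ (terms (D σ) (k ∸ 1)) (term-value (f ∘ representative σ) (v σ))) (length-sorted-letters σ w) ⟩
    ∑ (terms (D σ) (n ∸ 1)) (term-value (f ∘ representative σ) (v σ))
      ≡⟨ ∑-cong (terms (D σ) (n ∸ 1)) (λ (S , c , A) → cong (λ x → f (representative σ S) * (c * x)) (sym (F-value′ σ A))) ⟩
    ∑ (terms (D σ) (n ∸ 1)) (contribution f w ∘ basisTerm σ)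
      ≡⟨ ∑-map (basisTerm σ) (terms (D σ) (n ∸ 1)) (contribution f w) ⟨
    ∑ (map (basisTerm σ) (terms (D σ) (n ∸ 1))) (contribution f w) ∎

F-degree : ∀ α w → length w ≢ deg α → F α w ≡ 0ℚ
F-degree (pair n A σ) w l = trans (F-chainSeries n A σ w) (chainSeries-degree (A ∘ suc) (image σ) w l)

IsBasisTerm : ℕ → BasisTerm → Set
IsBasisTerm n (_ , _ , α) = IsStandard α × deg α ≡ n

bit-length : ∀ A i → bit A i ≡ true → i < length A
bit-length (b ∷ A) zero    _ = s≤s z≤n
bit-length (b ∷ A) (suc i) e = s≤s (bit-length A i e)

subset-standard : ∀ {n} (σ : Permutation′ n) {A} → Admissible (descents σ (allFin n)) (n ∸ 1) A → IsStandard (pair n (subset A) σ)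
subset-standard {n} σ {A} (l , a) = range , contains
  where
  range : ∀ i → subset A i ≡ true → 1 ≤ i × i < n
  range (suc i) e = s≤s z≤n , inside n (ℕP.<-≤-trans (bit-length A i e) (ℕP.≤-reflexive l))
    where
    inside : ∀ n → i < n ∸ 1 → suc i < n
    inside (suc n) l = s≤s l
  contains : ∀ i → Des σ i ≡ true → subset A i ≡ true
  contains (suc i) e = a i (below-pred n (<ᵇ⁻ (suc i) n (∧-conicalˡ _ _ e))) (trans (descents-allFin σ i) e)
    where
    below-pred : ∀ n → suc i < n → i < n ∸ 1
    below-pred (suc n) (s≤s l) = l

basis-valid : ∀ n → All (IsBasisTerm n) (basis n)
basis-valid n = AllP.concat⁺ (AllP.map⁺ (All.universal (λ σ → AllP.map⁺
  (All.map (λ a → subset-standard σ a , refl) (terms-Admissible (descents σ (allFin n)) (n ∸ 1)))) (permutations n)))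

∑-basis-other : ∀ f n w → length w ≢ n → ∑ (basis n) (contribution f w) ≡ 0ℚ
∑-basis-other f n w l = trans (∑-cong-All (basis-valid n) λ (r , c , α) (_ , d) →
    trans (cong (λ x → f r * (c * x)) (F-degree α w (λ e → l (trans e d))))
      (trans (cong (f r *_) (*-zeroʳ c)) (*-zeroʳ (f r))))
  (∑-0 (basis n))

basisUpTo : ℕ → List BasisTerm
basisUpTo zero    = basis zero
basisUpTo (suc N) = basis (suc N) ++ basisUpTo N

basisUpTo-standard : ∀ N → All (λ b → IsStandard (proj₂ (proj₂ b))) (basisUpTo N)
basisUpTo-standard zero    = All.map proj₁ (basis-valid zero)
basisUpTo-standard (suc N) = AllP.++⁺ (All.map proj₁ (basis-valid (suc N))) (basisUpTo-standard N)

∑-basisUpTo-other : ∀ f N w → N < length w → ∑ (basisUpTo N) (contribution f w) ≡ 0ℚ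
∑-basisUpTo-other f zero    w l = ∑-basis-other f zero w (≢-sym (ℕP.<⇒≢ l))
∑-basisUpTo-other f (suc N) w l = trans (∑-++ (basis (suc N)) (basisUpTo N) (contribution f w))
  (cong₂ _+_ (∑-basis-other f (suc N) w (≢-sym (ℕP.<⇒≢ l))) (∑-basisUpTo-other f N w (ℕP.<-trans (ℕP.n<1+n N) l)))

expansion-≤ : ∀ {f} → QSym f → ∀ N w → length w ≤ N → f w ≡ ∑ (basisUpTo N) (contribution f w)
expansion-≤ q zero    w l = expansion q zero w (ℕP.n≤0⇒n≡0 l)
expansion-≤ {f} q (suc N) w l = trans (split (ℕP.m≤n⇒m<n∨m≡n l)) (sym (∑-++ (basis (suc N)) (basisUpTo N) (contribution f w)))
  where
  split : length w < suc N ⊎ length w ≡ suc N → f w ≡ ∑ (basis (suc N)) (contribution f w) + ∑ (basisUpTo N) (contribution f w)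
  split (inj₁ (s≤s l′)) = trans (expansion-≤ q N w l′) (trans (sym (+-identityˡ _))
    (cong (_+ ∑ (basisUpTo N) (contribution f w)) (sym (∑-basis-other f (suc N) w (ℕP.<⇒≢ (s≤s l′))))))
  split (inj₂ e) = trans (expansion q (suc N) w e) (trans (sym (+-identityʳ _))
    (cong (∑ (basis (suc N)) (contribution f w) +_) (sym (∑-basisUpTo-other f N w (ℕP.≤-reflexive (sym e))))))

-- Finite combinations from series of bounded degree

Bounded : ℕ → Series → Set
Bounded N f = ∀ w → N < length w → f w ≡ 0ℚ

expansion-bounded : ∀ {f N} → QSym f → Bounded N f → ∀ w → f w ≡ ∑ (basisUpTo N) (contribution f w)
expansion-bounded {f} {N} q b w with ℕP.<-≤-connex N (length w)
... | inj₁ l = trans (b w l) (sym (∑-basisUpTo-other f N w l))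
... | inj₂ l = expansion-≤ q N w l

toComb : ℕ → Series → Comb
toComb N f = map (λ (r , c , α) → f r * c , α) (basisUpTo N)

toComb-standard : ∀ N f → StdComb (toComb N f)
toComb-standard N f = AllP.map⁺ (basisUpTo-standard N)

evalF-toComb : ∀ {f N} → QSym f → Bounded N f → evalF (toComb N f) ≈ f
evalF-toComb {f} {N} q b w = trans (∑-map (λ (r , c , α) → f r * c , α) (basisUpTo N) (λ t → proj₁ t * F (proj₂ t) w))
  (trans (∑-cong (basisUpTo N) λ (r , c , α) → *-assoc (f r) c (F α w)) (sym (expansion-bounded q b w)))

toComb₂ : ℕ → Series₂ → Comb₂
toComb₂ N f = concatMap (λ (r , c , α) → map (λ (s , d , β) → (f r s * d) * c , α , β) (basisUpTo N)) (basisUpTo N)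

toComb₂-standard : ∀ N f → StdComb₂ (toComb₂ N f)
toComb₂-standard N f = AllP.concat⁺ (AllP.map⁺ (All.map (λ a → AllP.map⁺ (All.map (λ b → a , b) (basisUpTo-standard N))) (basisUpTo-standard N)))

-- One expansion per tensor factor: first in v, with the other word held at a representative r, then
-- in u. Quasisymmetry and bounded degree therefore enter separately in each variable.
evalF₂-toComb₂ : ∀ {f : Series₂} {N} → (∀ v → QSym (λ u → f u v)) → (∀ u → QSym (f u)) →
  (∀ v → Bounded N (λ u → f u v)) → (∀ u → Bounded N (f u)) → evalF₂ (toComb₂ N f) ≈₂ f
evalF₂-toComb₂ {f} {N} q q′ b b′ u v = begin
  evalF₂ (toComb₂ N f) u v
    ≡⟨ ∑-concatMap _ B val ⟩
  ∑ B (λ (r , c , α) → ∑ (map (λ (s , d , β) → (f r s * d) * c , α , β) B) val)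
    ≡⟨ ∑-cong B (λ (r , c , α) → trans (∑-map (λ (s , d , β) → (f r s * d) * c , α , β) B val) (trans
         (∑-cong B λ (s , d , β) → regroup (f r s) d c (F α u) (F β v))
         (∑-*ʳ B (c * F α u) (contribution (f r) v)))) ⟩
  ∑ B (λ (r , c , α) → ∑ B (contribution (f r) v) * (c * F α u))
    ≡⟨ ∑-cong B (λ (r , c , α) → cong (_* (c * F α u)) (expansion-bounded (q′ r) (b′ r) v)) ⟨
  ∑ B (contribution (λ u → f u v) u)
    ≡⟨ expansion-bounded (q v) (b v) u ⟨
  f u v ∎
  where
  open ≡-Reasoning
  B = basisUpTo N
  val : ℚ × Pair × Pair → ℚ
  val t = proj₁ t * (F (proj₁ (proj₂ t)) u * F (proj₂ (proj₂ t)) v)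
  regroup : ∀ a d c p q → ((a * d) * c) * (p * q) ≡ (a * (d * q)) * (c * p)
  regroup = solve 5 (λ a d c p q → ((a :* d) :* c) :* (p :* q) := (a :* (d :* q)) :* (c :* p)) refl

-- The descent-to-peak map

evalF-bounded : ∀ c → ∃ λ N → Bounded N (evalF c)
evalF-bounded []            = 0 , λ _ _ → refl
evalF-bounded ((q , α) ∷ c) with evalF-bounded c
... | N , b = deg α ⊔ N , λ w l → cong₂ _+_
  (trans (cong (q *_) (F-degree α w (≢-sym (ℕP.<⇒≢ (ℕP.≤-<-trans (ℕP.m≤m⊔n (deg α) N) l))))) (*-zeroʳ q))
  (b w (ℕP.≤-<-trans (ℕP.m≤n⊔m (deg α) N) l))

⋆-bounded : ∀ {f g M N} → Bounded M f → Bounded N g → Bounded (M ℕ.+ N) (f ⋆ g)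
⋆-bounded {f} {g} {M} {N} bf bg w l = trans (∑-cong (upTo (suc (length w))) vanish) (∑-0 (upTo (suc (length w))))
  where
  vanish : ∀ k → f (take k w) * g (drop k w) ≡ 0ℚ
  vanish k with ℕP.<-≤-connex M (length (take k w))
  ... | inj₁ M< = trans (cong (_* g (drop k w)) (bf (take k w) M<)) (*-zeroˡ (g (drop k w)))
  ... | inj₂ ≤M = trans (cong (f (take k w) *_) (bg (drop k w) (ℕP.≰⇒> λ ≤N → ℕP.<⇒≱ l (ℕP.≤-trans
    (ℕP.≤-reflexive (trans (cong length (sym (take++drop≡id k w))) (length-++ (take k w)))) (ℕP.+-mono-≤ ≤M ≤N)))))
    (*-zeroʳ (f (take k w)))

shuffles-length : ∀ u v → All (λ s → length s ≡ length u ℕ.+ length v) (shuffles u v)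
shuffles-length []      v       = refl ∷ []
shuffles-length (x ∷ u) []      = sym (ℕP.+-identityʳ (suc (length u))) ∷ []
shuffles-length (x ∷ u) (y ∷ v) = AllP.++⁺
  (AllP.map⁺ (All.map (cong suc) (shuffles-length u (y ∷ v))))
  (AllP.map⁺ (All.map (λ e → trans (cong suc e) (sym (ℕP.+-suc (suc (length u)) (length v)))) (shuffles-length (x ∷ u) v)))

Δ-vanishes : ∀ {N f} → Bounded N f → ∀ u v → N < length u ℕ.+ length v → Δ f u v ≡ 0ℚ
Δ-vanishes {N} b u v l = trans
  (∑-cong-All (shuffles-length u v′) λ s e → b s (ℕP.<-≤-trans l (ℕP.≤-reflexive
    (sym (trans e (cong (length u ℕ.+_) (length-map (ℕ._+ suc (maxL u)) v)))))))
  (∑-0 (shuffles u v′))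
  where v′ = map (ℕ._+ suc (maxL u)) v

Δ-cong : ∀ {f g} → f ≈ g → Δ f ≈₂ Δ g
Δ-cong e u v = ∑-cong (shuffles u _) e

⋆-cong : ∀ {f f′ g g′} → f ≈ f′ → g ≈ g′ → (f ⋆ g) ≈ (f′ ⋆ g′)
⋆-cong e e′ w = ∑-cong (upTo (suc (length w))) λ k → cong₂ _*_ (e (take k w)) (e′ (drop k w))

T-𝟙 : ∀ n w → T n 𝟙 w ≡ 𝟙 w
T-𝟙 n []      = refl
T-𝟙 n (m ∷ w) = trans (∑-cong (allFin n) λ t → trans (cong (wt (toℕ t) *_) (T-zero n w)) (*-zeroʳ (wt (toℕ t)))) (∑-0 (allFin n))

toKData : PeakChoice → Pair → KData
toKData g α = deg α , chain (deg α) , g α , σ α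

toKComb : PeakChoice → Comb → KComb
toKComb g = map λ (q , α) → q , toKData g α

evalK-toKComb : ∀ g c → evalK (toKComb g c) ≈ Θ g c
evalK-toKComb g c w = cong sumℚ (sym (map-∘ c))

toKComb₂ : PeakChoice → Comb₂ → KComb₂
toKComb₂ g = map λ (q , α , β) → q , toKData g α , toKData g β

evalK₂-toKComb₂ : ∀ g e → evalK₂ (toKComb₂ g e) ≈₂ Θ₂ g e
evalK₂-toKComb₂ g e u v = cong sumℚ (sym (map-∘ e))

scale : ℚ → Comb → Comb
scale q = map λ (p , α) → q * p , α

Θ-scale : ∀ g q c w → Θ g (scale q c) w ≡ q * Θ g c w
Θ-scale g q c w = trans (∑-map (λ (p , α) → q * p , α) c (λ t → proj₁ t * ΘK g (proj₂ t) w))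
  (trans (∑-cong c λ (p , α) → *-assoc q p (ΘK g α w)) (∑-*ˡ c q (λ t → proj₁ t * ΘK g (proj₂ t) w)))

-- The generating series of plain (P,γ)-partitions.
F-poset : KData → Series
F-poset (n , P , γ , σ) w =
  ∑ (perms (allFin n)) λ π → ⟦ ext (below P) π ⟧ * chainSeries n (descents γ π) (map (σ ⟨$⟩ʳ_) π) w

F-poset-QSym : ∀ k → QSym (F-poset k)
F-poset-QSym (n , P , γ , σ) = ∑-QSym (perms (allFin n)) (λ π → ⟦ ext (below P) π ⟧)
  (λ π → chainSeries n (descents γ π) (map (σ ⟨$⟩ʳ_) π)) (λ π → chainSeries-QSym n (descents γ π) (map (σ ⟨$⟩ʳ_) π))

F-poset-degree : ∀ (k : KData) w → length w ≢ proj₁ k → F-poset k w ≡ 0ℚ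
F-poset-degree (n , P , γ , σ) w l = trans
  (∑-cong (perms (allFin n)) λ π → trans (cong (⟦ ext (below P) π ⟧ *_) (chainSeries-degree (descents γ π) (map (σ ⟨$⟩ʳ_) π) w l)) (*-zeroʳ ⟦ ext (below P) π ⟧))
  (∑-0 (perms (allFin n)))

poset-value : KData → List ℕ → ℕ → ℚ
poset-value k w zero    = Kof k w
poset-value k w (suc N) = T (suc N) (F-poset k) w

-- Interpolation works on each linear extension separately, and at 0 the chain counts add up to
-- K_(P,γ,σ). So Θ takes the series of plain (P,γ)-partitions to that of the enriched ones.
poset-value-Poly : ∀ k w → Poly (poset-value k w)
poset-value-Poly (n , P , γ , σ) w = Poly-cong eq (Poly-∑ (perms-↭ (allFin n)) λ π p → Poly-* (Poly-const ⟦ ext (below P) π ⟧)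
    (chainSeries-Poly (descents γ π) (↭-trans (PermP.map⁺ (σ ⟨$⟩ʳ_) p) (image-↭ σ)) w))
  where
  val : List (Fin n) → ℕ → ℚ
  val π = chainSeries-value n (descents γ π) (map (σ ⟨$⟩ʳ_) π) w
  eq : ∀ N → ∑ (perms (allFin n)) (λ π → ⟦ ext (below P) π ⟧ * val π N) ≡ poset-value (n , P , γ , σ) w N
  eq (suc N) = sym (T-linear (suc N) (perms (allFin n)) (λ π → ⟦ ext (below P) π ⟧)
    (λ π → chainSeries n (descents γ π) (map (σ ⟨$⟩ʳ_) π)) w)
  eq zero with length w ℕ.≟ n
  ... | yes l = trans (∑-cong (perms (allFin n)) λ π → cong (⟦ ext (below P) π ⟧ *_) (trans
          (cong (if_then TK.total (descents γ π) (map (letter w) (map (σ ⟨$⟩ʳ_) π)) else 0ℚ) (≡ᵇ-true l))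
          (cong (TK.total (descents γ π)) (sym (map-∘ π)))))
        (sym (K-linear-extensions P γ σ w l))
  ... | no l = trans (∑-cong (perms (allFin n)) λ π → trans (cong (⟦ ext (below P) π ⟧ *_)
          (cong (if_then TK.total (descents γ π) (map (letter w) (map (σ ⟨$⟩ʳ_) π)) else 0ℚ) (≡ᵇ-false l)))
          (*-zeroʳ ⟦ ext (below P) π ⟧))
        (trans (∑-0 (perms (allFin n))) (sym (K-degree P γ σ w l)))

module DescentToPeak (g : PeakChoice) (valid : ValidPeakChoice g) where

  Θ-unit : (c : Comb) → StdComb c → evalF c ≈ 𝟙 → Θ g c ≈ 𝟙
  Θ-unit c std e w = Poly-unique (Θ-value-Poly g valid std w) (Poly-const (𝟙 w)) λ N →
    trans (Θ-value-suc g c w N) (trans (T-cong (suc N) w e) (T-𝟙 (suc N) w))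

  -- Every T n is the identity on the coefficient of the empty word, so the interpolating sequence
  -- is constant.
  Θ-counit : (c : Comb) → StdComb c → counit (Θ g c) ≡ counit (evalF c)
  Θ-counit c std = Poly-unique (Θ-value-Poly g valid std []) (Poly-const (evalF c [])) (Θ-value-suc g c [])

  Θ-⋆ : (c d e : Comb) → StdComb c → StdComb d → StdComb e → evalF e ≈ (evalF c ⋆ evalF d) → Θ g e ≈ (Θ g c ⋆ Θ g d)
  Θ-⋆ c d e sc sd se h w = Poly-unique (Θ-value-Poly g valid se w)
    (Poly-∑′ ks (λ k → Poly-* (Θ-value-Poly g valid sc (take k w)) (Θ-value-Poly g valid sd (drop k w))))
    λ N → begin
      Θ-value g e w (suc N)
        ≡⟨ Θ-value-suc g e w N ⟩
      T (suc N) (evalF e) w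
        ≡⟨ T-cong (suc N) w h ⟩
      T (suc N) (evalF c ⋆ evalF d) w
        ≡⟨ T-⋆ (suc N) (evalF c) (evalF d) w ⟩
      (T (suc N) (evalF c) ⋆ T (suc N) (evalF d)) w
        ≡⟨ ∑-cong ks (λ k → cong₂ _*_ (Θ-value-suc g c (take k w) N) (Θ-value-suc g d (drop k w) N)) ⟨
      ∑ ks (λ k → Θ-value g c (take k w) (suc N) * Θ-value g d (drop k w) (suc N)) ∎
    where
    open ≡-Reasoning
    ks = upTo (suc (length w))

  Θ-Δ : (c : Comb) (e : Comb₂) → StdComb c → StdComb₂ e → Δ (evalF c) ≈₂ evalF₂ e → Δ (Θ g c) ≈₂ Θ₂ g e
  Θ-Δ c e sc se h u v = Poly-unique
    -- The list `sh` depends on u and v alone, so the coproduct of the whole family at (u , v) is a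
    -- fixed finite sum of polynomial sequences.
    (Poly-∑′ sh (λ s → Θ-value-Poly g valid sc s))
    (Poly-∑ se λ (q , α , β) (a , b) → Poly-* (Poly-const q) (Poly-* (F-value-Poly g valid α a u) (F-value-Poly g valid β b v)))
    λ N → begin
      ∑ sh (λ s → Θ-value g c s (suc N))
        ≡⟨ ∑-cong sh (λ s → Θ-value-suc g c s N) ⟩
      Δ (T (suc N) (evalF c)) u v
        ≡⟨ Δ-T (suc N) (evalF-QSym c) u v ⟩
      T₂ (suc N) (Δ (evalF c)) u v
        ≡⟨ T-cong (suc N) u (λ x → T-cong (suc N) v (h x)) ⟩
      T₂ (suc N) (evalF₂ e) u v
        ≡⟨ T₂-linear (suc N) e proj₁ (λ (_ , α , β) x y → F α x * F β y) u v ⟩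
      ∑ e (λ (q , α , β) → q * T₂ (suc N) (λ x y → F α x * F β y) u v)
        ≡⟨ ∑-cong e (λ (q , α , β) → cong (q *_) (T₂-product (suc N) (F α) (F β) u v)) ⟩
      ∑ e (λ (q , α , β) → q * (T (suc N) (F α) u * T (suc N) (F β) v)) ∎
    where
    open ≡-Reasoning
    sh = shuffles u (map (ℕ._+ suc (maxL u)) v)
    T-scale : ∀ n k f w → T n (λ x → k * f x) w ≡ k * T n f w
    T-scale n k f w = trans (T-cong n w λ x → sym (+-identityʳ (k * f x)))
      (trans (T-+ n k f (λ _ → 0ℚ) w) (trans (cong (k * T n f w +_) (T-zero n w)) (+-identityʳ _)))
    T₂-product : ∀ n f h u v → T₂ n (λ x y → f x * h y) u v ≡ T n f u * T n h v
    T₂-product n f h u v = trans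
      (T-cong n u λ x → trans (T-scale n (f x) h v) (*-comm (f x) (T n h v)))
      (trans (T-scale n (T n h v) f u) (*-comm (T n h v) (T n f u)))

  -- The preimage is the standard expansion of the plain series `F-poset k`: for n ≥ 1 both families
  -- are T n of that series, so they agree at 0.
  K-image : (k : KData) → Σ Comb (λ c → StdComb c × (Θ g c ≈ Kof k))
  K-image k = c , std , λ w → Poly-unique (Θ-value-Poly g valid std w) (poset-value-Poly k w) λ N →
    trans (Θ-value-suc g c w N) (T-cong (suc N) w (evalF-toComb (F-poset-QSym k) bounded))
    where
    c = toComb (proj₁ k) (F-poset k)
    std = toComb-standard (proj₁ k) (F-poset k)
    bounded : Bounded (proj₁ k) (F-poset k)
    bounded w l = F-poset-degree k w (≢-sym (ℕP.<⇒≢ l))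

  -- Membership in the image of Θ. As every K lies in this image, closure of NCΠ under product and
  -- coproduct reduces to re-expanding products and coproducts of the preimages in the standard
  -- basis.
  HasPreimage : Series → Set
  HasPreimage f = Σ Comb (λ c → StdComb c × (Θ g c ≈ f))

  HasPreimage-linear : ∀ q {f h} → HasPreimage f → HasPreimage h → HasPreimage (λ w → q * f w + h w)
  HasPreimage-linear q (c , sc , ec) (d , sd , ed) = scale q c ++ d , AllP.++⁺ (AllP.map⁺ sc) sd , λ w →
    trans (∑-++ (scale q c) d (λ t → proj₁ t * ΘK g (proj₂ t) w))
      (cong₂ _+_ (trans (Θ-scale g q c w) (cong (q *_) (ec w))) (ed w))

  KComb-image : (a : KComb) → HasPreimage (evalK a)
  KComb-image []            = [] , [] , λ _ → refl
  KComb-image ((q , k) ∷ a) = HasPreimage-linear q {Kof k} {evalK a} (K-image k) (KComb-image a)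

  HasPreimage-⋆ : ∀ {f h} → HasPreimage f → HasPreimage h → HasPreimage (f ⋆ h)
  HasPreimage-⋆ {f} {h} (c , sc , ec) (d , sd , ed) = toComb N p , toComb-standard N p , λ w →
    trans (Θ-⋆ c d (toComb N p) sc sd (toComb-standard N p) (evalF-toComb qsym bounded) w) (⋆-cong {Θ g c} {f} {Θ g d} {h} ec ed w)
    where
    p = evalF c ⋆ evalF d
    qsym : QSym p
    qsym = ⋆-QSym (evalF-QSym c) (evalF-QSym d)
    N = proj₁ (evalF-bounded c) ℕ.+ proj₁ (evalF-bounded d)
    bounded : Bounded N p
    bounded = ⋆-bounded (proj₂ (evalF-bounded c)) (proj₂ (evalF-bounded d))

  HasPreimage-Δ : ∀ {f} → HasPreimage f → Σ Comb₂ (λ e → Δ f ≈₂ Θ₂ g e)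
  HasPreimage-Δ {f} (c , sc , ec) = e , λ u v → trans (Δ-cong {f} {Θ g c} (λ w → sym (ec w)) u v)
    (Θ-Δ c e sc (toComb₂-standard N p) (λ u v → sym (p-expansion u v)) u v)
    where
    p = Δ (evalF c)
    N = proj₁ (evalF-bounded c)
    bounded = proj₂ (evalF-bounded c)
    e = toComb₂ N p
    qsym = evalF-QSym c
    p-expansion : evalF₂ e ≈₂ p
    p-expansion = evalF₂-toComb₂
      (λ v o r → Δ-QSym qsym {S = _≡_} o ≡-OrderPreserving r (Pointwise.refl refl))
      (λ u o r → Δ-QSym qsym {R = _≡_} ≡-OrderPreserving o {u} (Pointwise.refl refl) r)
      (λ v u l → Δ-vanishes bounded u v (ℕP.<-≤-trans l (ℕP.m≤m+n (length u) (length v))))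
      (λ u v l → Δ-vanishes bounded u v (ℕP.<-≤-trans l (ℕP.m≤n+m (length v) (length u))))

  NCΠ-unit : Σ KComb (λ a → evalK a ≈ 𝟙)
  NCΠ-unit = (1ℚ , 0 , chain 0 , Permutation.id , Permutation.id) ∷ [] , λ { [] → refl ; (_ ∷ _) → refl }

  NCΠ-⋆ : (a b : KComb) → Σ KComb (λ e → evalK e ≈ (evalK a ⋆ evalK b))
  NCΠ-⋆ a b = as-KComb (HasPreimage-⋆ {evalK a} {evalK b} (KComb-image a) (KComb-image b))
    where
    as-KComb : ∀ {f} → HasPreimage f → Σ KComb (λ e → evalK e ≈ f)
    as-KComb (c , _ , ec) = toKComb g c , λ w → trans (evalK-toKComb g c w) (ec w)

  NCΠ-Δ : (a : KComb) → Σ KComb₂ (λ e → Δ (evalK a) ≈₂ evalK₂ e)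
  NCΠ-Δ a = as-KComb₂ (HasPreimage-Δ {evalK a} (KComb-image a))
    where
    as-KComb₂ : ∀ {f} → Σ Comb₂ (λ e → f ≈₂ Θ₂ g e) → Σ KComb₂ (λ e → f ≈₂ evalK₂ e)
    as-KComb₂ (e , h) = toKComb₂ g e , λ u v → trans (h u v) (sym (evalK₂-toKComb₂ g e u v))

theorem9p6 : (g : PeakChoice) → ValidPeakChoice g →
    ((c : Comb) → StdComb c → evalF c ≈ 𝟙 → Θ g c ≈ 𝟙)
    × ((c : Comb) → StdComb c → counit (Θ g c) ≡ counit (evalF c))
    × ((c d e : Comb) → StdComb c → StdComb d → StdComb e →
    evalF e ≈ (evalF c ⋆ evalF d) → Θ g e ≈ (Θ g c ⋆ Θ g d))
    × ((c : Comb) (e : Comb₂) → StdComb c → StdComb₂ e →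
    Δ (evalF c) ≈₂ evalF₂ e → Δ (Θ g c) ≈₂ Θ₂ g e)
    × ((k : KData) → Σ Comb (λ c → StdComb c × (Θ g c ≈ Kof k)))
    × Σ KComb (λ a → evalK a ≈ 𝟙)
    × ((a b : KComb) → Σ KComb (λ e → evalK e ≈ (evalK a ⋆ evalK b)))
    × ((a : KComb) → Σ KComb₂ (λ e → Δ (evalK a) ≈₂ evalK₂ e))
theorem9p6 g valid = Θ-unit , Θ-counit , Θ-⋆ , Θ-Δ , K-image , NCΠ-unit , NCΠ-⋆ , NCΠ-Δ
  where open DescentToPeak g valid
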